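{- Let $p_{\xi}(n)$ be defined by $\sum_{n\ge 0} p_{\xi}(n)q^n=\xi(q)$. Then \begin{align*} \sum_{n=0}^{\infty} p_{\xi}(4n)q^n & = 4q^2\frac{f_{12}^6}{f_{3}^2f_{6}^3} - q^2 \omega(-q^3) + \frac{f_2^4f_6^5}{f_1^2f_3^4f_{12}^2},\\ \sum_{n=0}^{\infty} p_{\xi}(4n+1)q^n & = 2q\frac{f_{6}^3f_{12}^2}{f_{3}^4} + 2\frac{f_{4}^4f_{6}^5}{f_{2}^2f_{3}^4f_{12}^2},\\ \sum_{n=0}^{\infty} p_{\xi}(4n+2)q^n & = \frac{f_{6}^9}{f_{3}^6f_{12}^2} +\frac{f_{2}^{10}f_{12}^2}{f_{1}^4f_{3}^2f_{4}^4f_{6}},\\ 2\sum_{n=0}^{\infty} p_{\xi}(4n+3)q^{n+1} & = \frac{f_{6}^{15}}{f_3^8f_{12}^6} - f(q^6) + 4q\frac{f_{2}^4f_{12}^2}{f_{1}^2f_{3}^2f_{6}}. \end{align*}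
   Context: For $|q|<1$, $(a;q)_0=1$, $(a;q)_n=(1-a)(1-aq)\cdots(1-aq^{n-1})$, $(a;q)_\infty=\lim_{n\to\infty}(a;q)_n$, and $f_k:=(q^k;q^k)_\infty$. $\xi(q)=1+2\sum_{n\ge1}\frac{q^{6n^2-6n+1}}{(q;q^6)_n(q^5;q^6)_n}$ and $p_\xi(n)$ is its $n$-th coefficient. The third order mock theta functions $\omega$ and $f$ are $\omega(q)=\sum_{n\ge0}\frac{q^{2n(n+1)}}{(q;q^2)_{n+1}^2}$ and $f(q)=\sum_{n\ge0}\frac{q^{n^2}}{(-q;q)_n^2}$. -}

module Defs where

open import Data.Nat as ℕ using (ℕ; zero; suc; _∸_; _≤ᵇ_; _≡ᵇ_)
open import Data.Nat.DivMod using (_/_; _%_)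
open import Data.Integer as ℤ using (ℤ; +_; -_)
open import Data.Bool using (if_then_else_)
open import Data.Product using (_×_)
open import Relation.Binary.PropositionalEquality using (_≡_)

PS : Set
PS = ℕ → ℤ

infix 4 _≈_
_≈_ : PS → PS → Set
a ≈ b = ∀ n → a n ≡ b n

sumTo : ℕ → (ℕ → ℤ) → ℤ
sumTo zero    g = + 0
sumTo (suc n) g = sumTo n g ℤ.+ g n

X^ : ℕ → PS
X^ k n = if n ≡ᵇ k then + 1 else + 0

one : PS
one = X^ 0

infixl 6 _⊕_ _⊖_
infixl 7 _⊛_ _⊘_
_⊕_ : PS → PS → PS
(a ⊕ b) n = a n ℤ.+ b n

_·_ : ℤ → PS → PS
(c · a) n = c ℤ.* a n

_⊖_ : PS → PS → PS
a ⊖ b = a ⊕ ((- + 1) · b)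

_⊛_ : PS → PS → PS
(a ⊛ b) n = sumTo (suc n) (λ i → a i ℤ.* b (n ∸ i))

pow : PS → ℕ → PS
pow a zero    = one
pow a (suc k) = a ⊛ pow a k

-- multiplicative inverse of a series with constant term 1
-- (only ever applied to such series below).
-- invUpTo a n m is the m-th coefficient of a⁻¹, valid for m ≤ n.
invUpTo : PS → ℕ → ℕ → ℤ
invUpTo a zero    m = + 1
invUpTo a (suc n) m =
  if m ≤ᵇ n then invUpTo a n m
  else - sumTo (suc n) (λ j → a (suc j) ℤ.* invUpTo a n (n ∸ j))

inv : PS → PS
inv a n = invUpTo a n n

_⊘_ : PS → PS → PS
a ⊘ b = a ⊛ inv b

-- substitution q ↦ c q^(suc m)
dil : ℤ → ℕ → PS → PS
dil c m a n =
  if (n % suc m) ≡ᵇ 0 then (c ℤ.^ (n / suc m)) ℤ.* a (n / suc m) else + 0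

poch : ℤ → ℕ → ℕ → ℕ → PS
poch c r s zero    = one
poch c r s (suc n) = poch c r s n ⊛ (one ⊖ (c · X^ (r ℕ.+ s ℕ.* n)))

-- f_k = (q^k;q^k)_∞ for k ≥ 1: the N-th coefficient of the infinite product
-- equals that of the first N factors (the others are ≡ 1 mod q^(N+1)).
fq : ℕ → PS
fq k N = poch (+ 1) k k N N

-- formal sum Σ_{m≥0} T m, valid when ord(T m) ≥ m (which holds for all uses):
-- its N-th coefficient is Σ_{m≤N} (T m)_N.
sumSeries : (ℕ → PS) → PS
sumSeries T N = sumTo (suc N) (λ m → T m N)

-- ξ(q) = 1 + 2 Σ_{n≥1} q^(6n²-6n+1) / ((q;q^6)_n (q^5;q^6)_n), reindexed n = m+1
ξ : PS
ξ = one ⊕ ((+ 2) · sumSeries (λ m →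
      X^ (6 ℕ.* m ℕ.* m ℕ.+ 6 ℕ.* m ℕ.+ 1)
        ⊘ (poch (+ 1) 1 6 (suc m) ⊛ poch (+ 1) 5 6 (suc m))))

pξ : ℕ → ℤ
pξ n = ξ n

ω : PS
ω = sumSeries (λ n → X^ (2 ℕ.* n ℕ.* suc n) ⊘ pow (poch (+ 1) 1 2 (suc n)) 2)

mockf : PS
mockf = sumSeries (λ n → X^ (n ℕ.* n) ⊘ pow (poch (- + 1) 1 1 n) 2)

-- Write φ and ψ for Ramanujan's theta functions. The proof rests on two identities,
--   f₆ ξ(q) = q² f₆ ω(q³) + ψ(q)²   and   f(q⁸) + 2q ω(q) + 2q³ ω(-q⁴) = f₂ f₄⁶ / (f₁² f₈⁴).
-- Inserting the second at q³ into the first writes 2q ξ(q) through f(q²⁴), ω(-q¹²) and eta quotients,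
-- and the eta quotients are split into residue classes mod 4 by φ(q) = φ(q⁴) + 2qψ(q⁸),
-- ψ(q)² = φ(q)ψ(q²), φ(q)² = φ(q²)² + 4qψ(q⁴)² and ψ(q)ψ(q³) = φ(q⁶)ψ(q⁴) + qφ(q²)ψ(q¹²).
--
-- The mock theta functions become Lambert-type series f_b · (mock) = Σ_k: the reciprocals
-- 1/∏_{k≤n} (1 - s p^k + p^{2k+a}) have partial fractions over 1/((p)_{n-k} (p)_{n+k+a}), the sum over n
-- is then evaluated by Durfee rectangles, and letting n → ∞ in the same expansion evaluates theta quotients.
-- The first identity compares such series term by term, after splitting the one for ψ² mod 3. For the
-- second, the product of the series for ψ(q)² = f₂⁴/f₁² and f₄⁴/f₈² is expanded by a partial fraction
-- identity for (1 + q^a)/(1 - q^a) · q^b/(1 + q^{2b}); the resulting inner sums obey first order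
-- recurrences and collapse to monomials times three theta quotients.

module Submission where

import Defs as D
open import Data.Nat as ℕ using (ℕ; zero; suc; pred; _∸_; _≤_; _<_; z≤n; s≤s)
import Data.Nat.Properties as ℕP
open import Data.Nat.Tactic.RingSolver using (solve-∀)
open import Data.Integer as ℤ using (ℤ; +_)
import Data.Integer.Properties as ℤP
open import Data.List using ([]; _∷_)
open import Data.Product using (_×_; _,_)
open import Data.Sum using (_⊎_; inj₁; inj₂)
open import Function using (_∘_)
open import Relation.Nullary using (contradiction)
import Relation.Binary.PropositionalEquality as ≡
open ≡ using (_≡_; _≢_; cong; cong₂; subst)

-- Over ℤ neither 2 nor q is invertible, and this shapes most statements. Sums over all integers are
-- folded onto ℕ, relations with negative exponents are multiplied by a power of q that clears them,
-- 2qξ is dissected in place of ξ, and the only reciprocals taken are of series with constant term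
-- 1.
--
-- The second identity is reached through a product because f₂f₄⁶/(f₁²f₈⁴) is ψ(q)² · f₄⁴/f₈²
-- divided by f₂³f₈²/f₄². The product is a double series over (k, m). Partial fractions cut it into
-- three pieces: one is summed over m first and leaves the series of ω(q); the other two are summed
-- over k first and leave f(q⁸) from the even m and ω(-q⁴) from the odd m. Every inner sum is a
-- monomial times an initial value, `C 0` or `H 0`, and these two initial values supply the common
-- divisor f₂³f₈²/f₄².

module Coefficients where

  -- Coefficientwise calculus: finite sums, Cauchy products, inverses, dilations.

  open D
  open import Data.Nat using (_≡ᵇ_; _≤ᵇ_)
  open import Data.Nat.DivMod using (_/_; _%_; m<n⇒m%n≡m; [m+n]%n≡m%n; m/n≡1+[m∸n]/n)
  open import Data.Integer.Tactic.RingSolver using () renaming (solve-∀ to ℤ-solve-∀)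
  open import Data.Bool using (true; false; T)
  open import Data.Product using (∃)
  open import Data.Unit using (tt)
  open import Relation.Nullary using (yes; no)
  open ≡ hiding ([_]; isEquivalence; setoid)

  sumTo-cong : ∀ n {f g} → (∀ i → i < n → f i ≡ g i) → sumTo n f ≡ sumTo n g
  sumTo-cong zero    h = refl
  sumTo-cong (suc n) h = cong₂ ℤ._+_ (sumTo-cong n λ i i<n → h i (ℕP.m<n⇒m<1+n i<n)) (h n ℕP.≤-refl)

  sumTo-cong′ : ∀ n {f g} → (∀ i → f i ≡ g i) → sumTo n f ≡ sumTo n g
  sumTo-cong′ n h = sumTo-cong n λ i _ → h i

  sumTo-zero : ∀ n {f} → (∀ i → i < n → f i ≡ + 0) → sumTo n f ≡ + 0
  sumTo-zero zero    h = refl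
  sumTo-zero (suc n) h =
    cong₂ ℤ._+_ (sumTo-zero n λ i i<n → h i (ℕP.m<n⇒m<1+n i<n)) (h n ℕP.≤-refl)

  sumTo-head : ∀ n f → sumTo (suc n) f ≡ f 0 ℤ.+ sumTo n (f ∘ suc)
  sumTo-head zero    f = trans (ℤP.+-identityˡ (f 0)) (sym (ℤP.+-identityʳ (f 0)))
  sumTo-head (suc n) f = trans (cong (ℤ._+ f (suc n)) (sumTo-head n f)) (ℤP.+-assoc (f 0) _ _)

  private
    interchange : ∀ a b c d → (a ℤ.+ b) ℤ.+ (c ℤ.+ d) ≡ (a ℤ.+ c) ℤ.+ (b ℤ.+ d)
    interchange = ℤ-solve-∀

  sumTo-+ : ∀ n f g → sumTo n (λ i → f i ℤ.+ g i) ≡ sumTo n f ℤ.+ sumTo n g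
  sumTo-+ zero    f g = refl
  sumTo-+ (suc n) f g =
    trans (cong (ℤ._+ (f n ℤ.+ g n)) (sumTo-+ n f g)) (interchange (sumTo n f) _ _ _)

  sumTo-*ˡ : ∀ n c f → sumTo n (λ i → c ℤ.* f i) ≡ c ℤ.* sumTo n f
  sumTo-*ˡ zero    c f = sym (ℤP.*-zeroʳ c)
  sumTo-*ˡ (suc n) c f =
    trans (cong (ℤ._+ (c ℤ.* f n)) (sumTo-*ˡ n c f)) (sym (ℤP.*-distribˡ-+ c _ _))

  sumTo-swap : ∀ m n (f : ℕ → ℕ → ℤ) →
    sumTo m (λ i → sumTo n (f i)) ≡ sumTo n (λ j → sumTo m (λ i → f i j))
  sumTo-swap zero    n f = sym (sumTo-zero n λ _ _ → refl)
  sumTo-swap (suc m) n f =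
    trans (cong (ℤ._+ sumTo n (f m)) (sumTo-swap m n f)) (sym (sumTo-+ n _ (f m)))

  sumTo-extend : ∀ m k f → (∀ i → m ≤ i → f i ≡ + 0) → sumTo (k ℕ.+ m) f ≡ sumTo m f
  sumTo-extend m zero    f h = refl
  sumTo-extend m (suc k) f h =
    trans (cong₂ ℤ._+_ (sumTo-extend m k f h) (h (k ℕ.+ m) (ℕP.m≤n+m m k))) (ℤP.+-identityʳ _)

  sumTo-extend-≤ : ∀ m n f → m ≤ n → (∀ i → m ≤ i → f i ≡ + 0) → sumTo n f ≡ sumTo m f
  sumTo-extend-≤ m n f m≤n h =
    subst (λ k → sumTo k f ≡ sumTo m f) (ℕP.m∸n+n≡m m≤n) (sumTo-extend m (n ∸ m) f h)

  ⊛-cong : ∀ {a a′ b b′} n → (∀ i → i ≤ n → a i ≡ a′ i) → (∀ i → i ≤ n → b i ≡ b′ i) →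
    (a ⊛ b) n ≡ (a′ ⊛ b′) n
  ⊛-cong n p q =
    sumTo-cong (suc n) λ { i (s≤s i≤n) → cong₂ ℤ._*_ (p i i≤n) (q (n ∸ i) (ℕP.m∸n≤m n i)) }

  ⊛-suc : ∀ a b n → (a ⊛ b) (suc n) ≡ a 0 ℤ.* b (suc n) ℤ.+ ((a ∘ suc) ⊛ b) n
  ⊛-suc a b n = sumTo-head (suc n) (λ i → a i ℤ.* b (suc n ∸ i))

  ⊛-suc′ : ∀ a b n → (a ⊛ b) (suc n) ≡ (a ⊛ (b ∘ suc)) n ℤ.+ a (suc n) ℤ.* b 0
  ⊛-suc′ a b n = cong₂ ℤ._+_
    (sumTo-cong (suc n) λ { i (s≤s i≤n) → cong (λ k → a i ℤ.* b k) (ℕP.+-∸-assoc 1 i≤n) })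
    (cong (λ k → a (suc n) ℤ.* b k) (ℕP.n∸n≡0 n))

  ⊛-comm : ∀ a b → a ⊛ b ≈ b ⊛ a
  ⊛-comm a b zero    = cong (ℤ._+_ (+ 0)) (ℤP.*-comm (a 0) (b 0))
  ⊛-comm a b (suc n) = begin
    (a ⊛ b) (suc n)                             ≡⟨ ⊛-suc a b n ⟩
    a 0 ℤ.* b (suc n) ℤ.+ ((a ∘ suc) ⊛ b) n     ≡⟨ ℤP.+-comm (a 0 ℤ.* b (suc n)) _ ⟩
    ((a ∘ suc) ⊛ b) n ℤ.+ a 0 ℤ.* b (suc n)     ≡⟨ cong₂ ℤ._+_ (⊛-comm (a ∘ suc) b n) (ℤP.*-comm (a 0) _) ⟩
    (b ⊛ (a ∘ suc)) n ℤ.+ b (suc n) ℤ.* a 0     ≡⟨ ⊛-suc′ b a n ⟨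
    (b ⊛ a) (suc n)                             ∎
    where open ≡-Reasoning

  ⊛-distribˡ : ∀ a b c → a ⊛ (b ⊕ c) ≈ (a ⊛ b) ⊕ (a ⊛ c)
  ⊛-distribˡ a b c n =
    trans (sumTo-cong′ (suc n) λ i → ℤP.*-distribˡ-+ (a i) (b (n ∸ i)) (c (n ∸ i)))
          (sumTo-+ (suc n) _ _)

  ⊛-·ˡ : ∀ k a b → (k · a) ⊛ b ≈ k · (a ⊛ b)
  ⊛-·ˡ k a b n =
    trans (sumTo-cong′ (suc n) λ i → ℤP.*-assoc k (a i) (b (n ∸ i))) (sumTo-*ˡ (suc n) k _)

  ⊛-assoc : ∀ a b c → (a ⊛ b) ⊛ c ≈ a ⊛ (b ⊛ c)
  ⊛-assoc a b c zero = cong (ℤ._+_ (+ 0)) (begin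
    (+ 0 ℤ.+ a 0 ℤ.* b 0) ℤ.* c 0   ≡⟨ cong (ℤ._* c 0) (ℤP.+-identityˡ (a 0 ℤ.* b 0)) ⟩
    a 0 ℤ.* b 0 ℤ.* c 0             ≡⟨ ℤP.*-assoc (a 0) (b 0) (c 0) ⟩
    a 0 ℤ.* (b 0 ℤ.* c 0)           ≡⟨ cong (a 0 ℤ.*_) (ℤP.+-identityˡ (b 0 ℤ.* c 0)) ⟨
    a 0 ℤ.* (+ 0 ℤ.+ b 0 ℤ.* c 0)   ∎)
    where open ≡-Reasoning
  ⊛-assoc a b c (suc n) = begin
    ((a ⊛ b) ⊛ c) (suc n)
      ≡⟨ ⊛-suc (a ⊛ b) c n ⟩
    (a ⊛ b) 0 ℤ.* c (suc n) ℤ.+ (((a ⊛ b) ∘ suc) ⊛ c) n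
      ≡⟨ cong₂ ℤ._+_ (cong (ℤ._* c (suc n)) (ℤP.+-identityˡ (a 0 ℤ.* b 0)))
           (⊛-cong {b = c} n (λ i _ → ⊛-suc a b i) (λ _ _ → refl)) ⟩
    a 0 ℤ.* b 0 ℤ.* c (suc n) ℤ.+ (((a 0 · (b ∘ suc)) ⊕ ((a ∘ suc) ⊛ b)) ⊛ c) n
      ≡⟨ cong (ℤ._+_ (a 0 ℤ.* b 0 ℤ.* c (suc n))) distrib ⟩
    a 0 ℤ.* b 0 ℤ.* c (suc n) ℤ.+ (a 0 ℤ.* ((b ∘ suc) ⊛ c) n ℤ.+ ((a ∘ suc) ⊛ (b ⊛ c)) n)
      ≡⟨ regroup (a 0) (b 0) (c (suc n)) _ _ ⟩
    a 0 ℤ.* (b 0 ℤ.* c (suc n) ℤ.+ ((b ∘ suc) ⊛ c) n) ℤ.+ ((a ∘ suc) ⊛ (b ⊛ c)) n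
      ≡⟨ cong (λ x → a 0 ℤ.* x ℤ.+ ((a ∘ suc) ⊛ (b ⊛ c)) n) (⊛-suc b c n) ⟨
    a 0 ℤ.* (b ⊛ c) (suc n) ℤ.+ ((a ∘ suc) ⊛ (b ⊛ c)) n
      ≡⟨ ⊛-suc a (b ⊛ c) n ⟨
    (a ⊛ (b ⊛ c)) (suc n) ∎
    where
    open ≡-Reasoning
    regroup : ∀ a b c x y → a ℤ.* b ℤ.* c ℤ.+ (a ℤ.* x ℤ.+ y) ≡ a ℤ.* (b ℤ.* c ℤ.+ x) ℤ.+ y
    regroup = ℤ-solve-∀
    distrib : (((a 0 · (b ∘ suc)) ⊕ ((a ∘ suc) ⊛ b)) ⊛ c) n ≡
              a 0 ℤ.* ((b ∘ suc) ⊛ c) n ℤ.+ ((a ∘ suc) ⊛ (b ⊛ c)) n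
    distrib = begin
      (((a 0 · (b ∘ suc)) ⊕ ((a ∘ suc) ⊛ b)) ⊛ c) n
        ≡⟨ ⊛-comm ((a 0 · (b ∘ suc)) ⊕ ((a ∘ suc) ⊛ b)) c n ⟩
      (c ⊛ ((a 0 · (b ∘ suc)) ⊕ ((a ∘ suc) ⊛ b))) n
        ≡⟨ ⊛-distribˡ c (a 0 · (b ∘ suc)) ((a ∘ suc) ⊛ b) n ⟩
      (c ⊛ (a 0 · (b ∘ suc))) n ℤ.+ (c ⊛ ((a ∘ suc) ⊛ b)) n
        ≡⟨ cong₂ ℤ._+_ (⊛-comm c (a 0 · (b ∘ suc)) n) (⊛-comm c ((a ∘ suc) ⊛ b) n) ⟩
      ((a 0 · (b ∘ suc)) ⊛ c) n ℤ.+ (((a ∘ suc) ⊛ b) ⊛ c) n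
        ≡⟨ cong₂ ℤ._+_ (⊛-·ˡ (a 0) (b ∘ suc) c n) (⊛-assoc (a ∘ suc) b c n) ⟩
      a 0 ℤ.* ((b ∘ suc) ⊛ c) n ℤ.+ ((a ∘ suc) ⊛ (b ⊛ c)) n ∎

  X^0-⊛ : ∀ a → one ⊛ a ≈ a
  X^0-⊛ a zero    = trans (ℤP.+-identityˡ _) (ℤP.*-identityˡ (a 0))
  X^0-⊛ a (suc n) = begin
    (one ⊛ a) (suc n)                                  ≡⟨ ⊛-suc one a n ⟩
    + 1 ℤ.* a (suc n) ℤ.+ ((λ _ → + 0) ⊛ a) n           ≡⟨ cong₂ ℤ._+_ (ℤP.*-identityˡ (a (suc n))) (sumTo-zero (suc n) λ _ _ → refl) ⟩
    a (suc n) ℤ.+ + 0                                  ≡⟨ ℤP.+-identityʳ _ ⟩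
    a (suc n)                                          ∎
    where open ≡-Reasoning

  X^-⊛-< : ∀ k a n → n < k → (X^ k ⊛ a) n ≡ + 0
  X^-⊛-< (suc k) a zero    _         = refl
  X^-⊛-< (suc k) a (suc n) (s≤s n<k) =
    trans (⊛-suc (X^ (suc k)) a n) (trans (ℤP.+-identityˡ _) (X^-⊛-< k a n n<k))

  X^-⊛-+ : ∀ k a n → (X^ k ⊛ a) (k ℕ.+ n) ≡ a n
  X^-⊛-+ zero    a n = X^0-⊛ a n
  X^-⊛-+ (suc k) a n =
    trans (⊛-suc (X^ (suc k)) a (k ℕ.+ n)) (trans (ℤP.+-identityˡ _) (X^-⊛-+ k a n))

  X^-+ : ∀ m n → X^ (m ℕ.+ n) ≈ X^ m ⊛ X^ n
  X^-+ zero    n i       = sym (X^0-⊛ (X^ n) i)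
  X^-+ (suc m) n zero    = refl
  X^-+ (suc m) n (suc i) =
    trans (X^-+ m n i) (sym (trans (⊛-suc (X^ (suc m)) (X^ n) i) (ℤP.+-identityˡ _)))

  X^-≢ : ∀ k n → n < k → X^ k n ≡ + 0
  X^-≢ (suc k) zero    _         = refl
  X^-≢ (suc k) (suc n) (s≤s n<k) = X^-≢ k n n<k

  private
    T⇒true : ∀ {b} → T b → b ≡ true
    T⇒true {true} _ = refl

    suc≤ᵇ : ∀ n → (suc n ≤ᵇ n) ≡ false
    suc≤ᵇ n with suc n ≤ᵇ n in eq
    ... | false = refl
    ... | true  = contradiction (ℕP.≤ᵇ⇒≤ (suc n) n (subst T (sym eq) tt)) (ℕP.<-irrefl refl)

  -- The first argument n of `invUpTo` is only fuel: while m ≤ n the recursion lowers it until it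
  -- meets m.
  invUpTo-stable : ∀ a n m → m ≤ n → invUpTo a n m ≡ inv a m
  invUpTo-stable a zero    zero    _    = refl
  invUpTo-stable a (suc n) m m≤1+n with ℕP.m≤n⇒m<n∨m≡n m≤1+n
  ... | inj₂ refl      = refl
  ... | inj₁ (s≤s m≤n) rewrite T⇒true (ℕP.≤⇒≤ᵇ m≤n) = invUpTo-stable a n m m≤n

  inv-suc : ∀ a n → inv a (suc n) ≡ ℤ.- ((a ∘ suc) ⊛ inv a) n
  inv-suc a n rewrite suc≤ᵇ n =
    cong ℤ.-_ (sumTo-cong (suc n) λ i _ → cong (a (suc i) ℤ.*_) (invUpTo-stable a n (n ∸ i) (ℕP.m∸n≤m n i)))

  ⊛-inv : ∀ a → a 0 ≡ + 1 → a ⊛ inv a ≈ one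
  ⊛-inv a a₀ zero    = trans (ℤP.+-identityˡ _) (cong (ℤ._* + 1) a₀)
  ⊛-inv a a₀ (suc n) = begin
    (a ⊛ inv a) (suc n)                                      ≡⟨ ⊛-suc a (inv a) n ⟩
    a 0 ℤ.* inv a (suc n) ℤ.+ ((a ∘ suc) ⊛ inv a) n           ≡⟨ cong₂ (λ x y → x ℤ.* y ℤ.+ r) a₀ (inv-suc a n) ⟩
    (+ 1) ℤ.* (ℤ.- r) ℤ.+ r                                     ≡⟨ cong (ℤ._+ r) (ℤP.*-identityˡ (ℤ.- r)) ⟩
    ℤ.- r ℤ.+ r                                               ≡⟨ ℤP.+-inverseˡ r ⟩
    + 0                                                      ∎
    where
    open ≡-Reasoning
    r = ((a ∘ suc) ⊛ inv a) n

  private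
    split : ∀ m n → n < suc m ⊎ ∃ λ k → n ≡ k ℕ.+ suc m
    split m n with n ℕ.<? suc m
    ... | yes p = inj₁ p
    ... | no ¬p = inj₂ (n ∸ suc m , sym (ℕP.m∸n+n≡m (ℕP.≮⇒≥ ¬p)))

  dil-< : ∀ c m a n → suc n < suc m → dil c m a (suc n) ≡ + 0
  dil-< c m a n n<m rewrite m<n⇒m%n≡m n<m = refl

  dil-+ : ∀ c m a n → dil c m a (n ℕ.+ suc m) ≡ c ℤ.* dil c m (a ∘ suc) n
  dil-+ c m a n
    rewrite [m+n]%n≡m%n n (suc m) {{ℕ.nonZero}}
          | m/n≡1+[m∸n]/n {n ℕ.+ suc m} {suc m} {{ℕ.nonZero}} (ℕP.m≤n+m (suc m) n)
          | ℕP.m+n∸n≡m n (suc m)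
    with (n % suc m) ≡ᵇ 0
  ... | true  = ℤP.*-assoc c (c ℤ.^ (n / suc m)) (a (suc (n / suc m)))
  ... | false = sym (ℤP.*-zeroʳ c)

  dil-0 : ∀ c m a → dil c m a 0 ≡ a 0
  dil-0 c m a = ℤP.*-identityˡ (a 0)

  -- Replaces arithmetic with quotients and remainders: it suffices to compare the constant terms,
  -- the gap below q^(m+1), and the shift by m + 1, which costs one factor c.
  dil-ext : ∀ c m {a} {b : PS} →
    a 0 ≡ b 0 → (∀ n → suc n < suc m → b (suc n) ≡ + 0) →
    (∀ n → c ℤ.* dil c m (a ∘ suc) n ≡ b (n ℕ.+ suc m)) → dil c m a ≈ b
  dil-ext c m {a} {b} h₀ h₁ h₂ n = go n (split m n)
    where
    go : ∀ n → n < suc m ⊎ (∃ λ k → n ≡ k ℕ.+ suc m) → dil c m a n ≡ b n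
    go zero    (inj₁ _)        = trans (dil-0 c m a) h₀
    go (suc n) (inj₁ n<m)      = trans (dil-< c m a n n<m) (sym (h₁ n n<m))
    go _       (inj₂ (k , eq)) =
      subst (λ n → dil c m a n ≡ b n) (sym eq) (trans (dil-+ c m a k) (h₂ k))

  dil-cong : ∀ c m {a b} → a ≈ b → dil c m a ≈ dil c m b
  dil-cong c m h n with (n % suc m) ≡ᵇ 0
  ... | true  = cong (c ℤ.^ (n / suc m) ℤ.*_) (h (n / suc m))
  ... | false = refl

  dil-⊕ : ∀ c m a b → dil c m (a ⊕ b) ≈ dil c m a ⊕ dil c m b
  dil-⊕ c m a b n with (n % suc m) ≡ᵇ 0
  ... | true  = ℤP.*-distribˡ-+ (c ℤ.^ (n / suc m)) (a (n / suc m)) (b (n / suc m))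
  ... | false = refl

  dil-· : ∀ c m z a → dil c m (z · a) ≈ z · dil c m a
  dil-· c m z a n with (n % suc m) ≡ᵇ 0
  ... | true  = commute (c ℤ.^ (n / suc m)) z (a (n / suc m))
    where
    commute : ∀ x y w → x ℤ.* (y ℤ.* w) ≡ y ℤ.* (x ℤ.* w)
    commute = ℤ-solve-∀
  ... | false = sym (ℤP.*-zeroʳ z)

  dil-zero : ∀ c m a → (∀ n → a n ≡ + 0) → ∀ n → dil c m a n ≡ + 0
  dil-zero c m a h n with (n % suc m) ≡ᵇ 0
  ... | true  = trans (cong (c ℤ.^ (n / suc m) ℤ.*_) (h (n / suc m))) (ℤP.*-zeroʳ (c ℤ.^ (n / suc m)))
  ... | false = refl

  dil-const : ∀ c m z → dil c m (z · one) ≈ z · one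
  dil-const c m z = dil-ext c m {z · one} {z · one} refl (λ n _ → ℤP.*-zeroʳ z) λ n →
    trans (cong (c ℤ.*_) (dil-zero c m _ (λ k → ℤP.*-zeroʳ z) n))
    (trans (ℤP.*-zeroʳ c) (sym (trans (cong (λ k → z ℤ.* one k) (ℕP.+-suc n m)) (ℤP.*-zeroʳ z))))

  dil-X : ∀ c m a → dil c m (X^ 1 ⊛ a) ≈ (c · X^ (suc m)) ⊛ dil c m a
  dil-X c m a = dil-ext c m {X^ 1 ⊛ a} {(c · X^ (suc m)) ⊛ dil c m a}
    (sym (trans (⊛-·ˡ c (X^ (suc m)) (dil c m a) 0) (ℤP.*-zeroʳ c)))
    (λ n n<m → trans (⊛-·ˡ c (X^ (suc m)) (dil c m a) (suc n))
      (trans (cong (c ℤ.*_) (X^-⊛-< (suc m) (dil c m a) (suc n) n<m)) (ℤP.*-zeroʳ c)))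
    λ n → sym (trans (⊛-·ˡ c (X^ (suc m)) (dil c m a) (n ℕ.+ suc m)) (cong (c ℤ.*_)
      (trans (cong (X^ (suc m) ⊛ dil c m a) (ℕP.+-comm n (suc m)))
      (trans (X^-⊛-+ (suc m) (dil c m a) n) (sym (dil-cong c m {(X^ 1 ⊛ a) ∘ suc} {a} (X^-⊛-+ 1 a) n))))))

  dil-4* : ∀ a n → dil (+ 1) 3 a (4 ℕ.* n) ≡ a n
  dil-4* a zero    = dil-0 (+ 1) 3 a
  dil-4* a (suc n) = begin
    dil (+ 1) 3 a (4 ℕ.* suc n)              ≡⟨ cong (dil (+ 1) 3 a) (trans (ℕP.*-suc 4 n) (ℕP.+-comm 4 _)) ⟩
    dil (+ 1) 3 a (4 ℕ.* n ℕ.+ 4)            ≡⟨ dil-+ (+ 1) 3 a (4 ℕ.* n) ⟩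
    (+ 1) ℤ.* dil (+ 1) 3 (a ∘ suc) (4 ℕ.* n)  ≡⟨ ℤP.*-identityˡ (dil (+ 1) 3 (a ∘ suc) (4 ℕ.* n)) ⟩
    dil (+ 1) 3 (a ∘ suc) (4 ℕ.* n)          ≡⟨ dil-4* (a ∘ suc) n ⟩
    a (suc n)                                ∎
    where open ≡-Reasoning

-- The ring of integer power series, congruences modulo q^n and infinite sums.

module Series where
  open Coefficients
  open import Algebra using (CommutativeRing)
  open import Data.Bool using (true; false)
  open import Data.Nat.DivMod using (m/n≤m)
  open import Level using (0ℓ)
  open import Relation.Binary using (IsEquivalence)

  infix  4 _≈_ _≈[_]_
  infixl 6 _+_ _-_
  infixl 7 _*_
  infix  8 -_

  -- Opaque, so that the ring operations are neutral and implicit arguments can be inferred.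
  opaque
    Ser : Set
    Ser = D.PS

    ⟪_⟫ : D.PS → Ser
    ⟪ a ⟫ = a

    coeff : Ser → ℕ → ℤ
    coeff a = a

    _≈_ : Ser → Ser → Set
    _≈_ = D._≈_

    -- Congruence modulo q^n, the one notion behind orders of vanishing, limits and units.
    _≈[_]_ : Ser → ℕ → Ser → Set
    a ≈[ n ] b = ∀ i → i < n → a i ≡ b i

    _+_ _*_ : Ser → Ser → Ser
    _+_ = D._⊕_
    _*_ = D._⊛_

    -_ : Ser → Ser
    - a = (ℤ.- (+ 1)) D.· a

    κ : ℤ → Ser
    κ z = z D.· D.one

    X : ℕ → Ser
    X = D.X^

    inv : Ser → Ser
    inv = D.inv

    Sum : (ℕ → Ser) → Ser
    Sum = D.sumSeries

    -- The limit of a sequence whose n-th term is already correct up to q^n. The series `fq k` of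
    -- the statement is literally such a diagonal.
    diag : (ℕ → Ser) → Ser
    diag a n = a n n

    dil : ℤ → ℕ → Ser → Ser
    dil = D.dil

    drop : ℕ → Ser → Ser
    drop k a n = a (k ℕ.+ n)

    tail : Ser → Ser
    tail a = a ∘ suc

  0# 1# : Ser
  0# = κ (+ 0)
  1# = κ (+ 1)

  _-_ : Ser → Ser → Ser
  a - b = a + - b

  opaque
    unfolding Ser

    ≈-isEquivalence : IsEquivalence _≈_
    ≈-isEquivalence = record
      { refl  = λ _ → ≡.refl
      ; sym   = λ p n → ≡.sym (p n)
      ; trans = λ p q n → ≡.trans (p n) (q n)
      }

    +-cong : ∀ {a a′ b b′} → a ≈ a′ → b ≈ b′ → a + b ≈ a′ + b′
    +-cong p q n = cong₂ ℤ._+_ (p n) (q n)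

    +-assoc : ∀ a b c → (a + b) + c ≈ a + (b + c)
    +-assoc a b c n = ℤP.+-assoc (a n) (b n) (c n)

    +-comm : ∀ a b → a + b ≈ b + a
    +-comm a b n = ℤP.+-comm (a n) (b n)

    +-identityˡ : ∀ a → 0# + a ≈ a
    +-identityˡ a n = ≡.trans (cong (ℤ._+ a n) (ℤP.*-zeroˡ (D.one n))) (ℤP.+-identityˡ (a n))

    +-identityʳ : ∀ a → a + 0# ≈ a
    +-identityʳ a n = ≡.trans (+-comm a 0# n) (+-identityˡ a n)

    -‿cong : ∀ {a b} → a ≈ b → - a ≈ - b
    -‿cong p n = cong (ℤ._*_ (ℤ.- (+ 1))) (p n)

    -‿inverseʳ : ∀ a → a + - a ≈ 0#
    -‿inverseʳ a n = ≡.trans (cong (ℤ._+_ (a n)) (ℤP.-1*i≡-i (a n)))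
      (≡.trans (ℤP.+-inverseʳ (a n)) (≡.sym (ℤP.*-zeroˡ (D.one n))))

    -‿inverseˡ : ∀ a → - a + a ≈ 0#
    -‿inverseˡ a n = ≡.trans (+-comm (- a) a n) (-‿inverseʳ a n)

    *-cong : ∀ {a a′ b b′} → a ≈ a′ → b ≈ b′ → a * b ≈ a′ * b′
    *-cong {a} {a′} {b} {b′} p q n = ⊛-cong {a} {a′} {b} {b′} n (λ i _ → p i) (λ i _ → q i)

    *-assoc : ∀ a b c → (a * b) * c ≈ a * (b * c)
    *-assoc = ⊛-assoc

    *-comm : ∀ a b → a * b ≈ b * a
    *-comm = ⊛-comm

    one≈1# : ⟪ D.one ⟫ ≈ 1#
    one≈1# n = ≡.sym (ℤP.*-identityˡ (D.one n))

    *-identityˡ : ∀ a → 1# * a ≈ a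
    *-identityˡ a n = ≡.trans (⊛-·ˡ (+ 1) D.one a n)
      (≡.trans (ℤP.*-identityˡ ((D.one D.⊛ a) n)) (X^0-⊛ a n))

    *-identityʳ : ∀ a → a * 1# ≈ a
    *-identityʳ a n = ≡.trans (*-comm a 1# n) (*-identityˡ a n)

    distribˡ : ∀ a b c → a * (b + c) ≈ a * b + a * c
    distribˡ = ⊛-distribˡ

    distribʳ : ∀ a b c → (b + c) * a ≈ b * a + c * a
    distribʳ a b c n = ≡.trans (*-comm (b + c) a n) (≡.trans (distribˡ a b c n)
      (cong₂ ℤ._+_ (*-comm a b n) (*-comm a c n)))

    κ-cong : ∀ {x y} → x ≡ y → κ x ≈ κ y
    κ-cong p n = cong (λ z → z ℤ.* D.one n) p

    κ-+ : ∀ x y → κ (x ℤ.+ y) ≈ κ x + κ y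
    κ-+ x y n = ℤP.*-distribʳ-+ (D.one n) x y

    κ-* : ∀ x y → κ (x ℤ.* y) ≈ κ x * κ y
    κ-* x y n = ≡.trans (ℤP.*-assoc x y (D.one n)) (≡.sym
      (≡.trans (⊛-·ˡ x D.one (κ y) n) (cong (x ℤ.*_) (X^0-⊛ (κ y) n))))

    κ-neg : ∀ x → κ (ℤ.- x) ≈ - κ x
    κ-neg x n = ≡.trans (≡.sym (ℤP.neg-distribˡ-* x (D.one n))) (≡.sym (ℤP.-1*i≡-i _))

  series-ring : CommutativeRing 0ℓ 0ℓ
  series-ring = record
    { Carrier = Ser ; _≈_ = _≈_ ; _+_ = _+_ ; _*_ = _*_ ; -_ = -_ ; 0# = 0# ; 1# = 1#
    ; isCommutativeRing = record
      { isRing = record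
        { +-isAbelianGroup = record
          { isGroup = record
            { isMonoid = record
              { isSemigroup = record
                { isMagma = record { isEquivalence = ≈-isEquivalence ; ∙-cong = +-cong }
                ; assoc = +-assoc }
              ; identity = +-identityˡ , +-identityʳ }
            ; inverse = -‿inverseˡ , -‿inverseʳ
            ; ⁻¹-cong = -‿cong }
          ; comm = +-comm }
        ; *-cong = *-cong
        ; *-assoc = *-assoc
        ; *-identity = *-identityˡ , *-identityʳ
        ; distrib = distribˡ , distribʳ }
      ; *-comm = *-comm } }

  open IsEquivalence ≈-isEquivalence public
  open CommutativeRing series-ring public using (setoid; zeroˡ; zeroʳ)
  open import Algebra.Properties.CommutativeSemiring.Exp (CommutativeRing.commutativeSemiring series-ring) public
    using (_^_; ^-congˡ)

  opaque
    unfolding Ser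

    coeff-cong : ∀ {a b} → a ≈ b → ∀ n → coeff a n ≡ coeff b n
    coeff-cong p = p

    ≈⇒≈[] : ∀ {n a b} → a ≈ b → a ≈[ n ] b
    ≈⇒≈[] p i _ = p i

    ≈[]⇒≈ : ∀ {a b} → (∀ n → a ≈[ n ] b) → a ≈ b
    ≈[]⇒≈ p n = p (suc n) n ℕP.≤-refl

    ≈[]-sym : ∀ {n a b} → a ≈[ n ] b → b ≈[ n ] a
    ≈[]-sym p i i<n = ≡.sym (p i i<n)

    ≈[]-trans : ∀ {n a b c} → a ≈[ n ] b → b ≈[ n ] c → a ≈[ n ] c
    ≈[]-trans p q i i<n = ≡.trans (p i i<n) (q i i<n)

    ≈[]-mono : ∀ {m n a b} → m ≤ n → a ≈[ n ] b → a ≈[ m ] b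
    ≈[]-mono m≤n p i i<m = p i (ℕP.<-≤-trans i<m m≤n)

    ≈[0] : ∀ {a b} → a ≈[ 0 ] b
    ≈[0] i ()

    +-cong[] : ∀ {n a a′ b b′} → a ≈[ n ] a′ → b ≈[ n ] b′ → a + b ≈[ n ] a′ + b′
    +-cong[] p q i i<n = cong₂ ℤ._+_ (p i i<n) (q i i<n)

    -‿cong[] : ∀ {n a b} → a ≈[ n ] b → - a ≈[ n ] - b
    -‿cong[] p i i<n = cong (ℤ._*_ (ℤ.- (+ 1))) (p i i<n)

    *-cong[] : ∀ {n a a′ b b′} → a ≈[ n ] a′ → b ≈[ n ] b′ → a * b ≈[ n ] a′ * b′
    *-cong[] {n} {a} {a′} {b} {b′} p q i i<n = ⊛-cong {a} {a′} {b} {b′} i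
      (λ j j≤i → p j (ℕP.≤-<-trans j≤i i<n)) (λ j j≤i → q j (ℕP.≤-<-trans j≤i i<n))

    X-0 : X 0 ≈ 1#
    X-0 = one≈1#

    X-+ : ∀ m n → X (m ℕ.+ n) ≈ X m * X n
    X-+ = X^-+

    X*≈0 : ∀ n a → X n * a ≈[ n ] 0#
    X*≈0 n a i i<n = ≡.trans (X^-⊛-< n a i i<n) (≡.sym (ℤP.*-zeroˡ (D.one i)))

    X*-cong[] : ∀ k {n a b} → a ≈[ n ] b → X k * a ≈[ k ℕ.+ n ] X k * b
    X*-cong[] k {n} {a} {b} p i i<k+n with ℕP.<-≤-connex i k
    ... | inj₁ i<k = ≡.trans (X^-⊛-< k a i i<k) (≡.sym (X^-⊛-< k b i i<k))
    ... | inj₂ k≤i = subst (λ j → (X k * a) j ≡ (X k * b) j) (ℕP.m+[n∸m]≡n k≤i)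
      (≡.trans (X^-⊛-+ k a (i ∸ k)) (≡.trans (p (i ∸ k) i∸k<n) (≡.sym (X^-⊛-+ k b (i ∸ k)))))
      where
      i∸k<n : i ∸ k < n
      i∸k<n = subst (i ∸ k <_) (ℕP.m+n∸m≡n k n) (ℕP.∸-monoˡ-< i<k+n k≤i)

    X*-cancel : ∀ k {a b} → X k * a ≈ X k * b → a ≈ b
    X*-cancel k {a} {b} p n = ≡.trans (≡.sym (X^-⊛-+ k a n)) (≡.trans (p (k ℕ.+ n)) (X^-⊛-+ k b n))

    ≈[]0⇒X* : ∀ k {a} → a ≈[ k ] 0# → a ≈ X k * drop k a
    ≈[]0⇒X* k {a} p n with ℕP.<-≤-connex n k
    ... | inj₁ n<k = ≡.trans (p n n<k) (≡.trans (ℤP.*-zeroˡ (D.one n)) (≡.sym (X^-⊛-< k (drop k a) n n<k)))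
    ... | inj₂ k≤n = subst (λ m → a m ≡ (X k * drop k a) m) (ℕP.m+[n∸m]≡n k≤n)
      (≡.sym (X^-⊛-+ k (drop k a) (n ∸ k)))

    *-inv : ∀ {u} → u ≈[ 1 ] 1# → u * inv u ≈ 1#
    *-inv {u} u≈1 n = ≡.trans (⊛-inv u (u≈1 0 ℕP.≤-refl) n) (one≈1# n)

    -- A series with constant term 2 has no inverse over ℤ, but ℤ is a domain: once the lower
    -- coefficients of a vanish, coefficient i of the product is 2 times that of a.
    *-cancel-2 : ∀ {n a b} → b ≈[ 1 ] κ (+ 2) → a * b ≈[ n ] 0# → a ≈[ n ] 0#
    *-cancel-2 {n} {a} {b} b≈2 p i i<n = go (suc i) i ℕP.≤-refl i<n
      where
      go : ∀ m i → i < m → i < n → a i ≡ 0# i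
      go (suc m) i (s≤s i≤m) i<n = ℤP.*-cancelʳ-≡ (a i) (0# i) (+ 2) (≡.trans
        (≡.sym (≡.trans (cong₂ ℤ._+_
          (sumTo-zero i λ j j<i → cong (ℤ._* b (i ∸ j))
            (≡.trans (go m j (ℕP.<-≤-trans j<i i≤m) (ℕP.<-trans j<i i<n)) (ℤP.*-zeroˡ (D.one j))))
          (cong (a i ℤ.*_) (≡.trans (cong b (ℕP.n∸n≡0 i)) (b≈2 0 ℕP.≤-refl))))
          (ℤP.+-identityˡ _)))
        (≡.trans (p i i<n) (≡.trans (ℤP.*-zeroˡ (D.one i)) (≡.sym (cong (ℤ._* + 2) (ℤP.*-zeroˡ (D.one i)))))))

  -- Sum T takes the coefficient of q^N from T 0, …, T N only, so it is the sum of the T m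
  -- when T m has order at least m.
  Summable : (ℕ → Ser) → Set
  Summable T = ∀ m → T m ≈[ m ] 0#

  opaque
    unfolding Ser

    Sum-cong[] : ∀ {n S T} → (∀ m → S m ≈[ n ] T m) → Sum S ≈[ n ] Sum T
    Sum-cong[] p i i<n = sumTo-cong′ (suc i) λ m → p m i i<n

    Sum-cong : ∀ {S T} → (∀ m → S m ≈ T m) → Sum S ≈ Sum T
    Sum-cong p i = sumTo-cong′ (suc i) λ m → p m i

    Sum-+ : ∀ S T → Sum (λ m → S m + T m) ≈ Sum S + Sum T
    Sum-+ S T i = sumTo-+ (suc i) (λ m → S m i) (λ m → T m i)

    Sum-swap : ∀ (T : ℕ → ℕ → Ser) → Sum (λ m → Sum (T m)) ≈ Sum (λ n → Sum (λ m → T m n))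
    Sum-swap T i = sumTo-swap (suc i) (suc i) (λ m n → T m n i)

    private
      vanish : ∀ {T} → Summable T → ∀ {i} m → i < m → coeff (T m) i ≡ + 0
      vanish h {i} m i<m = ≡.trans (h m i i<m) (ℤP.*-zeroˡ (D.one i))

    -- Removing the head moves the cut-off at q^N by one term; summability makes that extra term
    -- invisible at q^N.
    Sum-head : ∀ {T} → Summable T → Sum T ≈ T 0 + Sum (T ∘ suc)
    Sum-head {T} h i = ≡.trans
      (≡.sym (sumTo-extend-≤ (suc i) (suc (suc i)) (λ m → T m i) (ℕP.n≤1+n _) (vanish h)))
      (sumTo-head (suc i) (λ m → T m i))

    Sum-*ˡ : ∀ c {T} → Summable T → c * Sum T ≈ Sum (λ m → c * T m)
    Sum-*ˡ c {T} h i = begin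
      D.sumTo (suc i) (λ j → c j ℤ.* D.sumTo (suc (i ∸ j)) (λ m → T m (i ∸ j)))
        ≡⟨ sumTo-cong′ (suc i) (λ j → cong (c j ℤ.*_) (≡.sym
             (sumTo-extend-≤ (suc (i ∸ j)) (suc i) _ (s≤s (ℕP.m∸n≤m i j)) (vanish h)))) ⟩
      D.sumTo (suc i) (λ j → c j ℤ.* D.sumTo (suc i) (λ m → T m (i ∸ j)))
        ≡⟨ sumTo-cong′ (suc i) (λ j → ≡.sym (sumTo-*ˡ (suc i) (c j) _)) ⟩
      D.sumTo (suc i) (λ j → D.sumTo (suc i) (λ m → c j ℤ.* T m (i ∸ j)))
        ≡⟨ sumTo-swap (suc i) (suc i) _ ⟩
      D.sumTo (suc i) (λ m → D.sumTo (suc i) (λ j → c j ℤ.* T m (i ∸ j))) ∎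
      where open ≡.≡-Reasoning

    -- Terms of index above N do not reach q^N, so N + 1 terms may be replaced by N + 1 full blocks.
    Sum-split : ∀ k {T} → Summable T →
      Sum T ≈ Sum (λ m → ⟪ (λ i → D.sumTo (suc k) (λ j → coeff (T (suc k ℕ.* m ℕ.+ j)) i)) ⟫)
    Sum-split k {T} h i = ≡.trans
      (≡.sym (sumTo-extend-≤ (suc i) (suc k ℕ.* suc i) (λ m → T m i) (ℕP.m≤n*m (suc i) (suc k)) (vanish h)))
      (≡.sym (blocks (suc i)))
      where
      concat : ∀ m n (f : ℕ → ℤ) → D.sumTo (m ℕ.+ n) f ≡ D.sumTo m f ℤ.+ D.sumTo n (λ j → f (m ℕ.+ j))
      concat m zero    f = ≡.trans (cong (λ k → D.sumTo k f) (ℕP.+-identityʳ m)) (≡.sym (ℤP.+-identityʳ _))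
      concat m (suc n) f = ≡.trans (cong (λ k → D.sumTo k f) (ℕP.+-suc m n))
        (≡.trans (cong (ℤ._+ f (m ℕ.+ n)) (concat m n f)) (ℤP.+-assoc (D.sumTo m f) _ _))
      blocks : ∀ n → D.sumTo n (λ m → D.sumTo (suc k) (λ j → T (suc k ℕ.* m ℕ.+ j) i)) ≡
                     D.sumTo (suc k ℕ.* n) (λ m → T m i)
      blocks zero    = cong (λ l → D.sumTo l (λ m → T m i)) (≡.sym (ℕP.*-zeroʳ (suc k)))
      blocks (suc n) = ≡.trans (cong (ℤ._+ D.sumTo (suc k) (λ j → T (suc k ℕ.* n ℕ.+ j) i)) (blocks n))
        (≡.trans (≡.sym (concat (suc k ℕ.* n) (suc k) (λ m → T m i)))
          (cong (λ l → D.sumTo l (λ m → T m i))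
            (≡.trans (ℕP.+-comm (suc k ℕ.* n) (suc k)) (≡.sym (ℕP.*-suc (suc k) n)))))

    Sum-split₂ : ∀ {T} → Summable T → Sum T ≈ Sum (λ m → T (2 ℕ.* m) + T (2 ℕ.* m ℕ.+ 1))
    Sum-split₂ {T} h i = ≡.trans (Sum-split 1 h i) (sumTo-cong′ (suc i) λ m →
      cong (ℤ._+ T (2 ℕ.* m ℕ.+ 1) i) (≡.trans (ℤP.+-identityˡ _) (cong (λ l → T l i) (ℕP.+-identityʳ (2 ℕ.* m)))))

    Sum-split₃ : ∀ {T} → Summable T →
      Sum T ≈ Sum (λ m → T (3 ℕ.* m) + T (3 ℕ.* m ℕ.+ 1) + T (3 ℕ.* m ℕ.+ 2))
    Sum-split₃ {T} h i = ≡.trans (Sum-split 2 h i) (sumTo-cong′ (suc i) λ m →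
      cong (λ z → z ℤ.+ T (3 ℕ.* m ℕ.+ 1) i ℤ.+ T (3 ℕ.* m ℕ.+ 2) i)
        (≡.trans (ℤP.+-identityˡ _) (cong (λ l → T l i) (ℕP.+-identityʳ (3 ℕ.* m)))))

    diag-lim : ∀ {a} → (∀ n → a (suc n) ≈[ suc n ] a n) → ∀ n → a n ≈[ suc n ] diag a
    diag-lim {a} h n i (s≤s i≤n) =
      ≡.trans (cong (λ k → a k i) (≡.sym (ℕP.m∸n+n≡m i≤n))) (go (n ∸ i))
      where
      go : ∀ k → a (k ℕ.+ i) i ≡ a i i
      go zero    = ≡.refl
      go (suc k) = ≡.trans (h (k ℕ.+ i) i (s≤s (ℕP.m≤n+m i k))) (go k)

    diag-cong : ∀ {a b} → (∀ n → a n ≈ b n) → diag a ≈ diag b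
    diag-cong h n = h n n

    unfold-tail : ∀ a → a ≈ κ (coeff a 0) + X 1 * tail a
    unfold-tail a zero    = ≡.sym (≡.trans
      (cong₂ ℤ._+_ (ℤP.*-identityʳ (a 0)) (X^-⊛-< 1 (tail a) 0 (s≤s z≤n))) (ℤP.+-identityʳ (a 0)))
    unfold-tail a (suc n) = ≡.sym (≡.trans
      (cong₂ ℤ._+_ (ℤP.*-zeroʳ (a 0)) (X^-⊛-+ 1 (tail a) n)) (ℤP.+-identityˡ (a (suc n))))

    dil-≈ : ∀ c m {a b} → a ≈ b → dil c m a ≈ dil c m b
    dil-≈ c m {a} {b} = dil-cong c m {a} {b}

    dil-hom-+ : ∀ c m a b → dil c m (a + b) ≈ dil c m a + dil c m b
    dil-hom-+ = dil-⊕

    dil-κ : ∀ c m z → dil c m (κ z) ≈ κ z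
    dil-κ = dil-const

    ·≈κ* : ∀ z a → ⟪ z D.· (λ n → coeff a n) ⟫ ≈ κ z * a
    ·≈κ* z a n = ≡.sym (≡.trans (⊛-·ˡ z D.one a n) (cong (z ℤ.*_) (X^0-⊛ a n)))

    dil-κ* : ∀ c m z a → dil c m (κ z * a) ≈ κ z * dil c m a
    dil-κ* c m z a n = ≡.trans (≡.sym (dil-cong c m {z D.· a} {κ z * a} (·≈κ* z a) n))
      (≡.trans (dil-· c m z a n) (·≈κ* z (dil c m a) n))

    dil-X* : ∀ c m a → dil c m (X 1 * a) ≈ κ c * X (suc m) * dil c m a
    dil-X* c m a n = ≡.trans (dil-X c m a n)
      (⊛-cong {c D.· X (suc m)} {κ c * X (suc m)} {dil c m a} {dil c m a} n
        (λ i _ → ≡.sym (≡.trans (⊛-·ˡ c D.one (X (suc m)) i) (cong (c ℤ.*_) (X^0-⊛ (X (suc m)) i))))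
        (λ _ _ → ≡.refl))

    dil-cong[] : ∀ c m {n a b} → a ≈[ n ] b → dil c m a ≈[ n ] dil c m b
    dil-cong[] c m {n} {a} {b} p i i<n with (i ℕ.% suc m) ℕ.≡ᵇ 0
    ... | Data.Bool.true  = cong (c ℤ.^ (i ℕ./ suc m) ℤ.*_) (p _ (ℕP.≤-<-trans (m/n≤m i (suc m)) i<n))
    ... | Data.Bool.false = ≡.refl

-- Certified linear combinations of equations between series.

module LinearCombination where
  open Series public
  open import Algebra using (CommutativeRing; RawRing)
  open import Algebra.Solver.Ring.AlmostCommutativeRing
    using (AlmostCommutativeRing; fromCommutativeRing; _-Raw-AlmostCommutative⟶_)
  open import Data.Bool using (T)
  open import Data.List using (List)
  open import Data.Maybe using (Maybe; just; is-just; map)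
  open import Data.Vec as Vec using (Vec; []; _∷_)
  open import Data.Vec.N-ary using (N-ary; _$ⁿ_)
  open import Level using (0ℓ)
  open import Relation.Nullary.Decidable using (dec⇒maybe)

  private
    coefficients : RawRing 0ℓ 0ℓ
    coefficients = CommutativeRing.rawRing ℤP.+-*-commutativeRing

    almost : AlmostCommutativeRing 0ℓ 0ℓ
    almost = fromCommutativeRing series-ring

    embedding : coefficients -Raw-AlmostCommutative⟶ almost
    embedding = record
      { ⟦_⟧ = κ ; +-homo = κ-+ ; *-homo = κ-* ; -‿homo = κ-neg ; 0-homo = refl ; 1-homo = refl }

    _≟κ_ : ∀ x y → Maybe (κ x ≈ κ y)
    x ≟κ y = map κ-cong (dec⇒maybe (x ℤ.≟ y))

  open import Algebra.Solver.Ring coefficients almost embedding _≟κ_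
    using (Polynomial; var; con; _:+_; _:*_; _:-_; :-_; _:^_; normalise; _≟N_; ⟦_⟧N-cong)
    renaming (⟦_⟧ to ⟦_⟧ₚ; correct to correctₚ) public

  open import Relation.Binary.Reasoning.Setoid setoid public

  infix 4 _:=_
  infix 6 _·[_]
  infix 2 _⊢_
  infix 9 #_

  Equation : ℕ → Set
  Equation n = Polynomial n × Polynomial n

  _:=_ : ∀ {n} → Polynomial n → Polynomial n → Equation n
  _:=_ = _,_

  record Hypothesis (n : ℕ) : Set where
    constructor _·[_]
    field
      multiplier : Polynomial n
      equation   : Equation n

  #_ : ∀ {n} → ℕ → Polynomial n
  # k = con (+ k)

  Problem : ℕ → Set
  Problem n = List (Hypothesis n) × Equation n

  _⊢_ : ∀ {n} → List (Hypothesis n) → Equation n → Problem n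
  _⊢_ = _,_

  private
    -- The certificate is checked as the ring identity L + Σ c r = R + Σ c l; afterwards each pair c
    -- l = c r is cancelled with the help of its hypothesis.
    certify : ∀ {n} → List (Hypothesis n) → Equation n → Equation n
    certify []                         e = e
    certify (c ·[ l , r ] ∷ hs) (L , R) = certify hs (L :+ c :* r , R :+ c :* l)

    Claim : ∀ {n} → List (Hypothesis n) → Equation n → Vec Ser n → Set
    Claim []                      (L , R) ρ = ⟦ L ⟧ₚ ρ ≈ ⟦ R ⟧ₚ ρ
    Claim (c ·[ l , r ] ∷ hs) e       ρ = ⟦ l ⟧ₚ ρ ≈ ⟦ r ⟧ₚ ρ → Claim hs e ρ

    -- Evaluates to the unit type when the two normal forms agree, so that the implicit argument
    -- `ok` of `lin` is filled in by computation.
    Certified : ∀ {n} → Equation n → Set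
    Certified (L , R) = T (is-just (normalise L ≟N normalise R))

    certified : ∀ {n} (e : Equation n) → Certified e → ∀ ρ → Claim [] e ρ
    certified (L , R) ok ρ with normalise L ≟N normalise R
    ... | just p = trans (sym (correctₚ L ρ)) (trans (⟦ p ⟧N-cong ρ) (correctₚ R ρ))

    +-cancelʳ : ∀ {a b c} → a + c ≈ b + c → a ≈ b
    +-cancelʳ {a} {b} {c} p = trans (expand a) (trans (+-cong p refl) (sym (expand b)))
      where
      expand : ∀ x → x ≈ x + c + - c
      expand x = trans (sym (+-identityʳ x))
        (trans (+-cong refl (sym (-‿inverseʳ c))) (sym (+-assoc x c (- c))))

    weaken : ∀ {n} hs {e e′ : Equation n} ρ → (Claim [] e ρ → Claim [] e′ ρ) → Claim hs e ρ → Claim hs e′ ρ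
    weaken []                        ρ k c = k c
    weaken (_ ·[ _ , _ ] ∷ hs) ρ k c h = weaken hs ρ k (c h)

    entail : ∀ {n} hs (e : Equation n) → Certified (certify hs e) → ∀ ρ → Claim hs e ρ
    entail []                        e       ok ρ = certified e ok ρ
    entail (c ·[ l , r ] ∷ hs) (L , R) ok ρ h =
      weaken hs ρ (λ p → +-cancelʳ (trans p (+-cong refl (*-cong refl h)))) (entail hs _ ok ρ)

    -- The series substituted for the variables are implicit; unification reads them off the
    -- hypotheses and the goal.
    ∀ˢ : ∀ n → (Vec Ser n → Set) → Set
    ∀ˢ zero    P = P []
    ∀ˢ (suc n) P = ∀ {x} → ∀ˢ n (P ∘ (x ∷_))

    curryˢ : ∀ n {P : Vec Ser n → Set} → (∀ ρ → P ρ) → ∀ˢ n P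
    curryˢ zero    p = p []
    curryˢ (suc n) p = curryˢ n λ ρ → p (_ ∷ ρ)

    problem : ∀ n → N-ary n (Polynomial n) (Problem n) → Problem n
    problem n f = f $ⁿ Vec.map var (Vec.allFin n)

  -- The certificate for L = R under hypotheses l = r with multipliers c is L - R = Σ c (l - r).
  lin : ∀ n (f : N-ary n (Polynomial n) (Problem n)) (let hs , e = problem n f) →
    {ok : Certified (certify hs e)} → ∀ˢ n (Claim hs e)
  lin n f {ok} = let hs , e = problem n f in curryˢ n (entail hs e ok)

-- Units and limits of sequences of series.

module Limits where
  open LinearCombination public

  X-≡ : ∀ {m n} → m ≡ n → X m ≈ X n
  X-≡ p = reflexive (cong X p)

  X-split : ∀ {l} m n → l ≡ m ℕ.+ n → X l ≈ X m * X n
  X-split m n p = trans (X-≡ p) (X-+ m n)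

  ≈[]-refl : ∀ {n a} → a ≈[ n ] a
  ≈[]-refl = ≈⇒≈[] refl

  ≈[]-resp : ∀ {n a a′ b b′} → a ≈ a′ → b ≈ b′ → a ≈[ n ] b → a′ ≈[ n ] b′
  ≈[]-resp p q h = ≈[]-trans (≈⇒≈[] (sym p)) (≈[]-trans h (≈⇒≈[] q))

  X≈0 : ∀ {m} n → m ≤ n → X n ≈[ m ] 0#
  X≈0 n m≤n = ≈[]-mono m≤n (≈[]-resp (*-identityʳ (X n)) refl (X*≈0 n 1#))

  *-zeroˡ[] : ∀ {n a b} → a ≈[ n ] 0# → a * b ≈[ n ] 0#
  *-zeroˡ[] {b = b} p = ≈[]-resp refl (zeroˡ b) (*-cong[] p ≈[]-refl)

  *-zeroʳ[] : ∀ {n a b} → b ≈[ n ] 0# → a * b ≈[ n ] 0#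
  *-zeroʳ[] {a = a} p = ≈[]-resp refl (zeroʳ a) (*-cong[] ≈[]-refl p)

  -‿cong₂ : ∀ {a a′ b b′} → a ≈ a′ → b ≈ b′ → a - b ≈ a′ - b′
  -‿cong₂ p q = +-cong p (-‿cong q)

  +-zero[] : ∀ {n a b} → a ≈[ n ] 0# → b ≈[ n ] 0# → a + b ≈[ n ] 0#
  +-zero[] p q = ≈[]-resp refl (+-identityˡ 0#) (+-cong[] p q)

  -‿zero[] : ∀ {n a} → a ≈[ n ] 0# → - a ≈[ n ] 0#
  -‿zero[] p = ≈[]-resp refl (lin 0 ([] ⊢ :- # 0 := # 0)) (-‿cong[] p)

  zeroʳ≈ : ∀ {a b} → b ≈ 0# → a * b ≈ 0#
  zeroʳ≈ {a} p = trans (*-cong refl p) (zeroʳ a)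

  zeroˡ≈ : ∀ {a b} → a ≈ 0# → a * b ≈ 0#
  zeroˡ≈ {b = b} p = trans (*-cong p refl) (zeroˡ b)

  Unit : Ser → Set
  Unit u = u ≈[ 1 ] 1#

  Unit-* : ∀ {u v} → Unit u → Unit v → Unit (u * v)
  Unit-* p q = ≈[]-resp refl (*-identityˡ 1#) (*-cong[] p q)

  Unit-^ : ∀ {u} k → Unit u → Unit (u ^ k)
  Unit-^ zero    p = ≈[]-refl
  Unit-^ (suc k) p = Unit-* p (Unit-^ k p)

  Unit-1+ : ∀ {a} → a ≈[ 1 ] 0# → Unit (1# + a)
  Unit-1+ p = ≈[]-resp refl (+-identityʳ 1#) (+-cong[] ≈[]-refl p)

  Unit-1- : ∀ {a} → a ≈[ 1 ] 0# → Unit (1# - a)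
  Unit-1- p = Unit-1+ (-‿zero[] p)

  *-cancelˡ : ∀ {u a b} → Unit u → u * a ≈ u * b → a ≈ b
  *-cancelˡ {u} {a} {b} ok p = lin 4 (λ u v a b → b :- a ·[ u :* v := # 1 ] ∷ v ·[ u :* a := u :* b ] ∷ [] ⊢ a := b)
    (*-inv ok) p

  *-cancelˡ-0 : ∀ {u a} → Unit u → u * a ≈ 0# → a ≈ 0#
  *-cancelˡ-0 {u} ok p = *-cancelˡ ok (trans p (sym (zeroʳ u)))

  inv-cong : ∀ {u v} → Unit u → u ≈ v → inv u ≈ inv v
  inv-cong {u} {v} ok p = *-cancelˡ ok (trans (*-inv ok)
    (sym (trans (*-cong p refl) (*-inv (≈[]-resp p refl ok)))))

  Summable-suc : ∀ {T} → Summable T → Summable (T ∘ suc)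
  Summable-suc h k = ≈[]-mono (ℕP.n≤1+n k) (h (suc k))

  Summable-+ : ∀ {S T} → Summable S → Summable T → Summable (λ k → S k + T k)
  Summable-+ p q k = +-zero[] (p k) (q k)

  Sum-0 : ∀ {T} → (∀ k → T k ≈ 0#) → Sum T ≈ 0#
  Sum-0 {T} h = trans (Sum-cong λ k → trans (h k) (sym (zeroˡ 0#)))
    (trans (sym (Sum-*ˡ 0# {λ _ → 0#} (λ _ → ≈[]-refl))) (zeroˡ (Sum λ _ → 0#)))

  Sum-only-head : ∀ {T} → (∀ k → T (suc k) ≈ 0#) → Sum T ≈ T 0
  Sum-only-head {T} h = trans (Sum-head summable) (trans (+-cong refl (Sum-0 h)) (+-identityʳ (T 0)))
    where
    summable : Summable T
    summable zero    = ≈[0]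
    summable (suc k) = ≈⇒≈[] (h k)

  Sum-telescope : ∀ {y} → Summable y → Sum (λ k → y k - y (suc k)) ≈ y 0
  Sum-telescope {y} h = lin 4
    (λ s t u v → :- # 1 ·[ s := u :+ t ] ∷ # 1 ·[ s := v :+ t ] ∷ [] ⊢ u := v)
    (trans (Sum-cong λ k → lin 2 (λ a b → [] ⊢ a := (a :- b) :+ b))
           (Sum-+ (λ k → y k - y (suc k)) (y ∘ suc)))
    (Sum-head h)

  -- The rate of convergence is fixed, hence uniform over all sequences; this is why limits pass
  -- through `Sum` term by term in `Lim-Sum`.
  Lim : (ℕ → Ser) → Ser → Set
  Lim a l = ∀ n → a n ≈[ n ] l

  Lim-unique : ∀ {a l m} → Lim a l → Lim a m → l ≈ m
  Lim-unique p q = ≈[]⇒≈ λ n → ≈[]-trans (≈[]-sym (p n)) (q n)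

  Lim-cong : ∀ {a b l} → (∀ n → a n ≈ b n) → Lim a l → Lim b l
  Lim-cong h p n = ≈[]-resp (h n) refl (p n)

  Lim-const : ∀ {l} → Lim (λ _ → l) l
  Lim-const _ = ≈[]-refl

  Lim-* : ∀ {a b l m} → Lim a l → Lim b m → Lim (λ n → a n * b n) (l * m)
  Lim-* p q n = *-cong[] (p n) (q n)

  Lim-+ : ∀ {a b l m} → Lim a l → Lim b m → Lim (λ n → a n + b n) (l + m)
  Lim-+ p q n = +-cong[] (p n) (q n)

  Lim-reindex : ∀ {a l} (φ : ℕ → ℕ) → (∀ n → n ≤ φ n) → Lim a l → Lim (a ∘ φ) l
  Lim-reindex φ n≤φn p n = ≈[]-mono (n≤φn n) (p (φ n))

  Lim-Sum : ∀ {T : ℕ → ℕ → Ser} {U : ℕ → Ser} → (∀ k → Lim (λ n → T n k) (U k)) → Lim (λ n → Sum (T n)) (Sum U)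
  Lim-Sum h n = Sum-cong[] λ k → h k n

  Lim-diag : ∀ {a} → (∀ n → a (suc n) ≈[ suc n ] a n) → Lim a (diag a)
  Lim-diag h n = ≈[]-mono (ℕP.n≤1+n n) (diag-lim h n)

  k≤bk² : ∀ b k → k ≤ suc b ℕ.* (k ℕ.* k)
  k≤bk² b zero    = z≤n
  k≤bk² b (suc k) = ℕP.≤-trans (ℕP.m≤m*n (suc k) (suc k)) (ℕP.m≤m+n _ _)

-- Unit Bailey pairs, partial fractions and Bailey's lemma.

module Durfee where
  open Limits public

  -- The base is p = q ^ suc β.
  module Base-p (β : ℕ) where

    P : ℕ → Ser
    P n = X (suc β ℕ.* n)

    p : Ser
    p = X (suc β)

    P-0 : P 0 ≈ 1#
    P-0 = trans (X-≡ (ℕP.*-zeroʳ β)) X-0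

    P-suc : ∀ n → P (suc n) ≈ p * P n
    P-suc n = X-split (suc β) (suc β ℕ.* n) (ℕP.*-suc (suc β) n)

    P-+ : ∀ m n → P (m ℕ.+ n) ≈ P m * P n
    P-+ m n = X-split (suc β ℕ.* m) (suc β ℕ.* n) (ℕP.*-distribˡ-+ (suc β) m n)

    P*≈0 : ∀ {m} n {a} → m ≤ n → P n * a ≈[ m ] 0#
    P*≈0 n m≤n = *-zeroˡ[] (X≈0 _ (ℕP.≤-trans m≤n (ℕP.m≤m+n n _)))

    Unit-1-P : ∀ n → Unit (1# - P (suc n))
    Unit-1-P n = Unit-1- (X≈0 _ (s≤s z≤n))

    -- 1/(p;p)_n.
    iq : ℕ → Ser
    iq zero    = 1#
    iq (suc n) = iq n * inv (1# - P (suc n))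

    iq-suc : ∀ n → (1# - p * P n) * iq (suc n) ≈ iq n
    iq-suc n = lin 5 (λ x p P v i →
      i ·[ (# 1 :- x) :* v := # 1 ] ∷ i :* v ·[ x := p :* P ] ∷ [] ⊢ (# 1 :- p :* P) :* (i :* v) := i)
      (*-inv (Unit-1-P n)) (P-suc n)

    iq-P : ∀ m n → (1# - P m * P (suc n)) * iq (suc (m ℕ.+ n)) ≈ iq (m ℕ.+ n)
    iq-P m n = trans (*-cong (-‿cong₂ refl P*P≈) refl) (iq-suc (m ℕ.+ n))
      where
      P*P≈ : P m * P (suc n) ≈ p * P (m ℕ.+ n)
      P*P≈ = trans (sym (P-+ m (suc n))) (trans (X-≡ (cong (suc β ℕ.*_) (ℕP.+-suc m n))) (P-suc (m ℕ.+ n)))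

    -- 1/(p;p)_{n-k}, with the usual value 0 for k > n, so that finite sums over k ≤ n can be
    -- written as infinite ones.
    r : ℕ → ℕ → Ser
    r n       zero    = iq n
    r zero    (suc k) = 0#
    r (suc n) (suc k) = r n k

    r-zero : ∀ n k → n ℕ.< k → r n k ≈ 0#
    r-zero zero    (suc k) _         = refl
    r-zero (suc n) (suc k) (s≤s n<k) = r-zero n k n<k

    -- The relation (1 - p^{n+1-k})/(p)_{n+1-k} = 1/(p)_{n-k} multiplied by p^k: no subtraction of
    -- indices remains, and the formula stays true for k > n.
    r-sucˡ : ∀ n k → (P k - p * P n) * r (suc n) k ≈ P k * r n k
    r-sucʳ : ∀ n k → (P k - P n) * r n k ≈ P k * r n (suc k)

    r-sucˡ n zero = lin 5 (λ o p P i j →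
      i :- j ·[ o := # 1 ] ∷ # 1 ·[ (# 1 :- p :* P) :* i := j ] ∷ [] ⊢ (o :- p :* P) :* i := o :* j)
      P-0 (iq-suc n)
    r-sucˡ n (suc k) = lin 6 (λ Pk′ p Pn Pk a b →
      a :- b ·[ Pk′ := p :* Pk ] ∷ p ·[ (Pk :- Pn) :* a := Pk :* b ] ∷ [] ⊢ (Pk′ :- p :* Pn) :* a := Pk′ :* b)
      (P-suc k) (r-sucʳ n k)

    r-sucʳ zero    zero    = lin 1 (λ o → [] ⊢ (o :- o) :* # 1 := o :* # 0)
    r-sucʳ zero    (suc k) = lin 2 (λ o x → [] ⊢ (x :- o) :* # 0 := x :* # 0)
    r-sucʳ (suc n) k       = trans (*-cong (-‿cong₂ refl (P-suc n)) refl) (r-sucˡ n k)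

    r-P : ∀ n k → (P k - P (suc n)) * r (suc n) k ≈ P k * r n k
    r-P n k = r-sucʳ (suc n) k

    r-+ : ∀ k j → r (k ℕ.+ j) k ≡ iq j
    r-+ zero    j = ≡.refl
    r-+ (suc k) j = r-+ k j

    -- Terms with k > n vanish, and for k ≤ n the order n of the prefactor c is enough. The sums
    -- `Z₁` and `Z₀` carry the factor `P n` to supply such a c.
    Summable-r : ∀ {n} {c : Ser} {u : ℕ → Ser} (v : ℕ → Ser) → c ≈[ n ] 0# →
      (∀ k → u k ≈ c * (r n k * v k)) → Summable u
    Summable-r {n} v c≈0 eq k with ℕP.<-≤-connex n k
    ... | inj₁ n<k = ≈⇒≈[] (trans (eq k) (zeroʳ≈ (zeroˡ≈ (r-zero n k n<k))))
    ... | inj₂ k≤n = ≈[]-resp (sym (eq k)) refl (*-zeroˡ[] (≈[]-mono k≤n c≈0))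

    P≈0 : ∀ n → P n ≈[ n ] 0#
    P≈0 n = X≈0 _ (ℕP.m≤m+n n _)

    -- (-1)^k p^(k(k-1)/2)
    w : ℕ → Ser
    w zero    = 1#
    w (suc k) = - (P k * w k)

    wP≈0 : ∀ k → w k * P k ≈[ k ] 0#
    wP≈0 k = *-zeroʳ[] (P≈0 k)

    -- The numbers α_k of the unit Bailey pair relative to p, times 1 - p; the matching β_n is 1 for
    -- n = 0 and 0 otherwise.
    e₁ : ℕ → Ser
    e₁ k = w k * (1# - p * (P k * P k))

    Z₁ : ℕ → Ser
    Z₁ n = Sum (λ k → P n * (e₁ k * (r n k * iq (suc (k ℕ.+ n)))))

    Summable-Z₁ : ∀ n → Summable (λ k → P n * (e₁ k * (r n k * iq (suc (k ℕ.+ n)))))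
    Summable-Z₁ n = Summable-r (λ k → e₁ k * iq (suc (k ℕ.+ n))) (P≈0 n) λ k →
      lin 4 (λ P e r i → [] ⊢ P :* (e :* (r :* i)) := P :* (r :* (e :* i)))

    Z₁-0 : Z₁ 0 ≈ 1#
    Z₁-0 = trans (Sum-only-head λ k → lin 3 (λ a b c → [] ⊢ a :* (b :* (# 0 :* c)) := # 0))
      (lin 3 (λ o p i →
         i :* (# 1 :- p :* o :* (o :+ # 1)) ·[ o := # 1 ] ∷
         # 1 ·[ (# 1 :- p :* o) :* i := # 1 ] ∷ [] ⊢
         o :* ((# 1 :* (# 1 :- p :* (o :* o))) :* (# 1 :* i)) := # 1)
       P-0 (iq-suc 0))

    -- After multiplication by 1 - p^{n+1} the summand is a difference y k - y (k+1).
    Z₁-suc : ∀ n → Z₁ (suc n) ≈ 0#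
    Z₁-suc n = *-cancelˡ-0 (Unit-1-P n) (begin
      (1# - P (suc n)) * Z₁ (suc n)
        ≈⟨ Sum-*ˡ _ (Summable-Z₁ (suc n)) ⟩
      Sum (λ k → (1# - P (suc n)) * (P (suc n) * (e₁ k * (r (suc n) k * iq (suc (k ℕ.+ suc n))))))
        ≈⟨ Sum-cong step ⟩
      Sum (λ k → y k - y (suc k))
        ≈⟨ Sum-telescope summable ⟩
      y 0
        ≈⟨ lin 5 (λ o Q R I₀ I₁ →
             :- (Q :* R) ·[ (# 1 :- o :* Q) :* I₁ := I₀ ] ∷
             :- (Q :* R :* I₁) ·[ o := # 1 ] ∷ [] ⊢
             Q :* (# 1 :* (R :* (I₀ :- (# 1 :- Q) :* (o :* I₁)))) := # 0)
           (iq-P 0 n) P-0 ⟩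
      0# ∎)
      where
      y : ℕ → Ser
      -- The bracket at k = 0 is 1/(p)_n - (1 - p^{n+1})/(p)_{n+1} = 0, so the telescoped sum has no
      -- boundary term.
      y k = P (suc n) * (w k * (r (suc n) k * (iq (k ℕ.+ n) - (1# - P (suc n)) * (P k * iq (suc (k ℕ.+ n))))))
      summable : Summable y
      summable = Summable-r (λ k → w k * (iq (k ℕ.+ n) - (1# - P (suc n)) * (P k * iq (suc (k ℕ.+ n))))) (P≈0 (suc n))
        λ k → lin 4 (λ P e r i → [] ⊢ P :* (e :* (r :* i)) := P :* (r :* (e :* i)))
      step : ∀ k → (1# - P (suc n)) * (P (suc n) * (e₁ k * (r (suc n) k * iq (suc (k ℕ.+ suc n))))) ≈ y k - y (suc k)
      step k = lin 11 (λ p Q Pk Pk′ W R R′ J I₀ I₁ I₂ →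
        (# 1 :- Q) :* Q :* W :* R :* (# 1 :- p :* Pk :* Pk) ·[ J := I₂ ] ∷
        Q :* W :* R ·[ (# 1 :- Pk :* Q) :* I₁ := I₀ ] ∷
        Q :* W :* R :* (# 1 :- Q) ·[ (# 1 :- Pk′ :* Q) :* I₂ := I₁ ] ∷
        Q :* W :* (I₁ :- (# 1 :- Q) :* Pk′ :* I₂) ·[ (Pk :- Q) :* R := Pk :* R′ ] ∷
        Q :* W :* R :* (# 1 :- Q) :* Pk :* I₂ ·[ Pk′ := p :* Pk ] ∷ [] ⊢
        (# 1 :- Q) :* (Q :* ((W :* (# 1 :- p :* (Pk :* Pk))) :* (R :* J))) :=
        Q :* (W :* (R :* (I₀ :- (# 1 :- Q) :* (Pk :* I₁)))) :-
        Q :* ((:- (Pk :* W)) :* (R′ :* (I₁ :- (# 1 :- Q) :* (Pk′ :* I₂)))))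
        (reflexive (cong (iq ∘ suc) (ℕP.+-suc k n))) (iq-P k n) (iq-P (suc k) n) (r-P n k) (P-suc k)

    -- The numbers α_k of the unit Bailey pair relative to 1; folding k and -k leaves the weight 1
    -- at k = 0.
    e₀ : ℕ → Ser
    e₀ zero    = 1#
    e₀ (suc k) = w (suc k) * (1# + P (suc k))

    Z₀ : ℕ → Ser
    Z₀ n = Sum (λ k → P n * (e₀ k * (r n k * iq (k ℕ.+ n))))

    Z₀-suc : ∀ n → Z₀ (suc n) ≈ 0#
    Z₀-suc n = *-cancelˡ-0 (Unit-1-P n) (begin
      (1# - P (suc n)) * Z₀ (suc n)
        ≈⟨ Sum-*ˡ _ (Summable-r (λ k → e₀ k * iq (k ℕ.+ suc n)) (P≈0 (suc n)) λ k →
             lin 4 (λ P e r i → [] ⊢ P :* (e :* (r :* i)) := P :* (r :* (e :* i)))) ⟩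
      Sum (λ k → (1# - P (suc n)) * (P (suc n) * (e₀ k * (r (suc n) k * iq (k ℕ.+ suc n)))))
        ≈⟨ Sum-cong step ⟩
      Sum (λ k → y k - y (suc k))
        ≈⟨ Sum-telescope summable ⟩
      0# ∎)
      where
      y : ℕ → Ser
      y zero    = 0#
      y (suc k) = P (suc n) * (w (suc k) * (r n k * iq (suc (k ℕ.+ n))))
      summable : Summable y
      summable zero    = ≈[0]
      summable (suc k) = Summable-r {suc n} (λ k → w k * iq (k ℕ.+ n)) (P≈0 (suc n)) (λ k →
        lin 4 (λ P e r i → [] ⊢ P :* (e :* (r :* i)) := P :* (r :* (e :* i)))) (suc k)
      step : ∀ k → (1# - P (suc n)) * (P (suc n) * (e₀ k * (r (suc n) k * iq (k ℕ.+ suc n)))) ≈ y k - y (suc k)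
      step zero = lin 4 (λ o Q I₀ I₁ →
        Q :* I₁ ·[ (# 1 :- o :* Q) :* I₁ := I₀ ] ∷
        Q :* Q :* I₁ :* I₁ :- Q :* I₀ :* I₁ ·[ o := # 1 ] ∷ [] ⊢
        (# 1 :- Q) :* (Q :* (# 1 :* (I₁ :* I₁))) := # 0 :- Q :* (:- (o :* # 1) :* (I₀ :* I₁)))
        (iq-P 0 n) P-0
      step (suc k) = lin 8 (λ Q Pk W R R′ J I₀ I₁ →
        (# 1 :- Q) :* Q :* W :* (# 1 :+ Pk) :* R ·[ J := I₁ ] ∷
        Q :* W :* R ·[ (# 1 :- Pk :* Q) :* I₁ := I₀ ] ∷
        Q :* W :* I₁ ·[ (Pk :- Q) :* R := Pk :* R′ ] ∷ [] ⊢
        (# 1 :- Q) :* (Q :* ((W :* (# 1 :+ Pk)) :* (R :* J))) :=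
        Q :* (W :* (R :* I₀)) :- Q :* ((:- (Pk :* W)) :* (R′ :* I₁)))
        (reflexive (cong (iq ∘ suc) (ℕP.+-suc k n))) (iq-P (suc k) n) (r-P n (suc k))

  Sum-shift : ∀ k {T} → Summable T → (∀ n → n ℕ.< k → T n ≈ 0#) → Sum T ≈ Sum (λ j → T (k ℕ.+ j))
  Sum-shift zero    h v = refl
  Sum-shift (suc k) {T} h v = trans (Sum-head h)
    (trans (+-cong (v 0 (s≤s z≤n)) refl)
    (trans (+-identityˡ _) (Sum-shift k (Summable-suc h) λ n n<k → v (suc n) (s≤s n<k))))

  module Durfee-p (β : ℕ) where
    open Base-p β public

    iq∞ : Ser
    iq∞ = diag iq

    iq-lim : Lim iq iq∞
    iq-lim = Lim-diag λ n → ≈[]-resp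
      (lin 4 (λ o Q i j → :- # 1 ·[ (# 1 :- o :* Q) :* i := j ] ∷ :- (Q :* i) ·[ o := # 1 ] ∷ [] ⊢ j :+ Q :* i := i)
         (iq-P 0 n) P-0)
      (+-identityʳ (iq n))
      (+-cong[] ≈[]-refl (P*≈0 (suc n) ℕP.≤-refl))

    -- `r n k` agrees with its limit only modulo q^(n-k); the k lost powers are given back by the
    -- order k of the factor a.
    *r-lim : ∀ k {a} → a ≈[ k ] 0# → Lim (λ n → a * r n k) (a * iq∞)
    *r-lim k {a} a≈0 n with ℕP.<-≤-connex n k
    ... | inj₁ n<k = ≈[]-trans (*-zeroˡ[] a≈[n]0) (≈[]-sym (*-zeroˡ[] a≈[n]0))
      where a≈[n]0 = ≈[]-mono (ℕP.<⇒≤ n<k) a≈0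
    ... | inj₂ k≤n = ≈[]-resp (factor (r n k)) (factor iq∞) (*-cong[] ≈[]-refl
      (subst (λ n → X k * r n k ≈[ n ] X k * iq∞) (ℕP.m+[n∸m]≡n k≤n)
        (≈[]-resp (*-cong refl (reflexive (≡.sym (r-+ k j)))) refl (X*-cong[] k (iq-lim j)))))
      where
      j = n ℕ.∸ k
      factor : ∀ x → drop k a * (X k * x) ≈ a * x
      factor x = lin 4 (λ d X x a → :- x ·[ a := X :* d ] ∷ [] ⊢ d :* (X :* x) := a :* x) (≈[]0⇒X* k a≈0)

    -- Partial fractions: Σ_k e_k p^k g_k / ((p)_{n-k} (p)_{n+k+a}) = S_0 / (D_1 ⋯ D_n) as soon as
    -- D_k g_k does not depend on k and the same sum without the g_k vanishes.
    module PartialFractions (a : ℕ) (s G : Ser) (e g : ℕ → Ser) where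

      D : ℕ → Ser
      D k = 1# - s * P k + P a * (P k * P k)

      S : ℕ → Ser
      S n = Sum (λ k → (e k * P k) * (g k * (r n k * iq (a ℕ.+ (k ℕ.+ n)))))

      S∞ : Ser
      S∞ = Sum (λ k → (e k * P k) * g k)

      ∏D : ℕ → Ser
      ∏D zero    = 1#
      ∏D (suc n) = D (suc n) * ∏D n

      module _
        (Dg : ∀ k → D k * g k ≈ G)
        (eP≈0 : Summable (λ k → e k * P k))
        (Z : ∀ n → Sum (λ k → P (suc n) * (e k * (r (suc n) k * iq (a ℕ.+ (k ℕ.+ suc n))))) ≈ 0#)
        where

        -- Everything rests on p^k D_{n+1} = p^{n+1} D_k + (p^k - p^{n+1})(1 - p^{a+k+n+1}). In the
        -- first summand D_k g_k is the constant G, and the sum vanishes by Z; in the second the two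
        -- factors lower the indices of the q-factorials and leave S_n.
        S-step : ∀ n → D (suc n) * S (suc n) ≈ S n
        S-step n = begin
          D (suc n) * S (suc n)
            ≈⟨ Sum-*ˡ _ (λ k → *-zeroˡ[] (eP≈0 k)) ⟩
          Sum (λ k → D (suc n) * ((e k * P k) * (g k * (r (suc n) k * iq (a ℕ.+ (k ℕ.+ suc n))))))
            ≈⟨ Sum-cong step ⟩
          Sum (λ k → G * (P (suc n) * (e k * (r (suc n) k * iq (a ℕ.+ (k ℕ.+ suc n))))) +
                     (e k * P k) * (g k * (r n k * iq (a ℕ.+ (k ℕ.+ n)))))
            ≈⟨ Sum-+ (λ k → G * (P (suc n) * (e k * (r (suc n) k * iq (a ℕ.+ (k ℕ.+ suc n)))))) _ ⟩
          Sum (λ k → G * (P (suc n) * (e k * (r (suc n) k * iq (a ℕ.+ (k ℕ.+ suc n)))))) + S n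
            ≈⟨ +-cong (sym (Sum-*ˡ G (Summable-r (λ k → e k * iq (a ℕ.+ (k ℕ.+ suc n))) (P≈0 (suc n)) λ k →
                 lin 4 (λ P e r i → [] ⊢ P :* (e :* (r :* i)) := P :* (r :* (e :* i)))))) refl ⟩
          G * Sum (λ k → P (suc n) * (e k * (r (suc n) k * iq (a ℕ.+ (k ℕ.+ suc n))))) + S n
            ≈⟨ lin 3 (λ G z s → G ·[ z := # 0 ] ∷ [] ⊢ G :* z :+ s := s) (Z n) ⟩
          S n ∎
          where
          index : ∀ a k n → suc (a ℕ.+ k ℕ.+ n) ≡ a ℕ.+ (k ℕ.+ suc n)
          index = solve-∀
          iq-rec : ∀ k → (1# - P a * P k * P (suc n)) * iq (a ℕ.+ (k ℕ.+ suc n)) ≈ iq (a ℕ.+ (k ℕ.+ n))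
          iq-rec k = trans (*-cong (-‿cong₂ refl (*-cong (sym (P-+ a k)) refl))
              (reflexive (cong iq (≡.sym (index a k n)))))
            (trans (iq-P (a ℕ.+ k) n) (reflexive (cong iq (ℕP.+-assoc a k n))))
          step : ∀ k → D (suc n) * ((e k * P k) * (g k * (r (suc n) k * iq (a ℕ.+ (k ℕ.+ suc n))))) ≈
            G * (P (suc n) * (e k * (r (suc n) k * iq (a ℕ.+ (k ℕ.+ suc n))))) +
            (e k * P k) * (g k * (r n k * iq (a ℕ.+ (k ℕ.+ n))))
          step k = lin 11 (λ s Pa Pk Q G e g R R′ I J →
            Q :* e :* R :* J ·[ (# 1 :- s :* Pk :+ Pa :* (Pk :* Pk)) :* g := G ] ∷
            e :* g :* Pk :* R′ ·[ (# 1 :- Pa :* Pk :* Q) :* J := I ] ∷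
            e :* g :* J :* (# 1 :- Pa :* Pk :* Q) ·[ (Pk :- Q) :* R := Pk :* R′ ] ∷ [] ⊢
            (# 1 :- s :* Q :+ Pa :* (Q :* Q)) :* ((e :* Pk) :* (g :* (R :* J))) :=
            G :* (Q :* (e :* (R :* J))) :+ (e :* Pk) :* (g :* (R′ :* I)))
            (Dg k) (iq-rec k) (r-P n k)

        S-∏D : ∀ n → ∏D n * S n ≈ S 0
        S-∏D zero    = *-identityˡ (S 0)
        S-∏D (suc n) = lin 5 (λ D p t u v → p ·[ D :* t := u ] ∷ # 1 ·[ p :* u := v ] ∷ [] ⊢ D :* p :* t := v)
          (S-step n) (S-∏D n)

        S-lim : Lim S (iq∞ * iq∞ * S∞)
        S-lim n = ≈[]-resp refl (sym sum≈) (Lim-Sum term n)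
          where
          sum≈ : iq∞ * iq∞ * S∞ ≈ Sum (λ k → g k * ((e k * P k * iq∞) * iq∞))
          sum≈ = trans (Sum-*ˡ (iq∞ * iq∞) (λ k → *-zeroˡ[] (eP≈0 k)))
            (Sum-cong λ k → lin 4 (λ i e P g → [] ⊢ i :* i :* ((e :* P) :* g) := g :* ((e :* P :* i) :* i)))
          term : ∀ k → Lim (λ n → (e k * P k) * (g k * (r n k * iq (a ℕ.+ (k ℕ.+ n)))))
                           (g k * ((e k * P k * iq∞) * iq∞))
          term k = Lim-cong
            (λ n → lin 5 (λ e P g r i → [] ⊢ g :* ((e :* P :* r) :* i) := (e :* P) :* (g :* (r :* i))))
            (Lim-* Lim-const (Lim-* (*r-lim k (eP≈0 k))
              (Lim-reindex (λ n → a ℕ.+ (k ℕ.+ n)) (λ n → ℕP.≤-trans (ℕP.m≤n+m n k) (ℕP.m≤n+m _ a)) iq-lim)))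

    private
      E : ℕ → ℕ → Ser
      E m j = X (suc β ℕ.* (j ℕ.* (j ℕ.+ m))) * (iq j * iq (j ℕ.+ m))

      exponent≥ : ∀ j m → j ≤ suc β ℕ.* (j ℕ.* (j ℕ.+ m))
      exponent≥ zero    m = z≤n
      exponent≥ (suc j) m = ℕP.≤-trans (ℕP.m≤m*n (suc j) (suc j ℕ.+ m)) (ℕP.m≤m+n _ _)

      Summable-E : ∀ m → Summable (E m)
      Summable-E m j = *-zeroˡ[] (X≈0 _ (exponent≥ j m))

      rec : ∀ m → Sum (E m) ≈ P (suc m) * Sum (E (suc (suc m))) + (1# - P (suc m)) * Sum (E (suc m))
      rec m = begin
        Sum (E m)
          ≈⟨ Sum-cong split ⟩
        Sum (λ j → U j + (1# - P (suc m)) * E (suc m) j)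
          ≈⟨ Sum-+ U _ ⟩
        Sum U + Sum (λ j → (1# - P (suc m)) * E (suc m) j)
          ≈⟨ +-cong (trans (Sum-head Summable-U) (trans (+-cong U-0 refl) (+-identityˡ _)))
                    (sym (Sum-*ˡ _ (Summable-E (suc m)))) ⟩
        Sum (U ∘ suc) + (1# - P (suc m)) * Sum (E (suc m))
          ≈⟨ +-cong (trans (Sum-cong U-suc) (sym (Sum-*ˡ _ (Summable-E (suc (suc m)))))) refl ⟩
        P (suc m) * Sum (E (suc (suc m))) + (1# - P (suc m)) * Sum (E (suc m)) ∎
        where
        A U : ℕ → Ser
        A j = X (suc β ℕ.* (j ℕ.* (j ℕ.+ m)))
        U j = A j * ((1# - P j) * iq j * iq (suc (j ℕ.+ m)))
        Summable-U : Summable U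
        Summable-U j = *-zeroˡ[] (X≈0 _ (exponent≥ j m))
        exponent-m : ∀ b j m → b ℕ.* (j ℕ.* (j ℕ.+ suc m)) ≡ b ℕ.* (j ℕ.* (j ℕ.+ m)) ℕ.+ b ℕ.* j
        exponent-m = solve-∀
        exponent-j : ∀ b j m →
          b ℕ.* (suc j ℕ.* (suc j ℕ.+ m)) ≡ b ℕ.* suc m ℕ.+ b ℕ.* (j ℕ.* (j ℕ.+ suc (suc m)))
        exponent-j = solve-∀
        index : ∀ j m → suc (suc j ℕ.+ m) ≡ j ℕ.+ suc (suc m)
        index = solve-∀
        -- From 1/(p)_{j+m} = (1 - p^{j+m+1})/(p)_{j+m+1} and 1 - p^{j+m+1} = (1 - p^j) + p^j (1 -
        -- p^{m+1}). The part with 1 - p^j vanishes at j = 0, so its index can be shifted.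
        split : ∀ j → E m j ≈ U j + (1# - P (suc m)) * E (suc m) j
        split j = lin 8 (λ A A′ Pj Pm I J₀ J₁ J₁′ →
          :- (A :* I) ·[ (# 1 :- Pj :* Pm) :* J₁ := J₀ ] ∷
          :- ((# 1 :- Pm) :* A′ :* I) ·[ J₁′ := J₁ ] ∷
          :- ((# 1 :- Pm) :* I :* J₁) ·[ A′ := A :* Pj ] ∷ [] ⊢
          A :* (I :* J₀) := A :* ((# 1 :- Pj) :* I :* J₁) :+ (# 1 :- Pm) :* (A′ :* (I :* J₁′)))
          (iq-P j m) (reflexive (cong iq (ℕP.+-suc j m)))
          (X-split (suc β ℕ.* (j ℕ.* (j ℕ.+ m))) (suc β ℕ.* j) (exponent-m (suc β) j m))
        U-0 : U 0 ≈ 0#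
        U-0 = lin 3 (λ a o i → :- (a :* i) ·[ o := # 1 ] ∷ [] ⊢ a :* ((# 1 :- o) :* # 1 :* i) := # 0) P-0
        U-suc : ∀ j → U (suc j) ≈ P (suc m) * E (suc (suc m)) j
        U-suc j = lin 9 (λ o A A′ Pj Pm I I′ J J′ →
          I′ :* (# 1 :- Pj) :* J ·[ A := Pm :* A′ ] ∷
          Pm :* A′ :* J ·[ (# 1 :- o :* Pj) :* I′ := I ] ∷
          Pm :* A′ :* J :* Pj :* I′ ·[ o := # 1 ] ∷
          Pm :* A′ :* I ·[ J := J′ ] ∷ [] ⊢
          A :* ((# 1 :- Pj) :* I′ :* J) := Pm :* (A′ :* (I :* J′)))
          (X-split (suc β ℕ.* suc m) (suc β ℕ.* (j ℕ.* (j ℕ.+ suc (suc m)))) (exponent-j (suc β) j m))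
          (iq-P 0 j) P-0 (reflexive (cong iq (index j m)))

      -- Writing E_m for the sum, `rec` says E_m - E_{m+1} = -p^{m+1} (E_{m+1} - E_{m+2}); each
      -- application raises the order, so the difference is 0.
      descent : ∀ n m → Sum (E m) - Sum (E (suc m)) ≈[ n ] 0#
      descent zero    m = ≈[0]
      descent (suc n) m = ≈[]-resp
        (lin 4 (λ P a b c → :- # 1 ·[ a := P :* c :+ (# 1 :- P) :* b ] ∷ [] ⊢ :- P :* (b :- c) := a :- b) (rec m)) refl
        (≈[]-resp (lin 2 (λ P x → [] ⊢ :- (P :* x) := :- P :* x)) refl (-‿zero[]
          (≈[]-resp refl (zeroʳ (P (suc m)))
            (≈[]-mono (s≤s (ℕP.m≤n+m n _)) (X*-cong[] (suc β ℕ.* suc m) (descent n (suc m)))))))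

      constant : ∀ m → Sum (E 0) ≈ Sum (E m)
      constant zero    = refl
      constant (suc m) = trans (constant m)
        (lin 2 (λ a b → # 1 ·[ a :- b := # 0 ] ∷ [] ⊢ a := b) (≈[]⇒≈ λ n → descent n m))

      E-lim : Lim (λ m → Sum (E m)) iq∞
      E-lim m = ≈[]-trans (≈⇒≈[] (Sum-head (Summable-E m))) (≈[]-trans
        (+-cong[] {b = Sum (E m ∘ suc)} {b′ = 0#} (≈[]-resp (sym head) refl (iq-lim m))
          (≈[]-trans (Sum-cong[] λ j → tail≈0 j) (≈⇒≈[] (Sum-0 λ _ → refl))))
        (≈⇒≈[] (+-identityʳ iq∞)))
        where
        head : E m 0 ≈ iq m
        head = trans (*-cong P-0 (*-identityˡ (iq m))) (*-identityˡ (iq m))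
        tail≈0 : ∀ j → E m (suc j) ≈[ m ] 0#
        tail≈0 j = *-zeroˡ[] (X≈0 _ (ℕP.≤-trans (ℕP.m≤n+m m (suc j))
          (ℕP.≤-trans (ℕP.m≤m+n _ _) (ℕP.m≤m+n _ _))))

    -- The sum does not depend on m, and for m → ∞ only the term j = 0 survives, with limit 1/(p)_∞.
    Durfee-sum : ∀ m → Sum (λ j → X (suc β ℕ.* (j ℕ.* (j ℕ.+ m))) * (iq j * iq (j ℕ.+ m))) ≈ iq∞
    Durfee-sum m = trans (sym (constant m))
      (Lim-unique Lim-const (Lim-cong (λ n → sym (constant n)) E-lim))

    Psq : ℕ → ℕ → Ser
    Psq a n = X (suc β ℕ.* (n ℕ.* (n ℕ.+ a)))

    Psq≈0 : ∀ a n → Psq a n ≈[ n ] 0#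
    Psq≈0 a n = X≈0 _ (exponent≥ n a)

    -- Bailey's lemma. After exchanging the sums, n = k + j splits n(n+a) as k(k+a) + j(j+a+2k), so
    -- the inner sum is `Durfee-sum` at m = a + 2k.
    Bailey-sum : ∀ a (u : ℕ → Ser) → Summable (λ k → u k * Psq a k) →
      Sum (λ n → Sum (λ k → Psq a n * (u k * (r n k * iq (a ℕ.+ (k ℕ.+ n)))))) ≈
      iq∞ * Sum (λ k → u k * Psq a k)
    Bailey-sum a u summable = begin
      Sum (λ n → Sum (λ k → Psq a n * (u k * (r n k * iq (a ℕ.+ (k ℕ.+ n))))))
        ≈⟨ Sum-swap _ ⟩
      Sum (λ k → Sum (λ n → Psq a n * (u k * (r n k * iq (a ℕ.+ (k ℕ.+ n))))))
        ≈⟨ Sum-cong inner ⟩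
      Sum (λ k → iq∞ * (u k * Psq a k))
        ≈⟨ Sum-*ˡ iq∞ summable ⟨
      iq∞ * Sum (λ k → u k * Psq a k) ∎
      where
      exponent : ∀ b a k j → b ℕ.* ((k ℕ.+ j) ℕ.* (k ℕ.+ j ℕ.+ a)) ≡
        b ℕ.* (k ℕ.* (k ℕ.+ a)) ℕ.+ b ℕ.* (j ℕ.* (j ℕ.+ (a ℕ.+ 2 ℕ.* k)))
      exponent = solve-∀
      index : ∀ a k j → a ℕ.+ (k ℕ.+ (k ℕ.+ j)) ≡ j ℕ.+ (a ℕ.+ 2 ℕ.* k)
      index = solve-∀
      inner : ∀ k → Sum (λ n → Psq a n * (u k * (r n k * iq (a ℕ.+ (k ℕ.+ n))))) ≈ iq∞ * (u k * Psq a k)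
      inner k = begin
        Sum (λ n → Psq a n * (u k * (r n k * iq (a ℕ.+ (k ℕ.+ n)))))
          ≈⟨ Sum-shift k (λ n → *-zeroˡ[] (Psq≈0 a n))
               (λ n n<k → zeroʳ≈ (zeroʳ≈ (zeroˡ≈ (r-zero n k n<k)))) ⟩
        Sum (λ j → Psq a (k ℕ.+ j) * (u k * (r (k ℕ.+ j) k * iq (a ℕ.+ (k ℕ.+ (k ℕ.+ j))))))
          ≈⟨ Sum-cong (λ j → trans
               (*-cong (X-split _ _ (exponent (suc β) a k j)) (*-cong refl
                 (*-cong (reflexive (r-+ k j)) (reflexive (cong iq (index a k j))))))
               (lin 4 (λ x y u i → [] ⊢ x :* y :* (u :* i) := (u :* x) :* (y :* i)))) ⟩
        Sum (λ j → (u k * Psq a k) * E (a ℕ.+ 2 ℕ.* k) j)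
          ≈⟨ Sum-*ˡ _ (Summable-E (a ℕ.+ 2 ℕ.* k)) ⟨
        (u k * Psq a k) * Sum (E (a ℕ.+ 2 ℕ.* k))
          ≈⟨ *-cong refl (Durfee-sum (a ℕ.+ 2 ℕ.* k)) ⟩
        (u k * Psq a k) * iq∞
          ≈⟨ *-comm _ _ ⟩
        iq∞ * (u k * Psq a k) ∎

-- Infinite products and the series f_k.

module Products where
  open Durfee public

  ∏ : (ℕ → Ser) → ℕ → Ser
  ∏ F zero    = 1#
  ∏ F (suc n) = ∏ F n * F n

  ∏∞ : (ℕ → Ser) → Ser
  ∏∞ F = diag (∏ F)

  Multipliable : (ℕ → Ser) → Set
  Multipliable F = ∀ n → F n ≈[ suc n ] 1#

  ∏-cong : ∀ {F G} → (∀ n → F n ≈ G n) → ∀ n → ∏ F n ≈ ∏ G n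
  ∏-cong h zero    = refl
  ∏-cong h (suc n) = *-cong (∏-cong h n) (h n)

  ∏∞-cong : ∀ {F G} → (∀ n → F n ≈ G n) → ∏∞ F ≈ ∏∞ G
  ∏∞-cong h = diag-cong (∏-cong h)

  ∏-lim : ∀ {F} → Multipliable F → Lim (∏ F) (∏∞ F)
  ∏-lim {F} h = Lim-diag λ n → ≈[]-resp refl (*-identityʳ (∏ F n)) (*-cong[] ≈[]-refl (h n))

  Multipliable-* : ∀ {F G} → Multipliable F → Multipliable G → Multipliable (λ n → F n * G n)
  Multipliable-* p q n = ≈[]-resp refl (*-identityˡ 1#) (*-cong[] (p n) (q n))

  ∏-* : ∀ F G n → ∏ (λ n → F n * G n) n ≈ ∏ F n * ∏ G n
  ∏-* F G zero    = sym (*-identityˡ 1#)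
  ∏-* F G (suc n) = lin 5 (λ t u v x y → x :* y ·[ t := u :* v ] ∷ [] ⊢ t :* (x :* y) := (u :* x) :* (v :* y)) (∏-* F G n)

  ∏∞-* : ∀ {F G} → Multipliable F → Multipliable G → ∏∞ (λ n → F n * G n) ≈ ∏∞ F * ∏∞ G
  ∏∞-* {F} {G} p q = Lim-unique (∏-lim (Multipliable-* p q))
    (Lim-cong (λ n → sym (∏-* F G n)) (Lim-* (∏-lim p) (∏-lim q)))

  ∏∞-split₂ : ∀ {F} → Multipliable F → ∏∞ F ≈ ∏∞ (λ n → F (2 ℕ.* n)) * ∏∞ (λ n → F (suc (2 ℕ.* n)))
  ∏∞-split₂ {F} h = Lim-unique (Lim-reindex (2 ℕ.*_) (λ n → ℕP.m≤m+n n _) (∏-lim h))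
    (Lim-cong (λ n → sym (pairs n)) (Lim-* (∏-lim even) (∏-lim odd)))
    where
    even : Multipliable (λ n → F (2 ℕ.* n))
    even n = ≈[]-mono (s≤s (ℕP.m≤m+n n _)) (h (2 ℕ.* n))
    odd : Multipliable (λ n → F (suc (2 ℕ.* n)))
    odd n = ≈[]-mono (s≤s (ℕP.≤-trans (ℕP.m≤m+n n _) (ℕP.n≤1+n _))) (h (suc (2 ℕ.* n)))
    pairs : ∀ n → ∏ F (2 ℕ.* n) ≈ ∏ (λ n → F (2 ℕ.* n)) n * ∏ (λ n → F (suc (2 ℕ.* n))) n
    pairs zero    = sym (*-identityˡ 1#)
    pairs (suc n) = trans (reflexive (cong (∏ F) (ℕP.*-suc 2 n)))
      (lin 5 (λ t u v x y → x :* y ·[ t := u :* v ] ∷ [] ⊢ (t :* x) :* y := (u :* x) :* (v :* y)) (pairs n))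

  Unit-∏∞ : ∀ {F} → Multipliable F → Unit (∏∞ F)
  Unit-∏∞ {F} h = ≈[]-trans (≈[]-sym (∏-lim h 1))
    (≈[]-resp refl (*-identityˡ 1#) (*-cong[] ≈[]-refl (h 0)))

  ⟨_,_⟩⁻ ⟨_,_⟩⁺ : ℕ → ℕ → ℕ → Ser
  ⟨ r , s ⟩⁻ = ∏ λ n → 1# - X (r ℕ.+ s ℕ.* n)
  ⟨ r , s ⟩⁺ = ∏ λ n → 1# + X (r ℕ.+ s ℕ.* n)

  opaque
    unfolding Ser

    f : ℕ → Ser
    f k = D.fq k

    poch⁻ : ∀ r s n → ⟪ D.poch (+ 1) r s n ⟫ ≈ ⟨ r , s ⟩⁻ n
    poch⁻ r s zero    = one≈1#
    poch⁻ r s (suc n) = *-cong (poch⁻ r s n) (+-cong one≈1# λ i →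
      cong (ℤ._*_ (ℤ.- (+ 1))) (ℤP.*-identityˡ (X (r ℕ.+ s ℕ.* n) i)))

    poch⁺ : ∀ r s n → ⟪ D.poch (ℤ.- (+ 1)) r s n ⟫ ≈ ⟨ r , s ⟩⁺ n
    poch⁺ r s zero    = one≈1#
    poch⁺ r s (suc n) = *-cong (poch⁺ r s n) (+-cong one≈1# λ i →
      ≡.trans (≡.sym (ℤP.*-assoc (ℤ.- (+ 1)) (ℤ.- (+ 1)) (X (r ℕ.+ s ℕ.* n) i))) (ℤP.*-identityˡ _))

    f≈diag : ∀ k → f k ≈ diag ⟨ k , k ⟩⁻
    f≈diag k n = poch⁻ k k n n

  f≈∏∞ : ∀ b → f b ≈ ∏∞ (λ n → 1# - X (b ℕ.* suc n))
  f≈∏∞ b = trans (f≈diag b) (∏∞-cong λ n → -‿cong₂ refl (X-≡ (≡.sym (ℕP.*-suc b n))))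

  module _ (β : ℕ) where
    private
      b = suc β

    Multipliable-1-X : ∀ (φ : ℕ → ℕ) → (∀ n → n ℕ.< φ n) → Multipliable (λ n → 1# - X (b ℕ.* φ n))
    Multipliable-1-X φ h n = ≈[]-resp refl (lin 0 ([] ⊢ # 1 :- # 0 := # 1))
      (+-cong[] ≈[]-refl (-‿cong[] (X≈0 _ (ℕP.≤-trans (h n) (ℕP.m≤m+n _ _)))))

    Multipliable-1+X : ∀ (φ : ℕ → ℕ) → (∀ n → n ℕ.< φ n) → Multipliable (λ n → 1# + X (b ℕ.* φ n))
    Multipliable-1+X φ h n = ≈[]-resp refl (+-identityʳ 1#)
      (+-cong[] ≈[]-refl (X≈0 _ (ℕP.≤-trans (h n) (ℕP.m≤m+n _ _))))

    private
      all : ∀ n → n ℕ.< suc n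
      all n = ℕP.≤-refl
      odd : ∀ n → n ℕ.< suc (2 ℕ.* n)
      odd n = s≤s (ℕP.m≤m+n n _)

    Unit-f : Unit (f b)
    Unit-f = ≈[]-resp (sym (f≈∏∞ b)) refl (Unit-∏∞ (Multipliable-1-X suc all))

    ∏odd⁻ ∏odd⁺ ∏all⁺ : Ser
    ∏odd⁻ = ∏∞ λ n → 1# - X (b ℕ.* suc (2 ℕ.* n))
    ∏odd⁺ = ∏∞ λ n → 1# + X (b ℕ.* suc (2 ℕ.* n))
    ∏all⁺ = ∏∞ λ n → 1# + X (b ℕ.* suc n)

    ∏odd⁻-lim : Lim (∏ λ n → 1# - X (b ℕ.* suc (2 ℕ.* n))) ∏odd⁻
    ∏odd⁻-lim = ∏-lim (Multipliable-1-X _ odd)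

    ∏odd⁺-lim : Lim (∏ λ n → 1# + X (b ℕ.* suc (2 ℕ.* n))) ∏odd⁺
    ∏odd⁺-lim = ∏-lim (Multipliable-1+X _ odd)

    ∏all⁺-lim : Lim (∏ λ n → 1# + X (b ℕ.* suc n)) ∏all⁺
    ∏all⁺-lim = ∏-lim (Multipliable-1+X _ all)

    f-odd : f b ≈ ∏odd⁻ * f (2 ℕ.* b)
    f-odd = trans (f≈∏∞ b) (trans (∏∞-split₂ (Multipliable-1-X suc all)) (*-cong refl
      (trans (∏∞-cong λ n → -‿cong₂ refl (X-≡ (exponent b n))) (sym (f≈∏∞ (2 ℕ.* b))))))
      where
      exponent : ∀ b n → b ℕ.* suc (suc (2 ℕ.* n)) ≡ 2 ℕ.* b ℕ.* suc n
      exponent = solve-∀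

    private
      difference-of-squares : ∀ φ → (∀ n → n ℕ.< φ n) → ∏∞ (λ n → 1# + X (b ℕ.* φ n)) * ∏∞ (λ n → 1# - X (b ℕ.* φ n)) ≈
        ∏∞ (λ n → 1# - X (2 ℕ.* b ℕ.* φ n))
      difference-of-squares φ h = trans (sym (∏∞-* (Multipliable-1+X φ h) (Multipliable-1-X φ h)))
        (∏∞-cong λ n → lin 2 (λ x y → # 1 ·[ y := x :* x ] ∷ [] ⊢ (# 1 :+ x) :* (# 1 :- x) := # 1 :- y)
          (X-split (b ℕ.* φ n) (b ℕ.* φ n) (exponent b (φ n))))
        where
        exponent : ∀ b n → 2 ℕ.* b ℕ.* n ≡ b ℕ.* n ℕ.+ b ℕ.* n
        exponent = solve-∀

    ∏all⁺-f : ∏all⁺ * f b ≈ f (2 ℕ.* b)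
    ∏all⁺-f = trans (*-cong refl (f≈∏∞ b)) (trans (difference-of-squares suc all) (sym (f≈∏∞ (2 ℕ.* b))))

    ∏odd⁺-odd : ∏odd⁺ * ∏odd⁻ ≈ ∏∞ (λ n → 1# - X (2 ℕ.* b ℕ.* suc (2 ℕ.* n)))
    ∏odd⁺-odd = difference-of-squares _ odd

  ∏odd⁺-f : ∀ β → ∏odd⁺ β * (f (suc β) * f (2 ℕ.* (2 ℕ.* suc β))) ≈ f (2 ℕ.* suc β) * f (2 ℕ.* suc β)
  ∏odd⁺-f β = lin 6 (λ B O O₂ f₁ f₂ f₄ →
    B :* f₄ ·[ f₁ := O :* f₂ ] ∷ :- f₂ ·[ f₂ := O₂ :* f₄ ] ∷ f₂ :* f₄ ·[ B :* O := O₂ ] ∷ [] ⊢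
    B :* (f₁ :* f₄) := f₂ :* f₂)
    (f-odd β) (f-odd (β ℕ.+ (suc β ℕ.+ 0))) (∏odd⁺-odd β)

  module Products-p (β : ℕ) where
    open Durfee-p β public

    iq∞-f : iq∞ * f (suc β) ≈ 1#
    iq∞-f = Lim-unique
      (≈-lim (Lim-* iq-lim (∏-lim (Multipliable-1-X β suc λ _ → ℕP.≤-refl))))
      (Lim-cong (λ n → sym (iq-∏ n)) Lim-const)
      where
      iq-∏ : ∀ n → iq n * ∏ (λ n → 1# - P (suc n)) n ≈ 1#
      iq-∏ zero    = *-identityˡ 1#
      iq-∏ (suc n) = lin 5 (λ o i i′ t Q →
        t ·[ (# 1 :- o :* Q) :* i′ := i ] ∷ i′ :* Q :* t ·[ o := # 1 ] ∷ # 1 ·[ i :* t := # 1 ] ∷ [] ⊢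
        i′ :* (t :* (# 1 :- Q)) := # 1) (iq-P 0 n) P-0 (iq-∏ n)
      ≈-lim : ∀ {a} → Lim a (iq∞ * ∏∞ (λ n → 1# - P (suc n))) → Lim a (iq∞ * f (suc β))
      ≈-lim h n = ≈[]-resp refl (*-cong refl (sym (f≈∏∞ (suc β)))) (h n)

-- Jacobi's triple product and the series of φ and ψ.

module TripleProduct where
  open Products public

  -- The finite Jacobi triple product for c_k = z^k p^{k(k-1)/2}, k ∈ ℤ. Negative powers are avoided by
  -- keeping c_k and d_k = c_{-k} for k ≥ 0 only, with x_n = z p^n and y_n = z^{-1} p^{n+1}.
  module Jacobi-p (β : ℕ) (c d x y : ℕ → Ser)
    (c-0 : c 0 ≈ 1#) (d-0 : d 0 ≈ 1#)
    (c-y : ∀ n k → c k * Base-p.P β (suc n) * Base-p.P β k ≈ y n * c (suc k))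
    (d-y : ∀ n k → d (suc k) * Base-p.P β n ≈ y n * Base-p.P β k * d k)
    (c-x : ∀ n k → c (suc k) * Base-p.P β n ≈ x n * Base-p.P β k * c k)
    (d-x : ∀ n k → d k * Base-p.P β (suc n) * Base-p.P β k ≈ x n * d (suc k))
    (c≈0 : Summable c) (d≈0 : Summable (d ∘ suc))
    where

    open Products-p β

    private
      v v′ z z′ : ℕ → ℕ → Ser
      v  n k = c k * (r n k * iq (k ℕ.+ n))
      v′ n k = d k * (r n k * iq (k ℕ.+ n))
      z  n k = c k * (r n k * iq (suc (k ℕ.+ n)))
      z′ n k = d (suc k) * (r n k * iq (suc (k ℕ.+ n)))

      -- The finite products divided by (p)_{2n} and (p)_{2n+1}: V n has n factors 1 + x_i and n
      -- factors 1 + y_i, and W n has the additional factor 1 + y_n. The two steps that follow are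
      -- q-Pascal rules adding one factor each.
      V W : ℕ → Ser
      V n = Sum (v n) + Sum (v′ n ∘ suc)
      W n = Sum (z n) + Sum (z′ n)

      Summable-v : ∀ n → Summable (v n)
      Summable-v n k = *-zeroˡ[] (c≈0 k)
      Summable-v′ : ∀ n → Summable (v′ n ∘ suc)
      Summable-v′ n k = *-zeroˡ[] (d≈0 k)
      Summable-z : ∀ n → Summable (z n)
      Summable-z n k = *-zeroˡ[] (c≈0 k)
      Summable-z′ : ∀ n → Summable (z′ n)
      Summable-z′ n k = *-zeroˡ[] (d≈0 k)

      head : ∀ n → v n 0 ≈ v′ n 0
      head n = *-cong (trans c-0 (sym d-0)) refl

    W-step : ∀ n → (1# - P n * P (suc n)) * W n ≈ (1# + y n) * V n
    W-step n = lin 10 (λ u y Sz Sz′ Sv Tv Tv′ Y v₀ v₀′ →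
        # 1 ·[ u :* Sz := Sv :+ y :* Tv ] ∷
        # 1 ·[ u :* Sz′ := Tv′ :+ Y ] ∷
        # 1 ·[ Y := y :* v₀′ :+ y :* Tv′ ] ∷
        :- y ·[ v₀ := v₀′ ] ∷
        :- y ·[ Sv := v₀ :+ Tv ] ∷ [] ⊢
        u :* (Sz :+ Sz′) := (# 1 :+ y) :* (Sv :+ Tv′))
      z-sum z′-sum (trans (Sum-head yv′≈0) (+-cong refl (sym (Sum-*ˡ (y n) (Summable-v′ n)))))
      (head n) (Sum-head (Summable-v n))
      where
      z-step : ∀ k → (1# - P n * P (suc n)) * z n k ≈ v n k + y n * v n (suc k)
      z-step k = lin 10 (λ Pn Q Pk y c c′ R R′ I₀ I₁ →
        c :* R ·[ (# 1 :- Pk :* Q) :* I₁ := I₀ ] ∷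
        R′ :* I₁ ·[ c :* Q :* Pk := y :* c′ ] ∷
        c :* Q :* I₁ ·[ (Pk :- Pn) :* R := Pk :* R′ ] ∷ [] ⊢
        (# 1 :- Pn :* Q) :* (c :* (R :* I₁)) := c :* (R :* I₀) :+ y :* (c′ :* (R′ :* I₁)))
        (iq-P k n) (c-y n k) (r-sucʳ n k)
      z′-step : ∀ k → (1# - P n * P (suc n)) * z′ n k ≈ v′ n (suc k) + y n * v′ n k
      z′-step k = X*-cancel (suc β ℕ.* k) (lin 10 (λ Pn Q Pk y d d′ R R′ I₀ I₁ →
        Pn :* d′ :* R ·[ (# 1 :- Pk :* Q) :* I₁ := I₀ ] ∷
        R :* I₀ ·[ d′ :* Pn := y :* Pk :* d ] ∷
        d′ :* I₁ ·[ (Pk :- Pn) :* R := Pk :* R′ ] ∷ [] ⊢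
        Pk :* ((# 1 :- Pn :* Q) :* (d′ :* (R :* I₁))) := Pk :* (d′ :* (R′ :* I₁) :+ y :* (d :* (R :* I₀))))
        (iq-P k n) (d-y n k) (r-sucʳ n k))
      yv′≈0 : Summable (λ k → y n * v′ n k)
      yv′≈0 k = ≈[]-resp
        (lin 3 (λ a b c → # 1 ·[ a := b :+ c ] ∷ [] ⊢ a :- b := c) (z′-step k)) refl
        (+-zero[] (*-zeroʳ[] (Summable-z′ n k)) (-‿zero[] (Summable-v′ n k)))
      z-sum : (1# - P n * P (suc n)) * Sum (z n) ≈ Sum (v n) + y n * Sum (v n ∘ suc)
      z-sum = trans (Sum-*ˡ _ (Summable-z n)) (trans (Sum-cong z-step) (trans (Sum-+ (v n) _)
        (+-cong refl (sym (Sum-*ˡ (y n) (Summable-suc (Summable-v n)))))))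
      z′-sum : (1# - P n * P (suc n)) * Sum (z′ n) ≈ Sum (v′ n ∘ suc) + Sum (λ k → y n * v′ n k)
      z′-sum = trans (Sum-*ˡ _ (Summable-z′ n)) (trans (Sum-cong z′-step) (Sum-+ (v′ n ∘ suc) _))

    V-step : ∀ n → (1# - P (suc n) * P (suc n)) * V (suc n) ≈ (1# + x n) * W n
    V-step n = lin 11 (λ u x Sv Tv v₀ Tv′ Sz Tz z₀ z₀′ Tz′ →
        u ·[ Sv := v₀ :+ Tv ] ∷
        # 1 ·[ u :* v₀ := z₀ :+ x :* z₀′ ] ∷
        # 1 ·[ u :* Tv := Tz :+ x :* Sz ] ∷
        # 1 ·[ u :* Tv′ := z₀′ :+ Tz′ :+ x :* Tz′ ] ∷
        :- # 1 ·[ Sz := z₀ :+ Tz ] ∷ [] ⊢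
        u :* (Sv :+ Tv′) := (# 1 :+ x) :* (Sz :+ (z₀′ :+ Tz′)))
      (Sum-head (Summable-v (suc n))) v-head v-sum v′-sum (Sum-head (Summable-z n))
      ⟨trans⟩ *-cong refl (+-cong refl (sym (Sum-head (Summable-z′ n))))
      where
      infixl 1 _⟨trans⟩_
      _⟨trans⟩_ = trans
      index : ∀ k → iq (suc k ℕ.+ suc n) ≈ iq (suc (suc k ℕ.+ n))
      index k = reflexive (cong (iq ∘ suc) (ℕP.+-suc k n))
      v-head : (1# - P (suc n) * P (suc n)) * v (suc n) 0 ≈ z n 0 + x n * z′ n 0
      v-head = lin 8 (λ o Q x c d d′ I₀ I₁ →
        c :* I₁ :* (# 1 :+ Q) ·[ (# 1 :- o :* Q) :* I₁ := I₀ ] ∷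
        c :* I₁ :* I₁ :* (# 1 :+ Q) :* Q :- Q :* d :* I₀ :* I₁ ·[ o := # 1 ] ∷
        I₀ :* I₁ ·[ d :* Q :* o := x :* d′ ] ∷
        Q :* I₀ :* I₁ ·[ c := d ] ∷ [] ⊢
        (# 1 :- Q :* Q) :* (c :* (I₁ :* I₁)) := c :* (I₀ :* I₁) :+ x :* (d′ :* (I₀ :* I₁)))
        (iq-P 0 n) P-0 (d-x n 0) (trans c-0 (sym d-0))
      v-step : ∀ k → (1# - P (suc n) * P (suc n)) * v (suc n) (suc k) ≈ z n (suc k) + x n * z n k
      v-step k = X*-cancel (suc β ℕ.* k) (lin 13 (λ p Pn Q Pk Pk′ x c c′ R R′ J I₁ I₂ →
        Pk :* (# 1 :- Q :* Q) :* c′ :* R ·[ J := I₂ ] ∷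
        R :* I₁ ·[ c′ :* Pn := x :* Pk :* c ] ∷
        c′ :* Pn :* R ·[ (# 1 :- Pk′ :* Q) :* I₂ := I₁ ] ∷
        c′ :* I₂ ·[ (Pk :- Pn) :* R := Pk :* R′ ] ∷
        Pn :* Q :* c′ :* R :* I₂ ·[ Pk′ := p :* Pk ] ∷
        :- (Pk :* Q :* c′ :* R :* I₂) ·[ Q := p :* Pn ] ∷ [] ⊢
        Pk :* ((# 1 :- Q :* Q) :* (c′ :* (R :* J))) := Pk :* (c′ :* (R′ :* I₂) :+ x :* (c :* (R :* I₁))))
        (index k) (c-x n k) (iq-P (suc k) n) (r-sucʳ n k) (P-suc k) (P-suc n))
      v′-step : ∀ k → (1# - P (suc n) * P (suc n)) * v′ (suc n) (suc k) ≈ z′ n k + x n * z′ n (suc k)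
      v′-step k = lin 13 (λ p Pn Q Pk Pk′ x d′ d″ R R′ J I₁ I₂ →
        (# 1 :- Q :* Q) :* d′ :* R ·[ J := I₂ ] ∷
        d′ :* R ·[ (# 1 :- Pk′ :* Q) :* I₂ := I₁ ] ∷
        R′ :* I₂ ·[ d′ :* Q :* Pk′ := x :* d″ ] ∷
        d′ :* Q :* p :* I₂ ·[ (Pk :- Pn) :* R := Pk :* R′ ] ∷
        d′ :* Q :* I₂ :* (R :- R′) ·[ Pk′ := p :* Pk ] ∷
        :- (Q :* d′ :* R :* I₂) ·[ Q := p :* Pn ] ∷ [] ⊢
        (# 1 :- Q :* Q) :* (d′ :* (R :* J)) := d′ :* (R :* I₁) :+ x :* (d″ :* (R′ :* I₂)))
        (index k) (iq-P (suc k) n) (d-x n (suc k)) (r-sucʳ n k) (P-suc k) (P-suc n)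
      v-sum : (1# - P (suc n) * P (suc n)) * Sum (v (suc n) ∘ suc) ≈ Sum (z n ∘ suc) + x n * Sum (z n)
      v-sum = trans (Sum-*ˡ _ (Summable-suc (Summable-v (suc n)))) (trans (Sum-cong v-step)
        (trans (Sum-+ (z n ∘ suc) _) (+-cong refl (sym (Sum-*ˡ (x n) (Summable-z n))))))
      v′-sum : (1# - P (suc n) * P (suc n)) * Sum (v′ (suc n) ∘ suc) ≈ z′ n 0 + Sum (z′ n ∘ suc) + x n * Sum (z′ n ∘ suc)
      v′-sum = trans (Sum-*ˡ _ (Summable-v′ (suc n))) (trans (Sum-cong v′-step) (trans (Sum-+ (z′ n) _)
        (+-cong (Sum-head (Summable-z′ n)) (sym (Sum-*ˡ (x n) (Summable-suc (Summable-z′ n)))))))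

    A : ℕ → Ser
    A = ∏ λ n → (1# + x n) * (1# + y n)

    V-product : ∀ n → V n ≈ iq (2 ℕ.* n) * A n
    V-product zero = trans (+-cong
        (trans (Sum-only-head λ k → zeroʳ≈ (zeroˡ (iq (suc k ℕ.+ 0)))) (lin 1 (λ c → # 1 ·[ c := # 1 ] ∷ [] ⊢ c :* (# 1 :* # 1) := # 1) c-0))
        (Sum-0 λ k → zeroʳ≈ (zeroˡ (iq (suc k ℕ.+ 0)))))
      (lin 0 ([] ⊢ # 1 :+ # 0 := # 1 :* # 1))
    V-product (suc n) = *-cancelˡ (Unit-* unit₁ unit₂)
      (lin 11 (λ u₁ u₂ V W V′ x y i i₁ i₂ A →
         u₁ ·[ u₂ :* V′ := (# 1 :+ x) :* W ] ∷
         # 1 :+ x ·[ u₁ :* W := (# 1 :+ y) :* V ] ∷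
         (# 1 :+ x) :* (# 1 :+ y) ·[ V := i :* A ] ∷
         :- (A :* (# 1 :+ x) :* (# 1 :+ y)) ·[ u₁ :* i₁ := i ] ∷
         :- (u₁ :* A :* (# 1 :+ x) :* (# 1 :+ y)) ·[ u₂ :* i₂ := i₁ ] ∷ [] ⊢
         (u₁ :* u₂) :* V′ := (u₁ :* u₂) :* (i₂ :* (A :* ((# 1 :+ x) :* (# 1 :+ y)))))
       (V-step n) (W-step n) (V-product n) iq₁ iq₂)
      where
      unit₁ : Unit (1# - P n * P (suc n))
      unit₁ = Unit-1- (*-zeroʳ[] (X≈0 _ (s≤s z≤n)))
      unit₂ : Unit (1# - P (suc n) * P (suc n))
      unit₂ = Unit-1- (*-zeroʳ[] (X≈0 _ (s≤s z≤n)))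
      index : ∀ n → n ℕ.+ n ≡ 2 ℕ.* n
      index = solve-∀
      index′ : ∀ n → suc (suc n ℕ.+ n) ≡ 2 ℕ.* suc n
      index′ = solve-∀
      iq₁ : (1# - P n * P (suc n)) * iq (suc (n ℕ.+ n)) ≈ iq (2 ℕ.* n)
      iq₁ = trans (iq-P n n) (reflexive (cong iq (index n)))
      iq₂ : (1# - P (suc n) * P (suc n)) * iq (2 ℕ.* suc n) ≈ iq (suc (n ℕ.+ n))
      iq₂ = trans (*-cong refl (reflexive (cong iq (≡.sym (index′ n))))) (iq-P (suc n) n)

    triple-product : ∀ {A∞} → Lim A A∞ → Sum c + Sum (d ∘ suc) ≈ f (suc β) * A∞
    triple-product {A∞} A-lim = lin 4 (λ i f Θ A →
      f :* A :- Θ :* (# 1 :+ i :* f) ·[ i :* f := # 1 ] ∷ f :* f ·[ i :* i :* Θ := i :* A ] ∷ [] ⊢ Θ := f :* A) iq∞-f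
      (Lim-unique V-lim (Lim-cong (λ n → sym (V-product (suc n)))
        (Lim-reindex suc ℕP.n≤1+n (Lim-* (Lim-reindex (2 ℕ.*_) (λ n → ℕP.m≤m+n n _) iq-lim) A-lim))))
      where
      pull : ∀ {u} → Summable u → Sum (λ k → (u k * iq∞) * iq∞) ≈ iq∞ * iq∞ * Sum u
      pull {u} h = sym (trans (Sum-*ˡ (iq∞ * iq∞) h)
        (Sum-cong λ k → lin 2 (λ i u → [] ⊢ i :* i :* u := (u :* i) :* i)))
      iq-lim′ : ∀ k → Lim (λ n → iq (k ℕ.+ n)) iq∞
      iq-lim′ k = Lim-reindex (k ℕ.+_) (λ n → ℕP.m≤n+m n k) iq-lim
      -- Taken at n + 1 because `r (suc n) (suc k)` reduces to `r n k`, which fits the order k that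
      -- is assumed of d_{k+1}.
      V-lim : Lim (V ∘ suc) (iq∞ * iq∞ * (Sum c + Sum (d ∘ suc)))
      V-lim n = ≈[]-resp refl
        (trans (+-cong (pull c≈0) (pull d≈0)) (lin 3 (λ i a b → [] ⊢ i :* i :* a :+ i :* i :* b := i :* i :* (a :+ b))))
        (Lim-+ {λ n → Sum (v (suc n))} {λ n → Sum (v′ (suc n) ∘ suc)}
           (Lim-Sum λ k → Lim-reindex suc ℕP.n≤1+n (Lim-cong (λ n → *-assoc (c k) (r n k) (iq (k ℕ.+ n)))
                   (Lim-* (*r-lim k (c≈0 k)) (iq-lim′ k))))
           (Lim-Sum λ k → Lim-cong (λ n → *-assoc (d (suc k)) (r n k) (iq (suc k ℕ.+ suc n)))
                   (Lim-* (*r-lim k (d≈0 k)) (Lim-reindex suc ℕP.n≤1+n (iq-lim′ (suc k))))) n)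

  module Theta (β : ℕ) where
    private
      b = suc β
      γ = β ℕ.+ (suc β ℕ.+ 0)

    open Products-p γ

    private
      X-≈ : ∀ {k l m n} → k ℕ.+ l ≡ m ℕ.+ n → X k * X l ≈ X m * X n
      X-≈ {k} {l} {m} {n} e = trans (sym (X-+ k l)) (X-split m n e)

      X-≈₃ : ∀ {j k l m n} → j ℕ.+ k ℕ.+ l ≡ m ℕ.+ n → X j * X k * X l ≈ X m * X n
      X-≈₃ {j} {k} {l} {m} {n} e = trans (*-cong (sym (X-+ j k)) refl) (X-≈ e)

      X-≈′ : ∀ {k l j m n} → k ℕ.+ l ≡ j ℕ.+ m ℕ.+ n → X k * X l ≈ X j * X m * X n
      X-≈′ e = sym (X-≈₃ (≡.sym e))

    -- The triple product at z = q^b in the base p = q^(2b), where the two halves c and d agree.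
    φ-sum : Sum (λ k → X (b ℕ.* (k ℕ.* k))) + Sum (λ k → X (b ℕ.* (suc k ℕ.* suc k))) ≈
            f (2 ℕ.* b) * (∏odd⁺ β * ∏odd⁺ β)
    φ-sum = Jacobi-p.triple-product γ c c x x
      (trans (X-≡ (ℕP.*-zeroʳ β)) X-0) (trans (X-≡ (ℕP.*-zeroʳ β)) X-0)
      (λ n k → X-≈₃ (exp₁ b n k)) (λ n k → X-≈′ (exp₂ b n k)) (λ n k → X-≈′ (exp₂ b n k)) (λ n k → X-≈₃ (exp₁ b n k))
      (λ k → X≈0 _ (k≤bk² β k)) (λ k → X≈0 _ (ℕP.≤-trans (ℕP.n≤1+n k) (k≤bk² β (suc k))))
      (Lim-cong (λ n → sym (∏-* _ _ n)) (Lim-* (∏odd⁺-lim β) (∏odd⁺-lim β)))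
      where
      c x : ℕ → Ser
      c k = X (b ℕ.* (k ℕ.* k))
      x n = X (b ℕ.* suc (2 ℕ.* n))
      exp₁ : ∀ b n k → b ℕ.* (k ℕ.* k) ℕ.+ 2 ℕ.* b ℕ.* suc n ℕ.+ 2 ℕ.* b ℕ.* k ≡ b ℕ.* suc (2 ℕ.* n) ℕ.+ b ℕ.* (suc k ℕ.* suc k)
      exp₁ = solve-∀
      exp₂ : ∀ b n k → b ℕ.* (suc k ℕ.* suc k) ℕ.+ 2 ℕ.* b ℕ.* n ≡ b ℕ.* suc (2 ℕ.* n) ℕ.+ 2 ℕ.* b ℕ.* k ℕ.+ b ℕ.* (k ℕ.* k)
      exp₂ = solve-∀

    -- The triple product at z = p = q^(2b). Now y_0 = 1, so the product contains the factor 1 + 1,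
    -- the source of the 2.
    ψ-sum : Sum (λ k → X (b ℕ.* (k ℕ.* suc k))) + Sum (λ k → X (b ℕ.* (k ℕ.* suc k))) ≈
            f (2 ℕ.* b) * (κ (+ 2) * (∏all⁺ γ * ∏all⁺ γ))
    ψ-sum = Jacobi-p.triple-product γ c d (P ∘ suc) P
      (trans (X-≡ (ℕP.*-zeroʳ β)) X-0) (trans (X-≡ (ℕP.*-zeroʳ β)) X-0)
      (λ n k → X-≈₃ (exp₁ b n k)) (λ n k → X-≈′ (exp₂ n k)) (λ n k → X-≈′ (exp₃ b n k)) (λ n k → X-≈₃ (exp₄ n k))
      summable summable A-lim
      where
      c d : ℕ → Ser
      c k = X (b ℕ.* (k ℕ.* suc k))
      d k = X (b ℕ.* (ℕ.pred k ℕ.* k))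
      summable : Summable c
      summable k = X≈0 _ (ℕP.≤-trans (k≤bk² β k) (ℕP.*-monoʳ-≤ b (ℕP.*-monoʳ-≤ k (ℕP.n≤1+n k))))
      exp₁ : ∀ b n k → b ℕ.* (k ℕ.* suc k) ℕ.+ 2 ℕ.* b ℕ.* suc n ℕ.+ 2 ℕ.* b ℕ.* k ≡ 2 ℕ.* b ℕ.* n ℕ.+ b ℕ.* (suc k ℕ.* suc (suc k))
      exp₁ = solve-∀
      exp₂ : ∀ n k → b ℕ.* (k ℕ.* suc k) ℕ.+ 2 ℕ.* b ℕ.* n ≡ 2 ℕ.* b ℕ.* n ℕ.+ 2 ℕ.* b ℕ.* k ℕ.+ b ℕ.* (ℕ.pred k ℕ.* k)
      exp₂ n zero    = lem β n
        where
        lem : ∀ β n → β ℕ.* 0 ℕ.+ 2 ℕ.* suc β ℕ.* n ≡ 2 ℕ.* suc β ℕ.* n ℕ.+ 2 ℕ.* suc β ℕ.* 0 ℕ.+ β ℕ.* 0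
        lem = solve-∀
      exp₂ n (suc k) = lem b n k
        where
        lem : ∀ b n k → b ℕ.* (suc k ℕ.* suc (suc k)) ℕ.+ 2 ℕ.* b ℕ.* n ≡ 2 ℕ.* b ℕ.* n ℕ.+ 2 ℕ.* b ℕ.* suc k ℕ.+ b ℕ.* (k ℕ.* suc k)
        lem = solve-∀
      exp₃ : ∀ b n k → b ℕ.* (suc k ℕ.* suc (suc k)) ℕ.+ 2 ℕ.* b ℕ.* n ≡ 2 ℕ.* b ℕ.* suc n ℕ.+ 2 ℕ.* b ℕ.* k ℕ.+ b ℕ.* (k ℕ.* suc k)
      exp₃ = solve-∀
      exp₄ : ∀ n k → b ℕ.* (ℕ.pred k ℕ.* k) ℕ.+ 2 ℕ.* b ℕ.* suc n ℕ.+ 2 ℕ.* b ℕ.* k ≡ 2 ℕ.* b ℕ.* suc n ℕ.+ b ℕ.* (k ℕ.* suc k)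
      exp₄ n zero    = lem β n
        where
        lem : ∀ β n → β ℕ.* 0 ℕ.+ 2 ℕ.* suc β ℕ.* suc n ℕ.+ 2 ℕ.* suc β ℕ.* 0 ≡ 2 ℕ.* suc β ℕ.* suc n ℕ.+ β ℕ.* 0
        lem = solve-∀
      exp₄ n (suc k) = lem b n k
        where
        lem : ∀ b n k → b ℕ.* (k ℕ.* suc k) ℕ.+ 2 ℕ.* b ℕ.* suc n ℕ.+ 2 ℕ.* b ℕ.* suc k ≡ 2 ℕ.* b ℕ.* suc n ℕ.+ b ℕ.* (suc k ℕ.* suc (suc k))
        lem = solve-∀
      B : ℕ → Ser
      B = ∏ λ n → (1# + P (suc n)) * (1# + P n)
      C : ℕ → Ser
      C = ∏ λ n → 1# + P (suc n)
      -- The factors 1 + p^n trail the factors 1 + p^{n+1} by one step: supplying the missing 1 +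
      -- p^n turns the product into twice a square, and in the limit p^n drops out.
      B-C : ∀ n → B n + P n * B n ≈ κ (+ 2) * (C n * C n)
      B-C zero    = lin 1 (λ o → # 1 ·[ o := # 1 ] ∷ [] ⊢ # 1 :+ o :* # 1 := # 2 :* (# 1 :* # 1)) P-0
      B-C (suc n) = lin 4 (λ p q B C → (# 1 :+ q) :* (# 1 :+ q) ·[ B :+ p :* B := # 2 :* (C :* C) ] ∷ [] ⊢
        B :* ((# 1 :+ q) :* (# 1 :+ p)) :+ q :* (B :* ((# 1 :+ q) :* (# 1 :+ p))) := # 2 :* ((C :* (# 1 :+ q)) :* (C :* (# 1 :+ q)))) (B-C n)
      A-lim : Lim B (κ (+ 2) * (∏all⁺ γ * ∏all⁺ γ))
      A-lim n = ≈[]-trans (≈[]-resp (+-identityʳ (B n)) (B-C n) (+-cong[] ≈[]-refl (≈[]-sym (P*≈0 n ℕP.≤-refl))))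
        (Lim-* Lim-const (Lim-* (∏all⁺-lim γ) (∏all⁺-lim γ)) n)

-- Ramanujan's theta functions: the dissections of φ and of ψ(q)ψ(q³).

module Theta where
  open TripleProduct public

  -- Ramanujan’s φ(q^b) = Σ q^(bk²) and ψ(q^b) = Σ q^(bk(k+1)/2), as eta quotients
  φ ψ : ℕ → Ser
  φ b = f (2 ℕ.* b) ^ 5 * inv (f b ^ 2 * f (4 ℕ.* b) ^ 2)
  ψ b = f (2 ℕ.* b) ^ 2 * inv (f b)

  Unit-φ-denominator : ∀ β → Unit (f (suc β) ^ 2 * f (4 ℕ.* suc β) ^ 2)
  Unit-φ-denominator β = Unit-* (Unit-^ 2 (Unit-f β)) (Unit-^ 2 (Unit-f (pred (4 ℕ.* suc β))))

  φ-f : ∀ β → φ (suc β) * (f (suc β) ^ 2 * f (4 ℕ.* suc β) ^ 2) ≈ f (2 ℕ.* suc β) ^ 5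
  φ-f β = lin 3 (λ a u v → a ·[ u :* v := # 1 ] ∷ [] ⊢ (a :* v) :* u := a) (*-inv (Unit-φ-denominator β))

  ψ-f : ∀ β → ψ (suc β) * f (suc β) ≈ f (2 ℕ.* suc β) ^ 2
  ψ-f β = lin 3 (λ a u v → a ·[ u :* v := # 1 ] ∷ [] ⊢ (a :* v) :* u := a) (*-inv (Unit-f β))

  private
    f-4 : ∀ b → f (2 ℕ.* (2 ℕ.* b)) ≈ f (4 ℕ.* b)
    f-4 b = reflexive (cong f (≡.sym (ℕP.*-assoc 2 2 b)))

  φ-series : ∀ β (let b = suc β) →
    φ b ≈ Sum (λ k → X (b ℕ.* (k ℕ.* k))) + Sum (λ k → X (b ℕ.* (suc k ℕ.* suc k)))
  φ-series β = *-cancelˡ (Unit-φ-denominator β) (lin 7 (λ φ f₁ f₂ f₄ f₄′ B S →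
      # 1 ·[ φ :* (f₁ :^ 2 :* f₄ :^ 2) := f₂ :^ 5 ] ∷
      :- (f₁ :^ 2 :* f₄ :^ 2) ·[ S := f₂ :* (B :* B) ] ∷
      :- (f₂ :* (B :* f₁ :* f₄ :+ f₂ :* f₂)) ·[ B :* (f₁ :* f₄′) := f₂ :* f₂ ] ∷
      f₂ :* (B :* f₁ :* f₄ :+ f₂ :* f₂) :* B :* f₁ ·[ f₄′ := f₄ ] ∷ [] ⊢
      (f₁ :^ 2 :* f₄ :^ 2) :* φ := (f₁ :^ 2 :* f₄ :^ 2) :* S)
    (φ-f β) (Theta.φ-sum β) (∏odd⁺-f β) (f-4 (suc β)))

  ψ-series : ∀ β (let b = suc β) →
    κ (+ 2) * ψ (2 ℕ.* b) ≈ Sum (λ k → X (b ℕ.* (k ℕ.* suc k))) + Sum (λ k → X (b ℕ.* (k ℕ.* suc k)))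
  ψ-series β = *-cancelˡ (Unit-f γ) (lin 6 (λ ψ f₂ f₄ B S T →
      # 2 ·[ ψ :* f₂ := f₄ :^ 2 ] ∷
      :- f₂ ·[ S :+ T := f₂ :* (# 2 :* (B :* B)) ] ∷
      :- # 2 :* (B :* f₂ :+ f₄) ·[ B :* f₂ := f₄ ] ∷ [] ⊢
      f₂ :* (# 2 :* ψ) := f₂ :* (S :+ T))
    (ψ-f γ) (Theta.ψ-sum β) (∏all⁺-f γ))
    where γ = pred (2 ℕ.* suc β)

  -- Even k in Σ q^(bk²) give φ(q^(4b)); odd k give exponents b + 4bm(m+1). The target indices are
  -- taken up to equality, since 4 * (3 * b) and 12 * b differ for a variable b.
  φ-dissection : ∀ β {b₄ b₈} → b₄ ≡ 4 ℕ.* suc β → b₈ ≡ 8 ℕ.* suc β →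
    φ (suc β) ≈ φ b₄ + κ (+ 2) * (X (suc β) * ψ b₈)
  φ-dissection β ≡.refl ≡.refl = begin
    φ b
      ≈⟨ φ-series β ⟩
    Sum (λ k → X (b ℕ.* (k ℕ.* k))) + Sum (λ k → X (b ℕ.* (suc k ℕ.* suc k)))
      ≈⟨ +-cong (split (λ k → X (b ℕ.* (k ℕ.* k))) (λ k → X≈0 _ (k≤bk² β k)))
                (split (λ k → X (b ℕ.* (suc k ℕ.* suc k))) (λ k → X≈0 _ (ℕP.≤-trans (ℕP.n≤1+n k) (k≤bk² β (suc k))))) ⟩
    (Sum (λ k → X (b ℕ.* (2 ℕ.* k ℕ.* (2 ℕ.* k)))) + Sum (λ k → X (b ℕ.* ((2 ℕ.* k ℕ.+ 1) ℕ.* (2 ℕ.* k ℕ.+ 1))))) +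
    (Sum (λ k → X (b ℕ.* (suc (2 ℕ.* k) ℕ.* suc (2 ℕ.* k)))) + Sum (λ k → X (b ℕ.* (suc (2 ℕ.* k ℕ.+ 1) ℕ.* suc (2 ℕ.* k ℕ.+ 1)))))
      ≈⟨ +-cong (+-cong (Sum-cong λ k → X-≡ (exp₀ b k)) (odd λ k → exp₁ b k))
                (+-cong (odd λ k → exp₂ b k) (Sum-cong λ k → X-≡ (exp₃ b k))) ⟩
    (Sum (λ k → X (4 ℕ.* b ℕ.* (k ℕ.* k))) + X b * S) + (X b * S + Sum (λ k → X (4 ℕ.* b ℕ.* (suc k ℕ.* suc k))))
      ≈⟨ lin 7 (λ T T′ x S φ₄ ψ₈ ψ₈′ →
           :- # 1 ·[ φ₄ := T :+ T′ ] ∷ :- x ·[ # 2 :* ψ₈ := S :+ S ] ∷ # 2 :* x ·[ ψ₈ := ψ₈′ ] ∷ [] ⊢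
           (T :+ x :* S) :+ (x :* S :+ T′) := φ₄ :+ # 2 :* (x :* ψ₈′))
         (φ-series (pred (4 ℕ.* b))) (ψ-series (pred (4 ℕ.* b)))
         (reflexive (cong ψ (≡.sym (ℕP.*-assoc 2 4 b)))) ⟩
    φ (4 ℕ.* b) + κ (+ 2) * (X b * ψ (8 ℕ.* b)) ∎
    where
    b = suc β
    S = Sum (λ k → X (4 ℕ.* b ℕ.* (k ℕ.* suc k)))
    split : ∀ T → Summable T → Sum T ≈ Sum (λ m → T (2 ℕ.* m)) + Sum (λ m → T (2 ℕ.* m ℕ.+ 1))
    split T h = trans (Sum-split₂ h) (Sum-+ _ _)
    exp₀ : ∀ b k → b ℕ.* (2 ℕ.* k ℕ.* (2 ℕ.* k)) ≡ 4 ℕ.* b ℕ.* (k ℕ.* k)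
    exp₀ = solve-∀
    exp₁ : ∀ b k → b ℕ.* ((2 ℕ.* k ℕ.+ 1) ℕ.* (2 ℕ.* k ℕ.+ 1)) ≡ b ℕ.+ 4 ℕ.* b ℕ.* (k ℕ.* suc k)
    exp₁ = solve-∀
    exp₂ : ∀ b k → b ℕ.* (suc (2 ℕ.* k) ℕ.* suc (2 ℕ.* k)) ≡ b ℕ.+ 4 ℕ.* b ℕ.* (k ℕ.* suc k)
    exp₂ = solve-∀
    exp₃ : ∀ b k → b ℕ.* (suc (2 ℕ.* k ℕ.+ 1) ℕ.* suc (2 ℕ.* k ℕ.+ 1)) ≡ 4 ℕ.* b ℕ.* (suc k ℕ.* suc k)
    exp₃ = solve-∀
    odd : ∀ {e : ℕ → ℕ} → (∀ k → e k ≡ b ℕ.+ 4 ℕ.* b ℕ.* (k ℕ.* suc k)) → Sum (λ k → X (e k)) ≈ X b * S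
    odd h = trans (Sum-cong λ k → X-split b _ (h k)) (sym (Sum-*ˡ (X b) λ k → X≈0 _
      (ℕP.≤-trans (k≤bk² (pred (4 ℕ.* b)) k) (ℕP.*-monoʳ-≤ (4 ℕ.* b) (ℕP.*-monoʳ-≤ k (ℕP.n≤1+n k))))))

  ψ² : ∀ β {b₂} → b₂ ≡ 2 ℕ.* suc β → ψ (suc β) * ψ (suc β) ≈ φ (suc β) * ψ b₂
  ψ² β ≡.refl = *-cancelˡ (Unit-* (Unit-φ-denominator β) (Unit-f (pred (2 ℕ.* suc β))))
    (lin 7 (λ φ ψ₁ ψ₂ f₁ f₂ f₄ f₄′ →
      (ψ₁ :* f₁ :+ f₂ :^ 2) :* f₄ :^ 2 :* f₂ ·[ ψ₁ :* f₁ := f₂ :^ 2 ] ∷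
      :- (ψ₂ :* f₂) ·[ φ :* (f₁ :^ 2 :* f₄ :^ 2) := f₂ :^ 5 ] ∷
      :- (f₂ :^ 5) ·[ ψ₂ :* f₂ := f₄′ :^ 2 ] ∷
      :- (f₂ :^ 5 :* (f₄′ :+ f₄)) ·[ f₄′ := f₄ ] ∷ [] ⊢
      (f₁ :^ 2 :* f₄ :^ 2 :* f₂) :* (ψ₁ :* ψ₁) := (f₁ :^ 2 :* f₄ :^ 2 :* f₂) :* (φ :* ψ₂))
    (ψ-f β) (φ-f β) (ψ-f (pred (2 ℕ.* suc β))) (f-4 (suc β)))

  *-≈1[] : ∀ {n a b} → a ≈[ n ] 1# → b ≈[ n ] 1# → a * b ≈[ n ] 1#
  *-≈1[] p q = ≈[]-resp refl (*-identityˡ 1#) (*-cong[] p q)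

  ^-≈1[] : ∀ {n a} k → a ≈[ n ] 1# → a ^ k ≈[ n ] 1#
  ^-≈1[] zero    p = ≈[]-refl
  ^-≈1[] (suc k) p = *-≈1[] p (^-≈1[] k p)

  inv-≈1[] : ∀ {n u} → Unit u → u ≈[ n ] 1# → inv u ≈[ n ] 1#
  inv-≈1[] {u = u} ok p = ≈[]-trans (≈[]-resp (*-identityˡ (inv u)) refl (*-cong[] (≈[]-sym p) ≈[]-refl)) (≈⇒≈[] (*-inv ok))

  f≈1[] : ∀ {n} b → n ≤ suc b → f (suc b) ≈[ n ] 1#
  f≈1[] {n} β n≤b = ≈[]-resp (sym (f≈∏∞ (suc β))) refl
    (≈[]-trans (≈[]-sym (∏-lim (Multipliable-1-X β suc λ _ → ℕP.≤-refl) n)) (go n))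
    where
    go : ∀ m → ∏ (λ k → 1# - X (suc β ℕ.* suc k)) m ≈[ n ] 1#
    go zero    = ≈[]-refl
    go (suc m) = *-≈1[] (go m) (≈[]-resp refl (lin 0 ([] ⊢ # 1 :- # 0 := # 1))
      (+-cong[] ≈[]-refl (-‿cong[] (X≈0 _ (ℕP.≤-trans n≤b (ℕP.m≤m*n (suc β) (suc m)))))))

  φ≈1[] : ∀ {n} β → n ≤ suc β → φ (suc β) ≈[ n ] 1#
  φ≈1[] β h = *-≈1[] (^-≈1[] 5 (f≈1[] _ (ℕP.≤-trans h (ℕP.m≤m+n _ _))))
    (inv-≈1[] (Unit-φ-denominator β)
      (*-≈1[] (^-≈1[] 2 (f≈1[] β h)) (^-≈1[] 2 (f≈1[] _ (ℕP.≤-trans h (ℕP.m≤m+n _ _))))))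

  ψ≈1[] : ∀ {n} β → n ≤ suc β → ψ (suc β) ≈[ n ] 1#
  ψ≈1[] β h = *-≈1[] (^-≈1[] 2 (f≈1[] _ (ℕP.≤-trans h (ℕP.m≤m+n _ _)))) (inv-≈1[] (Unit-f β) (f≈1[] β h))

  b<2b : ∀ β → suc (suc β) ≤ 2 ℕ.* suc β
  b<2b β = s≤s (ℕP.≤-trans (s≤s (ℕP.m≤m+n β (β ℕ.+ 0))) (ℕP.≤-reflexive (≡.sym (ℕP.+-suc β (β ℕ.+ 0)))))

  private
    δ : ℕ → Ser
    δ b = φ b * φ b - (φ (2 ℕ.* b) * φ (2 ℕ.* b) + κ (+ 4) * (X b * (ψ (4 ℕ.* b) * ψ (4 ℕ.* b))))

    X-2 : ∀ b → X (2 ℕ.* b) ≈ X b * X b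
    X-2 b = X-split b b (exponent b)
      where
      exponent : ∀ b → 2 ℕ.* b ≡ b ℕ.+ b
      exponent = solve-∀

    -- Squaring φ(q) = φ(q⁴) + 2qψ(q⁸) gives the middle term 4qφ(q⁴)ψ(q⁸) = 4qψ(q⁴)², which is the
    -- one in δ; what remains is the relation at q² with opposite sign.
    δ-double : ∀ β → δ (suc β) ≈ - δ (2 ℕ.* suc β)
    δ-double β = lin 9 (λ φ₁ φ₂ φ₄ φ₄′ ψ₄ ψ₈ ψ₈′ x x₂ →
      φ₁ :+ φ₄ :+ # 2 :* (x :* ψ₈) ·[ φ₁ := φ₄ :+ # 2 :* (x :* ψ₈) ] ∷
      :- (# 4 :* x) ·[ ψ₄ :* ψ₄ := φ₄ :* ψ₈ ] ∷
      φ₄′ :+ φ₄ ·[ φ₄ := φ₄′ ] ∷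
      # 4 :* x :* x :* (ψ₈ :+ ψ₈′) ·[ ψ₈ := ψ₈′ ] ∷
      :- (# 4 :* ψ₈′ :* ψ₈′) ·[ x₂ := x :* x ] ∷ [] ⊢
      φ₁ :* φ₁ :- (φ₂ :* φ₂ :+ # 4 :* (x :* (ψ₄ :* ψ₄))) :=
      :- (φ₂ :* φ₂ :- (φ₄′ :* φ₄′ :+ # 4 :* (x₂ :* (ψ₈′ :* ψ₈′)))))
      (φ-dissection β ≡.refl ≡.refl) (ψ² (pred (4 ℕ.* suc β)) (ℕP.*-assoc 2 4 (suc β)))
      (reflexive (cong φ (ℕP.*-assoc 2 2 (suc β)))) (reflexive (cong ψ (ℕP.*-assoc 4 2 (suc β)))) (X-2 (suc β))

    -- δ changes sign under q ↦ q², so its order exceeds every bound.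
    δ≈0[] : ∀ n β → δ (suc β) ≈[ n ℕ.+ suc β ] 0#
    δ≈0[] zero    β = ≈[]-resp refl (lin 0 ([] ⊢ # 1 :* # 1 :- (# 1 :* # 1 :+ # 4 :* (# 0 :* (# 1 :* # 1))) := # 0))
      (+-cong[] (*-cong[] φ₁ φ₁) (-‿cong[] (+-cong[] (*-cong[] φ₂ φ₂)
        (*-cong[] ≈[]-refl (*-cong[] (X≈0 _ ℕP.≤-refl) (*-cong[] ψ₄ ψ₄))))))
      where
      φ₁ = φ≈1[] {suc β} β ℕP.≤-refl
      φ₂ = φ≈1[] {suc β} (pred (2 ℕ.* suc β)) (ℕP.m≤m+n _ _)
      ψ₄ = ψ≈1[] {suc β} (pred (4 ℕ.* suc β)) (ℕP.m≤m+n _ _)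
    δ≈0[] (suc n) β = ≈[]-resp (sym (δ-double β)) refl (-‿zero[] (≈[]-mono
      (ℕP.≤-trans (ℕP.≤-reflexive (≡.sym (ℕP.+-suc n (suc β)))) (ℕP.+-monoʳ-≤ n (b<2b β)))
      (δ≈0[] n (pred (2 ℕ.* suc β)))))

  φ² : ∀ β {b₂ b₄} → b₂ ≡ 2 ℕ.* suc β → b₄ ≡ 4 ℕ.* suc β →
    φ (suc β) * φ (suc β) ≈ φ b₂ * φ b₂ + κ (+ 4) * (X (suc β) * (ψ b₄ * ψ b₄))
  φ² β ≡.refl ≡.refl = lin 2 (λ a b → # 1 ·[ a :- b := # 0 ] ∷ [] ⊢ a := b)
    (≈[]⇒≈ λ n → ≈[]-mono (ℕP.m≤m+n n (suc β)) (δ≈0[] n β))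

  X-* : ∀ m b → X (m ℕ.* b) ≈ X b ^ m
  X-* zero    b = X-0
  X-* (suc m) b = trans (X-+ b (m ℕ.* b)) (*-cong refl (X-* m b))

  private
    B d : ℕ → Ser
    B b = φ (6 ℕ.* b) * ψ (4 ℕ.* b) + X b * (φ (2 ℕ.* b) * ψ (12 ℕ.* b))
    d b = B b - ψ b * ψ (3 ℕ.* b)

    module _ (β : ℕ) where
      private
        b = suc β
        at : ℕ → ℕ
        at m = pred (suc m ℕ.* b)
        ≡* : ∀ m k → m ℕ.* k ℕ.* b ≡ m ℕ.* (k ℕ.* b)
        ≡* m k = ℕP.*-assoc m k b

      -- For b = 1 this is the even part of φ(q)φ(q³): the dissection of both factors gives
      -- φ(q)φ(q³) = E + 2q · B(q²).
      E : Ser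
      E = φ (4 ℕ.* b) * φ (12 ℕ.* b) + κ (+ 4) * (X b ^ 4 * (ψ (8 ℕ.* b) * ψ (24 ℕ.* b)))

      d₂ : Ser
      d₂ = φ (12 ℕ.* b) * ψ (8 ℕ.* b) + X b ^ 2 * (φ (4 ℕ.* b) * ψ (24 ℕ.* b)) - ψ (2 ℕ.* b) * ψ (6 ℕ.* b)

      d₂≈d : d₂ ≈ d (2 ℕ.* b)
      d₂≈d = -‿cong₂
        (+-cong (*-cong (reflexive (cong φ (≡* 6 2))) (reflexive (cong ψ (≡* 4 2))))
          (*-cong (sym (X-* 2 b)) (*-cong (reflexive (cong φ (≡* 2 2))) (reflexive (cong ψ (≡* 12 2))))))
        (*-cong refl (reflexive (cong ψ (≡* 3 2))))

      B² : B b * B b ≈ E * (φ (12 ℕ.* b) * ψ (8 ℕ.* b) + X b ^ 2 * (φ (4 ℕ.* b) * ψ (24 ℕ.* b)))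
             + κ (+ 2) * (X b * (ψ (2 ℕ.* b) * ψ (2 ℕ.* b) * (ψ (6 ℕ.* b) * ψ (6 ℕ.* b))))
      B² = lin 13 (λ q φ₂ φ₄ φ₆ φ₁₂ ψ₂ ψ₄ ψ₆ ψ₈ ψ₁₂ ψ₂₄ x₂ x₆ →
        ψ₄ :* ψ₄ ·[ φ₆ :* φ₆ := φ₁₂ :* φ₁₂ :+ # 4 :* (x₆ :* (ψ₂₄ :* ψ₂₄)) ] ∷
        # 4 :* ψ₂₄ :* ψ₂₄ :* ψ₄ :* ψ₄ ·[ x₆ := q :^ 6 ] ∷
        φ₁₂ :* φ₁₂ :+ # 4 :* q :^ 6 :* ψ₂₄ :* ψ₂₄ ·[ ψ₄ :* ψ₄ := φ₄ :* ψ₈ ] ∷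
        q :^ 2 :* ψ₁₂ :* ψ₁₂ ·[ φ₂ :* φ₂ := φ₄ :* φ₄ :+ # 4 :* (x₂ :* (ψ₈ :* ψ₈)) ] ∷
        # 4 :* ψ₈ :* ψ₈ :* q :^ 2 :* ψ₁₂ :* ψ₁₂ ·[ x₂ := q :^ 2 ] ∷
        q :^ 2 :* (φ₄ :* φ₄ :+ # 4 :* q :^ 2 :* ψ₈ :* ψ₈) ·[ ψ₁₂ :* ψ₁₂ := φ₁₂ :* ψ₂₄ ] ∷
        :- # 2 :* q :* φ₆ :* ψ₁₂ ·[ ψ₂ :* ψ₂ := φ₂ :* ψ₄ ] ∷
        :- # 2 :* q :* ψ₂ :* ψ₂ ·[ ψ₆ :* ψ₆ := φ₆ :* ψ₁₂ ] ∷ [] ⊢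
        (φ₆ :* ψ₄ :+ q :* (φ₂ :* ψ₁₂)) :* (φ₆ :* ψ₄ :+ q :* (φ₂ :* ψ₁₂)) :=
        (φ₄ :* φ₁₂ :+ # 4 :* (q :^ 4 :* (ψ₈ :* ψ₂₄))) :* (φ₁₂ :* ψ₈ :+ q :^ 2 :* (φ₄ :* ψ₂₄))
          :+ # 2 :* (q :* (ψ₂ :* ψ₂ :* (ψ₆ :* ψ₆))))
        (φ² (at 5) (≡* 2 6) (≡* 4 6)) (X-* 6 b) (ψ² (at 3) (≡* 2 4))
        (φ² (at 1) (≡* 2 2) (≡* 4 2)) (X-* 2 b) (ψ² (at 11) (≡* 2 12))
        (ψ² (at 1) (≡* 2 2)) (ψ² (at 5) (≡* 2 6))

      bb² : ψ b * ψ (3 ℕ.* b) * (ψ b * ψ (3 ℕ.* b)) ≈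
        (E + κ (+ 2) * (X b * (φ (12 ℕ.* b) * ψ (8 ℕ.* b) + X b ^ 2 * (φ (4 ℕ.* b) * ψ (24 ℕ.* b))))) *
        (ψ (2 ℕ.* b) * ψ (6 ℕ.* b))
      bb² = lin 12 (λ q φ₁ φ₃ φ₄ φ₁₂ ψ₁ ψ₂ ψ₃ ψ₆ ψ₈ ψ₂₄ x₃ →
        ψ₃ :* ψ₃ ·[ ψ₁ :* ψ₁ := φ₁ :* ψ₂ ] ∷
        φ₁ :* ψ₂ ·[ ψ₃ :* ψ₃ := φ₃ :* ψ₆ ] ∷
        φ₃ :* ψ₂ :* ψ₆ ·[ φ₁ := φ₄ :+ # 2 :* (q :* ψ₈) ] ∷
        (φ₄ :+ # 2 :* (q :* ψ₈)) :* ψ₂ :* ψ₆ ·[ φ₃ := φ₁₂ :+ # 2 :* (x₃ :* ψ₂₄) ] ∷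
        (φ₄ :+ # 2 :* (q :* ψ₈)) :* ψ₂ :* ψ₆ :* # 2 :* ψ₂₄ ·[ x₃ := q :^ 3 ] ∷ [] ⊢
        ψ₁ :* ψ₃ :* (ψ₁ :* ψ₃) :=
        ((φ₄ :* φ₁₂ :+ # 4 :* (q :^ 4 :* (ψ₈ :* ψ₂₄))) :+ # 2 :* (q :* (φ₁₂ :* ψ₈ :+ q :^ 2 :* (φ₄ :* ψ₂₄)))) :* (ψ₂ :* ψ₆))
        (ψ² β ≡.refl) (ψ² (at 2) (≡* 2 3)) (φ-dissection β ≡.refl ≡.refl)
        (φ-dissection (at 2) (≡* 4 3) (≡* 8 3)) (X-* 3 b)

      -- With g(q) = ψ(q)ψ(q³), B₂ = B(q²) and g₂ = g(q²) the squares are B² = E B₂ + 2q g₂² and g²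
      -- = (E + 2q B₂) g₂, so B² - g² = (E - 2q g₂)(B₂ - g₂).
      d-double : d b * (B b + ψ b * ψ (3 ℕ.* b)) ≈
        (E - κ (+ 2) * (X b * (ψ (2 ℕ.* b) * ψ (6 ℕ.* b)))) * d (2 ℕ.* b)
      d-double = trans (lin 7 (λ B g E B₂ x ψ₂ ψ₆ →
        # 1 ·[ B :* B := E :* B₂ :+ # 2 :* (x :* (ψ₂ :* ψ₂ :* (ψ₆ :* ψ₆))) ] ∷
        :- # 1 ·[ g :* g := (E :+ # 2 :* (x :* B₂)) :* (ψ₂ :* ψ₆) ] ∷ [] ⊢
        (B :- g) :* (B :+ g) := (E :- # 2 :* (x :* (ψ₂ :* ψ₆))) :* (B₂ :- ψ₂ :* ψ₆))
        B² bb²) (*-cong refl d₂≈d)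

    B≈1[] : ∀ {n} β → n ≤ suc β → B (suc β) ≈[ n ] 1#
    B≈1[] β h = ≈[]-resp refl (lin 0 ([] ⊢ # 1 :* # 1 :+ # 0 :* (# 1 :* # 1) := # 1))
      (+-cong[] (*-cong[] (φ≈1[] _ (m* 5)) (ψ≈1[] _ (m* 3))) (*-cong[] (X≈0 _ h) (*-cong[] (φ≈1[] _ (m* 1)) (ψ≈1[] _ (m* 11)))))
      where
      m* : ∀ k → _ ≤ suc β ℕ.+ k ℕ.* suc β
      m* k = ℕP.≤-trans h (ℕP.m≤m+n _ _)

    bb≈1[] : ∀ {n} β → n ≤ suc β → ψ (suc β) * ψ (3 ℕ.* suc β) ≈[ n ] 1#
    bb≈1[] β h = *-≈1[] (ψ≈1[] β h) (ψ≈1[] _ (ℕP.≤-trans h (ℕP.m≤m+n _ _)))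

    -- Up to a factor with constant term 2, d(q) is a multiple of d(q²), so its order exceeds every bound.
    d≈0[] : ∀ n β → d (suc β) ≈[ n ℕ.+ suc β ] 0#
    d≈0[] zero    β = ≈[]-resp refl (lin 0 ([] ⊢ # 1 :- # 1 := # 0))
      (+-cong[] (B≈1[] β ℕP.≤-refl) (-‿cong[] (bb≈1[] β ℕP.≤-refl)))
    d≈0[] (suc n) β = *-cancel-2 (≈[]-resp refl (lin 0 ([] ⊢ # 1 :+ # 1 := # 2))
        (+-cong[] (B≈1[] β (s≤s z≤n)) (bb≈1[] β (s≤s z≤n))))
      (≈[]-resp (sym (d-double β)) refl (*-zeroʳ[] (≈[]-mono
        (ℕP.≤-trans (ℕP.≤-reflexive (≡.sym (ℕP.+-suc n (suc β)))) (ℕP.+-monoʳ-≤ n (b<2b β)))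
        (d≈0[] n (pred (2 ℕ.* suc β))))))

  ψψ₃ : ∀ β (let b = suc β) →
    ψ b * ψ (3 ℕ.* b) ≈ φ (6 ℕ.* b) * ψ (4 ℕ.* b) + X b * (φ (2 ℕ.* b) * ψ (12 ℕ.* b))
  ψψ₃ β = lin 2 (λ a b → :- # 1 ·[ b :- a := # 0 ] ∷ [] ⊢ a := b)
    (≈[]⇒≈ λ n → ≈[]-mono (ℕP.m≤m+n n (suc β)) (d≈0[] n β))

-- Lambert-type series for general quadratic denominators.

module Mock where
  open Theta public

  Unit-∏ : ∀ {F} → (∀ n → Unit (F n)) → ∀ n → Unit (∏ F n)
  Unit-∏ h zero    = ≈[]-refl
  Unit-∏ h (suc n) = Unit-* (Unit-∏ h n) (h n)

  inv-unique : ∀ {u v} → Unit u → u * v ≈ 1# → v ≈ inv u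
  inv-unique ok p = *-cancelˡ ok (trans p (sym (*-inv ok)))

  module Mock-p (β : ℕ) where
    open Products-p β public

    -- (-1)^k p^(k(k+1)/2)
    σ : ℕ → Ser
    σ zero    = 1#
    σ (suc k) = - (P (suc k) * σ k)

    wP≈σ : ∀ k → w k * P k ≈ σ k
    wP≈σ zero    = lin 1 (λ o → # 1 ·[ o := # 1 ] ∷ [] ⊢ # 1 :* o := # 1) P-0
    wP≈σ (suc k) = lin 4 (λ P w Q s → :- Q ·[ w :* P := s ] ∷ [] ⊢ (:- (P :* w)) :* Q := :- (Q :* s)) (wP≈σ k)

    σ≈0 : Summable σ
    σ≈0 k = ≈[]-resp (wP≈σ k) refl (wP≈0 k)

    -- For s = x + p/x the factor D_k is (1 - x p^k)(1 - x⁻¹ p^{k+1}). Keeping s as the parameter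
    -- also covers s = 0, where x would be a square root of -p.
    module PF₁ (s : Ser) where
      D : ℕ → Ser
      D k = 1# - s * P k + P 1 * (P k * P k)

      term : ℕ → Ser
      term k = σ k * ((1# - p * (P k * P k)) * inv (D k))

      module _ (Unit-D : ∀ k → Unit (D k)) where
        private
          module PF = PartialFractions 1 s 1# e₁ (inv ∘ D)

          eP≈ : ∀ k → e₁ k * P k ≈ σ k * (1# - p * (P k * P k))
          eP≈ k = lin 4 (λ w P p s → # 1 :- p :* (P :* P) ·[ w :* P := s ] ∷ [] ⊢
            w :* (# 1 :- p :* (P :* P)) :* P := s :* (# 1 :- p :* (P :* P))) (wP≈σ k)

          eP≈0 : Summable (λ k → e₁ k * P k)
          eP≈0 k = ≈[]-resp (sym (eP≈ k)) refl (*-zeroˡ[] (σ≈0 k))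

          Dg : ∀ k → D k * inv (D k) ≈ 1#
          Dg k = *-inv (Unit-D k)

          S-0 : D 0 * PF.S 0 ≈ 1#
          S-0 = trans (*-cong refl (Sum-only-head λ k → lin 3 (λ e g i → [] ⊢ e :* (g :* (# 0 :* i)) := # 0)))
            (lin 5 (λ o D p g i →
              i :* o :* (# 1 :- p :* o :* o) ·[ D :* g := # 1 ] ∷
              i :* (# 1 :- p :* o :* (o :+ # 1)) ·[ o := # 1 ] ∷
              # 1 ·[ (# 1 :- p :* o) :* i := # 1 ] ∷ [] ⊢
              D :* ((# 1 :* (# 1 :- p :* (o :* o)) :* o) :* (g :* (# 1 :* i))) := # 1)
              (Dg 0) P-0 (iq-suc 0))

          ∏D : ∀ n → ∏ D (suc n) ≈ D 0 * PF.∏D n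
          ∏D zero    = *-comm 1# (D 0)
          ∏D (suc n) = lin 4 (λ d E p q → E ·[ p := d :* q ] ∷ [] ⊢ p :* E := d :* (E :* q)) (∏D n)

          ∏D-S : ∀ n → ∏ D (suc n) * PF.S n ≈ 1#
          ∏D-S n = lin 6 (λ p d q S S₀ o →
            S ·[ p := d :* q ] ∷ d ·[ q :* S := S₀ ] ∷ # 1 ·[ d :* S₀ := o ] ∷ [] ⊢ p :* S := o)
            (∏D n) (PF.S-∏D Dg eP≈0 (λ n → Z₁-suc n) n) S-0

        theta-sum : ∀ {L} → Lim (∏ D) L → L * Sum term ≈ f (suc β) * f (suc β)
        theta-sum {L} L-lim = lin 5 (λ L i f T U →
          L :* T :* (# 1 :+ i :* f) ·[ # 1 := i :* f ] ∷
          f :* f ·[ L :* (i :* i :* U) := # 1 ] ∷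
          :- (L :* f :* f :* i :* i) ·[ U := T ] ∷ [] ⊢ L :* T := f :* f)
          (sym iq∞-f)
          (Lim-unique (Lim-* (Lim-reindex suc ℕP.n≤1+n L-lim) (PF.S-lim Dg eP≈0 (λ n → Z₁-suc n)))
            (Lim-cong (λ n → sym (∏D-S n)) Lim-const))
          (Sum-cong λ k → trans (*-cong (eP≈ k) refl) (*-assoc _ _ _))

        mock-sum : f (suc β) * Sum (λ n → Psq 1 n * inv (∏ D (suc n))) ≈ Sum (λ k → term k * Psq 1 k)
        mock-sum = lin 5 (λ f i S T U →
          f ·[ S := i :* T ] ∷ T ·[ i :* f := # 1 ] ∷ # 1 ·[ T := U ] ∷ [] ⊢ f :* S := U)
          (trans (Sum-cong inner) (Bailey-sum 1 (λ k → (e₁ k * P k) * inv (D k)) λ k → *-zeroʳ[] (Psq≈0 1 k)))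
          iq∞-f
          (Sum-cong λ k → *-cong (trans (*-cong (eP≈ k) refl) (*-assoc _ _ _)) refl)
          where
          inner : ∀ n → Psq 1 n * inv (∏ D (suc n)) ≈
            Sum (λ k → Psq 1 n * ((e₁ k * P k * inv (D k)) * (r n k * iq (1 ℕ.+ (k ℕ.+ n)))))
          inner n = trans (*-cong refl (sym (inv-unique (Unit-∏ Unit-D (suc n)) (∏D-S n))))
            (trans (Sum-*ˡ (Psq 1 n) (λ k → *-zeroˡ[] (eP≈0 k)))
              (Sum-cong λ k → *-cong refl (sym (*-assoc (e₁ k * P k) _ _))))

    -- Euler's pentagonal number theorem: in Bailey's lemma for the unit pair only n = 0 contributes
    -- to the left side.
    f-series : f (suc β) ≈ Sum (λ k → e₁ k * Psq 1 k)
    f-series = lin 4 (λ f i S T →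
      f ·[ S := i :* T ] ∷ :- f ·[ S := # 1 ] ∷ T ·[ i :* f := # 1 ] ∷ [] ⊢ f := T)
      (Bailey-sum 1 e₁ λ k → *-zeroʳ[] (Psq≈0 1 k)) ones iq∞-f
      where
      exponent : ∀ b n → b ℕ.* (n ℕ.* (n ℕ.+ 1)) ≡ b ℕ.* (n ℕ.* n) ℕ.+ b ℕ.* n
      exponent = solve-∀
      inner : ∀ n → Sum (λ k → Psq 1 n * (e₁ k * (r n k * iq (1 ℕ.+ (k ℕ.+ n))))) ≈ X (suc β ℕ.* (n ℕ.* n)) * Z₁ n
      inner n = trans (Sum-cong λ k → trans (*-cong (X-split _ _ (exponent (suc β) n)) refl) (*-assoc _ _ _))
        (sym (Sum-*ˡ _ (Summable-Z₁ n)))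
      ones : Sum (λ n → Sum (λ k → Psq 1 n * (e₁ k * (r n k * iq (1 ℕ.+ (k ℕ.+ n)))))) ≈ 1#
      ones = trans (Sum-only-head λ n → trans (inner (suc n)) (zeroʳ≈ (Z₁-suc n)))
        (trans (inner 0) (trans (*-cong P-0 Z₁-0) (*-identityˡ 1#)))

    module PF₀ (s : Ser) where
      -- D_0 = 2 - s need not be invertible. With the constant value D_k g_k = 2 - s the weight at k
      -- = 0 becomes 1, and only the D_k with k > 0 are inverted.
      D g : ℕ → Ser
      D k = 1# - s * P k + P 0 * (P k * P k)
      g zero    = 1#
      g (suc k) = (κ (+ 2) - s) * inv (D (suc k))

      τ : ℕ → Ser
      τ zero    = 1#
      τ (suc k) = σ (suc k) * (1# + P (suc k))

      term : ℕ → Ser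
      term k = τ k * g k

      module _ (Unit-D : ∀ k → Unit (D (suc k))) where
        private
          module PF = PartialFractions 0 s (κ (+ 2) - s) e₀ g

          eP≈ : ∀ k → e₀ k * P k ≈ τ k
          eP≈ zero    = trans (*-identityˡ _) P-0
          eP≈ (suc k) = lin 3 (λ w P s → # 1 :+ P ·[ w :* P := s ] ∷ [] ⊢ w :* (# 1 :+ P) :* P := s :* (# 1 :+ P)) (wP≈σ (suc k))

          eP≈0 : Summable (λ k → e₀ k * P k)
          eP≈0 k = *-zeroʳ[] (P≈0 k)

          Dg : ∀ k → D k * g k ≈ κ (+ 2) - s
          Dg zero    = lin 2 (λ s o → o :* o :+ o :+ # 1 :- s ·[ o := # 1 ] ∷ [] ⊢ (# 1 :- s :* o :+ o :* (o :* o)) :* # 1 := # 2 :- s) P-0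
          Dg (suc k) = lin 3 (λ D t v → t ·[ D :* v := # 1 ] ∷ [] ⊢ D :* (t :* v) := t) (*-inv (Unit-D k))

          S-0 : PF.S 0 ≈ 1#
          S-0 = trans (Sum-only-head λ k → lin 3 (λ e g i → [] ⊢ e :* (g :* (# 0 :* i)) := # 0))
            (lin 1 (λ o → # 1 ·[ o := # 1 ] ∷ [] ⊢ (# 1 :* o) :* (# 1 :* (# 1 :* # 1)) := # 1) P-0)

          ∏D : ∀ n → ∏ (D ∘ suc) n ≈ PF.∏D n
          ∏D zero    = refl
          ∏D (suc n) = trans (*-cong (∏D n) refl) (*-comm _ _)

          ∏D-S : ∀ n → ∏ (D ∘ suc) n * PF.S n ≈ 1#
          ∏D-S n = trans (*-cong (∏D n) refl) (trans (PF.S-∏D Dg eP≈0 (λ n → Z₀-suc n) n) S-0)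

        theta-sum : ∀ {L} → Lim (∏ (D ∘ suc)) L → L * Sum term ≈ f (suc β) * f (suc β)
        theta-sum {L} L-lim = lin 5 (λ L i f T U →
          L :* T :* (# 1 :+ i :* f) ·[ # 1 := i :* f ] ∷
          f :* f ·[ L :* (i :* i :* U) := # 1 ] ∷
          :- (L :* f :* f :* i :* i) ·[ U := T ] ∷ [] ⊢ L :* T := f :* f)
          (sym iq∞-f)
          (Lim-unique (Lim-* L-lim (PF.S-lim Dg eP≈0 (λ n → Z₀-suc n)))
            (Lim-cong (λ n → sym (∏D-S n)) Lim-const))
          (Sum-cong λ k → *-cong (eP≈ k) refl)

        mock-sum : f (suc β) * Sum (λ n → Psq 0 n * inv (∏ (D ∘ suc) n)) ≈ Sum (λ k → term k * Psq 0 k)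
        mock-sum = lin 5 (λ f i S T U →
          f ·[ S := i :* T ] ∷ T ·[ i :* f := # 1 ] ∷ # 1 ·[ T := U ] ∷ [] ⊢ f :* S := U)
          (trans (Sum-cong inner) (Bailey-sum 0 (λ k → (e₀ k * P k) * g k) λ k → *-zeroʳ[] (Psq≈0 0 k)))
          iq∞-f
          (Sum-cong λ k → *-cong (*-cong (eP≈ k) refl) refl)
          where
          inner : ∀ n → Psq 0 n * inv (∏ (D ∘ suc) n) ≈
            Sum (λ k → Psq 0 n * ((e₀ k * P k * g k) * (r n k * iq (k ℕ.+ n))))
          inner n = trans (*-cong refl (sym (inv-unique (Unit-∏ Unit-D n) (∏D-S n))))
            (trans (Sum-*ˡ (Psq 0 n) (λ k → *-zeroˡ[] (eP≈0 k)))
              (Sum-cong λ k → *-cong refl (sym (*-assoc (e₀ k * P k) _ _))))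

-- The substitution of c q^M for q as a ring homomorphism.

module Dilation where
  open Mock public

  module _ (c : ℤ) (m : ℕ) where
    private
      T = dil c m
      M = suc m

    dil-1 : T 1# ≈ 1#
    dil-1 = dil-κ c m (+ 1)

    dil-0 : T 0# ≈ 0#
    dil-0 = dil-κ c m (+ 0)

    dil-step : ∀ a b → T (a * b) ≈ κ (coeff a 0) * T b + κ c * (X M * T (tail a * b))
    dil-step a b = begin
      T (a * b)
        ≈⟨ dil-≈ c m (lin 5 (λ a z x t b → b ·[ a := z :+ x :* t ] ∷ [] ⊢ a :* b := z :* b :+ x :* (t :* b)) (unfold-tail a)) ⟩
      T (κ (coeff a 0) * b + X 1 * (tail a * b))
        ≈⟨ dil-hom-+ c m _ _ ⟩
      T (κ (coeff a 0) * b) + T (X 1 * (tail a * b))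
        ≈⟨ +-cong (dil-κ* c m (coeff a 0) b) (trans (dil-X* c m _) (*-assoc _ _ _)) ⟩
      κ (coeff a 0) * T b + κ c * (X M * T (tail a * b)) ∎

    dil-unfold : ∀ a → T a ≈ κ (coeff a 0) + κ c * (X M * T (tail a))
    dil-unfold a = trans (dil-≈ c m (sym (*-identityʳ a))) (trans (dil-step a 1#)
      (+-cong (trans (*-cong refl dil-1) (*-identityʳ _)) (*-cong refl (*-cong refl (dil-≈ c m (*-identityʳ (tail a)))))))

    -- Splitting off the constant term of a gives both sides the same recursion, whose remainder
    -- carries q^M; the order up to which they agree therefore grows without bound.
    dil-* : ∀ a b → T (a * b) ≈ T a * T b
    dil-* a b = ≈[]⇒≈ λ n → go n a b
      where
      go : ∀ n a b → T (a * b) ≈[ n ] T a * T b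
      go zero    a b = ≈[0]
      go (suc n) a b = ≈[]-resp (sym (dil-step a b))
        (lin 6 (λ A z k x t b → :- b ·[ A := z :+ k :* (x :* t) ] ∷ [] ⊢ z :* b :+ k :* (x :* (t :* b)) := A :* b) (dil-unfold a))
        (+-cong[] ≈[]-refl (*-cong[] ≈[]-refl (≈[]-mono (s≤s (ℕP.m≤n+m n m)) (X*-cong[] M (go n (tail a) b)))))

    dil-neg : ∀ a → T (- a) ≈ - T a
    dil-neg a = trans (dil-≈ c m (lin 1 (λ a → [] ⊢ :- a := con (ℤ.- (+ 1)) :* a)))
      (trans (dil-κ* c m _ a) (lin 1 (λ a → [] ⊢ con (ℤ.- (+ 1)) :* a := :- a)))

    dil-minus : ∀ a b → T (a - b) ≈ T a - T b
    dil-minus a b = trans (dil-hom-+ c m a (- b)) (+-cong refl (dil-neg b))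

    dil-^ : ∀ a k → T (a ^ k) ≈ T a ^ k
    dil-^ a zero    = dil-1
    dil-^ a (suc k) = trans (dil-* a (a ^ k)) (*-cong refl (dil-^ a k))

    dil-Xpow : ∀ n → T (X n) ≈ κ (c ℤ.^ n) * X (M ℕ.* n)
    dil-Xpow zero    = trans (dil-≈ c m X-0) (trans dil-1
      (lin 1 (λ x → :- # 1 ·[ x := # 1 ] ∷ [] ⊢ # 1 := # 1 :* x) (trans (X-≡ (ℕP.*-zeroʳ m)) X-0)))
    dil-Xpow (suc n) = trans (dil-≈ c m (X-+ 1 n)) (trans (dil-X* c m (X n))
      (lin 7 (λ k x t k′ x′ k″ x″ →
        k :* x :* # 1 ·[ t := k′ :* x′ ] ∷ :- x″ ·[ k″ := k :* k′ ] ∷ :- (k :* k′) ·[ x″ := x :* x′ ] ∷ [] ⊢ k :* x :* t := k″ :* x″)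
        (dil-Xpow n) (κ-* c (c ℤ.^ n)) (X-split M (M ℕ.* n) (ℕP.*-suc M n))))

    dil-≈0[] : ∀ {n a} → a ≈[ n ] 0# → T a ≈[ n ] 0#
    dil-≈0[] p = ≈[]-resp refl dil-0 (dil-cong[] c m p)

    dil-≈1[] : ∀ {n a} → a ≈[ n ] 1# → T a ≈[ n ] 1#
    dil-≈1[] p = ≈[]-resp refl dil-1 (dil-cong[] c m p)

    dil-inv : ∀ {u} → Unit u → T (inv u) ≈ inv (T u)
    dil-inv ok = inv-unique (dil-≈1[] ok) (trans (sym (dil-* _ _)) (trans (dil-≈ c m (*-inv ok)) dil-1))

    -- Heads are split off one at a time; the induction tracks the offset j by which the order of
    -- the k-th remaining term exceeds k.
    dil-Sum : ∀ {U} → Summable U → T (Sum U) ≈ Sum (T ∘ U)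
    dil-Sum h = ≈[]⇒≈ λ n → ≈[]-mono (ℕP.m≤m+n n 0) (go n 0 _ λ k → ≈[]-mono (ℕP.≤-reflexive (ℕP.+-identityʳ k)) (h k))
      where
      go : ∀ n j U → (∀ k → U k ≈[ k ℕ.+ j ] 0#) → T (Sum U) ≈[ n ℕ.+ j ] Sum (T ∘ U)
      go zero j U h = ≈[]-trans (dil-≈0[] (vanish U λ k → ≈[]-mono (ℕP.m≤n+m j k) (h k)))
        (≈[]-sym (vanish (T ∘ U) λ k → dil-≈0[] (≈[]-mono (ℕP.m≤n+m j k) (h k))))
        where
        vanish : ∀ V → (∀ k → V k ≈[ j ] 0#) → Sum V ≈[ j ] 0#
        vanish V p = ≈[]-trans (Sum-cong[] p) (≈⇒≈[] (Sum-0 λ _ → refl))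
      go (suc n) j U h = ≈[]-resp
        (trans (sym (dil-hom-+ c m _ _)) (dil-≈ c m (sym (Sum-head summable))))
        (sym (Sum-head λ k → dil-≈0[] (summable k)))
        (+-cong[] ≈[]-refl (≈[]-mono (ℕP.≤-reflexive (≡.sym (ℕP.+-suc n j)))
          (go n (suc j) (U ∘ suc) λ k → ≈[]-mono (ℕP.≤-reflexive (ℕP.+-suc k j)) (h (suc k)))))
        where
        summable : Summable U
        summable k = ≈[]-mono (ℕP.m≤m+n k j) (h k)

    dil-∏ : ∀ F n → T (∏ F n) ≈ ∏ (T ∘ F) n
    dil-∏ F zero    = dil-1
    dil-∏ F (suc n) = trans (dil-* _ _) (*-cong (dil-∏ F n) refl)

    dil-∏∞ : ∀ {F} → Multipliable F → T (∏∞ F) ≈ ∏∞ (T ∘ F)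
    dil-∏∞ {F} h = Lim-unique (λ n → dil-cong[] c m (∏-lim h n))
      (Lim-cong (λ n → sym (dil-∏ F n)) (∏-lim λ n → dil-≈1[] (h n)))

    -- All exponents in the factors of f_b are multiples of b, so the sign c enters only through c^b
    -- = 1.
    dil-f : ∀ β → c ℤ.^ suc β ≡ + 1 → T (f (suc β)) ≈ f (suc β ℕ.* M)
    dil-f β c^b≡1 = trans (dil-≈ c m (f≈∏∞ b)) (trans (dil-∏∞ (Multipliable-1-X β suc λ _ → ℕP.≤-refl))
      (trans (∏∞-cong λ n → trans (dil-minus 1# _) (-‿cong₂ dil-1 (trans (dil-Xpow (b ℕ.* suc n))
          (lin 3 (λ k x y → y ·[ k := # 1 ] ∷ # 1 ·[ x := y ] ∷ x :- y ·[ k := # 1 ] ∷ [] ⊢ k :* x := y)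
            (κ≈1 n) (X-≡ (exponent M b n)) (κ≈1 n)))))
        (sym (f≈∏∞ (b ℕ.* M)))))
      where
      b = suc β
      exponent : ∀ M b n → M ℕ.* (b ℕ.* suc n) ≡ b ℕ.* M ℕ.* suc n
      exponent = solve-∀
      κ≈1 : ∀ n → κ (c ℤ.^ (b ℕ.* suc n)) ≈ 1#
      κ≈1 n = κ-cong (≡.trans (≡.sym (ℤP.^-*-assoc c b (suc n))) (≡.trans (cong (ℤ._^ suc n) c^b≡1) (ℤP.^-zeroˡ (suc n))))

  dil-X₁ : ∀ m n {l} → suc m ℕ.* n ≡ l → dil (+ 1) m (X n) ≈ X l
  dil-X₁ m n ≡.refl = trans (dil-Xpow (+ 1) m n) (lin 2 (λ k x → x ·[ k := # 1 ] ∷ [] ⊢ k :* x := x)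
    (κ-cong (ℤP.^-zeroˡ n)))

-- The relation between ξ(q), ω(q³) and ψ(q)².

module XiOmega where
  open Dilation public

  module B₁ = Mock-p 0
  module B₂ = Mock-p 1
  module B₄ = Mock-p 3
  module B₆ = Mock-p 5

  opaque
    unfolding Ser f

    pow≈^ : ∀ a k → ⟪ D.pow a k ⟫ ≈ ⟪ a ⟫ ^ k
    pow≈^ a zero    = one≈1#
    pow≈^ a (suc k) = *-cong {⟪ a ⟫} {⟪ a ⟫} refl (pow≈^ a k)

    ω-unfold : ⟪ D.ω ⟫ ≈ Sum (λ n → X (2 ℕ.* n ℕ.* suc n) * inv ⟪ D.pow (D.poch (+ 1) 1 2 (suc n)) 2 ⟫)
    ω-unfold = refl

    mockf-unfold : ⟪ D.mockf ⟫ ≈ Sum (λ n → X (n ℕ.* n) * inv ⟪ D.pow (D.poch (ℤ.- (+ 1)) 1 1 n) 2 ⟫)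
    mockf-unfold = refl

    ξ-unfold : ⟪ D.ξ ⟫ ≈ 1# + κ (+ 2) * Sum (λ m → X (6 ℕ.* m ℕ.* m ℕ.+ 6 ℕ.* m ℕ.+ 1) *
      inv (⟪ D.poch (+ 1) 1 6 (suc m) ⟫ * ⟪ D.poch (+ 1) 5 6 (suc m) ⟫))
    ξ-unfold = +-cong one≈1# (·≈κ* (+ 2) _)

  Unit-1-X : ∀ n → Unit (1# - X (suc n))
  Unit-1-X n = Unit-1- (X≈0 _ (s≤s z≤n))

  Unit-1+X : ∀ n → Unit (1# + X (suc n))
  Unit-1+X n = Unit-1+ (X≈0 _ (s≤s z≤n))

  module PFω = B₂.PF₁ (κ (+ 2) * X 1)
  module PFξ = B₆.PF₁ (X 1 + X 5)

  Dω≈ : ∀ k → PFω.D k ≈ (1# - X (1 ℕ.+ 2 ℕ.* k)) * (1# - X (1 ℕ.+ 2 ℕ.* k))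
  Dω≈ k = lin 4 (λ q q₂ P x → P :* P ·[ q₂ := q :* q ] ∷ # 2 :- x :- q :* P ·[ x := q :* P ] ∷ [] ⊢
    # 1 :- # 2 :* q :* P :+ q₂ :* (P :* P) := (# 1 :- x) :* (# 1 :- x))
    (X-+ 1 1) (X-+ 1 (2 ℕ.* k))

  Dξ≈ : ∀ k → PFξ.D k ≈ (1# - X (1 ℕ.+ 6 ℕ.* k)) * (1# - X (5 ℕ.+ 6 ℕ.* k))
  Dξ≈ k = lin 6 (λ q q₅ q₆ P x y →
    P :* P ·[ q₆ := q :* q₅ ] ∷ # 1 :- y ·[ x := q :* P ] ∷ # 1 :- q :* P ·[ y := q₅ :* P ] ∷ [] ⊢
    # 1 :- (q :+ q₅) :* P :+ q₆ :* (P :* P) := (# 1 :- x) :* (# 1 :- y))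
    (X-+ 1 5) (X-+ 1 (6 ℕ.* k)) (X-+ 5 (6 ℕ.* k))

  Unit-Dω : ∀ k → Unit (PFω.D k)
  Unit-Dω k = ≈[]-resp (sym (Dω≈ k)) refl (Unit-* (Unit-1-X _) (Unit-1-X _))

  Unit-Dξ : ∀ k → Unit (PFξ.D k)
  Unit-Dξ k = ≈[]-resp (sym (Dξ≈ k)) refl (Unit-* (Unit-1-X _) (Unit-1-X _))

  ∏² : ∀ {F G} → (∀ k → G k ≈ F k * F k) → ∀ n → ∏ G n ≈ ∏ F n ^ 2
  ∏² {F} {G} h n = trans (∏-cong h n) (trans (∏-* F F n) (lin 1 (λ a → [] ⊢ a :* a := a :^ 2)))

  ω≈ : ⟪ D.ω ⟫ ≈ Sum (λ n → B₂.Psq 1 n * inv (∏ PFω.D (suc n)))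
  ω≈ = trans ω-unfold (Sum-cong λ n → *-cong (X-≡ (exponent n)) (sym (inv-cong (Unit-∏ Unit-Dω (suc n))
      (trans (∏² Dω≈ (suc n)) (trans (^-congˡ 2 (sym (poch⁻ 1 2 (suc n)))) (sym (pow≈^ _ 2)))))))
    where
    exponent : ∀ n → 2 ℕ.* n ℕ.* suc n ≡ 2 ℕ.* (n ℕ.* (n ℕ.+ 1))
    exponent = solve-∀

  ξ≈ : ⟪ D.ξ ⟫ ≈ 1# + κ (+ 2) * (X 1 * Sum (λ n → B₆.Psq 1 n * inv (∏ PFξ.D (suc n))))
  ξ≈ = trans ξ-unfold (+-cong refl (*-cong refl (trans (Sum-cong λ n → trans
      (*-cong (X-split 1 _ (exponent n)) (sym (inv-cong (Unit-∏ Unit-Dξ (suc n))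
        (trans (∏-cong Dξ≈ (suc n)) (trans (∏-* _ _ (suc n)) (*-cong (sym (poch⁻ 1 6 (suc n))) (sym (poch⁻ 5 6 (suc n)))))))))
      (*-assoc _ _ _)) (sym (Sum-*ˡ (X 1) λ n → *-zeroˡ[] (B₆.Psq≈0 1 n))))))
    where
    exponent : ∀ n → 6 ℕ.* n ℕ.* n ℕ.+ 6 ℕ.* n ℕ.+ 1 ≡ 1 ℕ.+ 6 ℕ.* (n ℕ.* (n ℕ.+ 1))
    exponent = solve-∀

  K : ℕ → Ser
  K k = (1# + X (1 ℕ.+ 2 ℕ.* k)) * inv (1# - X (1 ℕ.+ 2 ℕ.* k))

  -- With x = q^(2k+1) the numerator is 1 - x² and the denominator (1 - x)², which leaves (1 + x)/(1
  -- - x).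
  PFω-term : ∀ k → PFω.term k ≈ B₂.σ k * K k
  PFω-term k = lin 7 (λ s p P x D v i →
      :- (s :* v) ·[ p :* (P :* P) := x :* x ] ∷
      s :* (:- (# 1 :- x :* x) :* v :* ((# 1 :- x) :* i :+ # 1) :+ (# 1 :+ x) :* i) ·[ (# 1 :- x) :* i := # 1 ] ∷
      s :* (# 1 :- x :* x) :* i :* i ·[ D :* v := # 1 ] ∷
      :- (s :* (# 1 :- x :* x) :* i :* i :* v) ·[ D := (# 1 :- x) :* (# 1 :- x) ] ∷ [] ⊢
      s :* ((# 1 :- p :* (P :* P)) :* v) := s :* ((# 1 :+ x) :* i))
    pPP (*-inv (Unit-1-X _)) (*-inv (Unit-Dω k)) (Dω≈ k)
    where
    pPP : B₂.p * (B₂.P k * B₂.P k) ≈ X (1 ℕ.+ 2 ℕ.* k) * X (1 ℕ.+ 2 ℕ.* k)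
    pPP = lin 4 (λ q q₂ P x → P :* P ·[ q₂ := q :* q ] ∷ :- (x :+ q :* P) ·[ x := q :* P ] ∷ [] ⊢
      q₂ :* (P :* P) := x :* x) (X-+ 1 1) (X-+ 1 (2 ℕ.* k))

  -- Here the infinite product of the D_k is (f₁/f₂)², so the theta evaluation gives f₂⁴/f₁².
  ψ₁² : ψ 1 * ψ 1 ≈ Sum (λ k → B₂.σ k * K k)
  ψ₁² = *-cancelˡ (Unit-* (Unit-f 0) (Unit-f 0)) (lin 6 (λ ψ f₁ f₂ O T U →
      ψ :* f₁ :+ f₂ :^ 2 ·[ ψ :* f₁ := f₂ :^ 2 ] ∷
      :- (f₁ :+ O :* f₂) :* U ·[ f₁ := O :* f₂ ] ∷
      :- (f₂ :* f₂) ·[ O :* O :* T := f₂ :* f₂ ] ∷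
      f₂ :* f₂ :* O :* O ·[ T := U ] ∷ [] ⊢
      (f₁ :* f₁) :* (ψ :* ψ) := (f₁ :* f₁) :* U)
    (ψ-f 0) (f-odd 0) (PFω.theta-sum Unit-Dω lim) (Sum-cong PFω-term))
    where
    lim : Lim (∏ PFω.D) (∏odd⁻ 0 * ∏odd⁻ 0)
    lim = Lim-cong (λ n → trans (sym (∏-* _ _ n)) (∏-cong (λ k → trans (*-cong (exponent k) (exponent k)) (sym (Dω≈ k))) n))
      (Lim-* (∏odd⁻-lim 0) (∏odd⁻-lim 0))
      where
      exponent : ∀ k → 1# - X (1 ℕ.* suc (2 ℕ.* k)) ≈ 1# - X (1 ℕ.+ 2 ℕ.* k)
      exponent k = -‿cong₂ refl (X-≡ (ℕP.*-identityˡ _))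

  f₂ω : f 2 * ⟪ D.ω ⟫ ≈ Sum (λ k → B₂.σ k * K k * B₂.Psq 1 k)
  f₂ω = trans (*-cong refl ω≈) (trans (PFω.mock-sum Unit-Dω) (Sum-cong λ k → *-cong (PFω-term k) refl))

  private
    -- (-1)^j q^(9j² + 3j)
    ρ : ℕ → Ser
    ρ j = B₆.w j * B₆.Psq 1 j

    Y : ℕ → Ser
    Y j = B₆.p * (B₆.P j * B₆.P j)

    ρ-suc : ∀ j → ρ (suc j) ≈ - (X (18 ℕ.* j ℕ.+ 12) * ρ j)
    ρ-suc j = lin 6 (λ P w s s′ y z →
      :- (P :* w) ·[ s′ := y :* s ] ∷ :- (w :* s) ·[ P :* y := z ] ∷ [] ⊢
      (:- (P :* w)) :* s′ := :- (z :* (w :* s)))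
      (X-split (12 ℕ.* suc j) _ (exponent₁ j)) (trans (sym (X-+ (6 ℕ.* j) (12 ℕ.* suc j))) (X-≡ (exponent₂ j)))
      where
      exponent₁ : ∀ j → 6 ℕ.* (suc j ℕ.* (suc j ℕ.+ 1)) ≡ 12 ℕ.* suc j ℕ.+ 6 ℕ.* (j ℕ.* (j ℕ.+ 1))
      exponent₁ = solve-∀
      exponent₂ : ∀ j → 6 ℕ.* j ℕ.+ 12 ℕ.* suc j ≡ 18 ℕ.* j ℕ.+ 12
      exponent₂ = solve-∀

    σ-3j : ∀ j → B₂.σ (3 ℕ.* j) ≈ ρ j
    σ-3j zero    = lin 1 (λ x → :- # 1 ·[ x := # 1 ] ∷ [] ⊢ # 1 := # 1 :* x) X-0
    σ-3j (suc j) = trans (reflexive (cong B₂.σ (index j)))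
      (lin 7 (λ a b c s r z r′ →
        :- (a :* b :* c) ·[ s := r ] ∷ :- r ·[ a :* b :* c := z ] ∷ :- # 1 ·[ r′ := :- (z :* r) ] ∷ [] ⊢
        :- (a :* (:- (b :* (:- (c :* s))))) := r′)
        (σ-3j j) (trans (*-cong (sym (X-+ (2 ℕ.* suc (suc (suc (3 ℕ.* j)))) (2 ℕ.* suc (suc (3 ℕ.* j))))) refl)
          (trans (sym (X-+ _ (2 ℕ.* suc (3 ℕ.* j)))) (X-≡ (exponent j)))) (ρ-suc j))
      where
      index : ∀ j → 3 ℕ.* suc j ≡ suc (suc (suc (3 ℕ.* j)))
      index = solve-∀
      exponent : ∀ j → 2 ℕ.* suc (suc (suc (3 ℕ.* j))) ℕ.+ 2 ℕ.* suc (suc (3 ℕ.* j)) ℕ.+ 2 ℕ.* suc (3 ℕ.* j) ≡ 18 ℕ.* j ℕ.+ 12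
      exponent = solve-∀

    σ-3j+1 : ∀ j → B₂.σ (3 ℕ.* j ℕ.+ 1) ≈ - (X 2 * B₆.P j * ρ j)
    σ-3j+1 j = trans (reflexive (cong B₂.σ (ℕP.+-comm (3 ℕ.* j) 1)))
      (-‿cong (*-cong (X-split 2 (6 ℕ.* j) (exponent j)) (σ-3j j)))
      where
      exponent : ∀ j → 2 ℕ.* suc (3 ℕ.* j) ≡ 2 ℕ.+ 6 ℕ.* j
      exponent = solve-∀

    σ-3j+2 : ∀ j → B₂.σ (3 ℕ.* j ℕ.+ 2) ≈ Y j * ρ j
    σ-3j+2 j = trans (reflexive (cong B₂.σ (ℕP.+-comm (3 ℕ.* j) 2)))
      (lin 6 (λ a b s r p P → a :* b ·[ s := r ] ∷ r ·[ a :* b := p :* (P :* P) ] ∷ [] ⊢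
        :- (a :* (:- (b :* s))) := (p :* (P :* P)) :* r) (σ-3j j)
        (trans (sym (X-+ (2 ℕ.* suc (suc (3 ℕ.* j))) (2 ℕ.* suc (3 ℕ.* j)))) (trans (X-split 6 _ (exponent j)) (*-cong refl (X-+ (6 ℕ.* j) (6 ℕ.* j))))))
      where
      exponent : ∀ j → 2 ℕ.* suc (suc (3 ℕ.* j)) ℕ.+ 2 ℕ.* suc (3 ℕ.* j) ≡ 6 ℕ.+ (6 ℕ.* j ℕ.+ 6 ℕ.* j)
      exponent = solve-∀

    K₃ : ℕ → Ser
    K₃ k = (1# + X (3 ℕ.+ 6 ℕ.* k)) * inv (1# - X (3 ℕ.+ 6 ℕ.* k))

    dil-σ : ∀ k → dil (+ 1) 2 (B₂.σ k) ≈ B₆.σ k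
    dil-σ zero    = dil-1 (+ 1) 2
    dil-σ (suc k) = trans (dil-neg _ _ _) (-‿cong (trans (dil-* _ _ _ _) (*-cong (dil-X₁ 2 _ (exponent k)) (dil-σ k))))
      where
      exponent : ∀ k → 3 ℕ.* (2 ℕ.* suc k) ≡ 6 ℕ.* suc k
      exponent = solve-∀

    dil-K : ∀ k → dil (+ 1) 2 (K k) ≈ K₃ k
    dil-K k = trans (dil-* _ _ _ _) (*-cong (trans (dil-hom-+ _ _ _ _) (+-cong (dil-1 _ _) x))
      (trans (dil-inv _ _ (Unit-1-X _)) (sym (inv-cong (Unit-1-X _)
        (sym (trans (dil-minus _ _ _ _) (-‿cong₂ (dil-1 _ _) x)))))))
      where
      exponent : ∀ k → 3 ℕ.* (1 ℕ.+ 2 ℕ.* k) ≡ 3 ℕ.+ 6 ℕ.* k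
      exponent = solve-∀
      x : dil (+ 1) 2 (X (1 ℕ.+ 2 ℕ.* k)) ≈ X (3 ℕ.+ 6 ℕ.* k)
      x = dil-X₁ 2 _ (exponent k)

    f₆ω₃ : f 6 * dil (+ 1) 2 ⟪ D.ω ⟫ ≈ Sum (λ k → B₆.P k * ρ k * K₃ k)
    f₆ω₃ = trans (*-cong (sym (dil-f (+ 1) 2 1 ≡.refl)) refl) (trans (sym (dil-* _ _ _ _))
      (trans (dil-≈ _ _ f₂ω) (trans (dil-Sum _ _ (λ k → *-zeroʳ[] (B₂.Psq≈0 1 k))) (Sum-cong term))))
      where
      exponent : ∀ k → 3 ℕ.* (2 ℕ.* (k ℕ.* (k ℕ.+ 1))) ≡ 6 ℕ.* (k ℕ.* (k ℕ.+ 1))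
      exponent = solve-∀
      term : ∀ k → dil (+ 1) 2 (B₂.σ k * K k * B₂.Psq 1 k) ≈ B₆.P k * ρ k * K₃ k
      term k = trans (dil-* _ _ _ _) (trans (*-cong (trans (dil-* _ _ _ _) (*-cong (dil-σ k) (dil-K k))) (dil-X₁ 2 _ (exponent k)))
        (lin 5 (λ w P s t K → :- (t :* K) ·[ w :* P := s ] ∷ [] ⊢ s :* K :* t := P :* (w :* t) :* K) (B₆.wP≈σ k)))

    K-3j+1 : ∀ j → K (3 ℕ.* j ℕ.+ 1) ≈ K₃ j
    K-3j+1 j = *-cong (+-cong refl x) (inv-cong (Unit-1-X _) (-‿cong₂ refl x))
      where
      exponent : ∀ j → 1 ℕ.+ 2 ℕ.* (3 ℕ.* j ℕ.+ 1) ≡ 3 ℕ.+ 6 ℕ.* j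
      exponent = solve-∀
      x : X (1 ℕ.+ 2 ℕ.* (3 ℕ.* j ℕ.+ 1)) ≈ X (3 ℕ.+ 6 ℕ.* j)
      x = X-≡ (exponent j)

    -- With u = q^(6j+1) and v = q^(6j+5):
    -- (1 - uv) + 2u(1 - uv)/((1 - u)(1 - v)) = (1 + u)/(1 - u) + uv (1 + v)/(1 - v)
    fractions : ∀ j → (1# - Y j) + κ (+ 2) * (X 1 * (B₆.P j * ((1# - Y j) * inv (PFξ.D j)))) ≈
      K (3 ℕ.* j) + Y j * K (3 ℕ.* j ℕ.+ 2)
    fractions j = *-cancelˡ (Unit-Dξ j) (lin 11 (λ q P u v y D d iu iv K₀ K₂ →
        # 2 :* q :* P :* (# 1 :- y) ·[ D :* d := # 1 ] ∷
        :- D ·[ K₀ := (# 1 :+ u) :* iu ] ∷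
        :- (D :* y) ·[ K₂ := (# 1 :+ v) :* iv ] ∷
        (# 1 :- y) :- (# 1 :+ u) :* iu :- y :* (# 1 :+ v) :* iv ·[ D := (# 1 :- u) :* (# 1 :- v) ] ∷
        :- (# 2 :* (# 1 :- y)) ·[ u := q :* P ] ∷
        :- ((# 1 :- v) :* (# 1 :+ u)) ·[ (# 1 :- u) :* iu := # 1 ] ∷
        :- (y :* (# 1 :- u) :* (# 1 :+ v)) ·[ (# 1 :- v) :* iv := # 1 ] ∷
        :- # 2 ·[ y := u :* v ] ∷ [] ⊢
        D :* ((# 1 :- y) :+ # 2 :* (q :* (P :* ((# 1 :- y) :* d)))) := D :* (K₀ :+ y :* K₂))
      (*-inv (Unit-Dξ j)) (K-≈ (3 ℕ.* j) (exponent₀ j)) (K-≈ (3 ℕ.* j ℕ.+ 2) (exponent₂ j)) (Dξ≈ j)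
      (X-+ 1 (6 ℕ.* j)) (*-inv (Unit-1-X _)) (*-inv (Unit-1-X _)) Y≈)
      where
      exponent₀ : ∀ j → 1 ℕ.+ 2 ℕ.* (3 ℕ.* j) ≡ 1 ℕ.+ 6 ℕ.* j
      exponent₀ = solve-∀
      exponent₂ : ∀ j → 1 ℕ.+ 2 ℕ.* (3 ℕ.* j ℕ.+ 2) ≡ 5 ℕ.+ 6 ℕ.* j
      exponent₂ = solve-∀
      exponent : ∀ j → 6 ℕ.+ (6 ℕ.* j ℕ.+ 6 ℕ.* j) ≡ 1 ℕ.+ 6 ℕ.* j ℕ.+ (5 ℕ.+ 6 ℕ.* j)
      exponent = solve-∀
      Y≈ : Y j ≈ X (1 ℕ.+ 6 ℕ.* j) * X (5 ℕ.+ 6 ℕ.* j)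
      Y≈ = trans (*-cong refl (sym (X-+ (6 ℕ.* j) (6 ℕ.* j)))) (trans (sym (X-+ 6 _)) (X-split (1 ℕ.+ 6 ℕ.* j) _ (exponent j)))
      K-≈ : ∀ k {m} → 1 ℕ.+ 2 ℕ.* k ≡ suc m → K k ≈ (1# + X (suc m)) * inv (1# - X (suc m))
      K-≈ k eq = *-cong (+-cong refl (X-≡ eq)) (inv-cong (Unit-1-X _) (-‿cong₂ refl (X-≡ eq)))

  -- In the series of ψ(q)² the class k = 3j + 1 is the series of -q² f₆ ω(q³), and by `fractions`
  -- the classes 3j and 3j + 2 together are the j-th term of f₆ ξ(q).
  ξ-ω : f 6 * ⟪ D.ξ ⟫ ≈ X 2 * (f 6 * dil (+ 1) 2 ⟪ D.ω ⟫) + ψ 1 * ψ 1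
  ξ-ω = begin
    f 6 * ⟪ D.ξ ⟫
      -- The leading 1 of ξ must also become a series over j: times f₆ it is the pentagonal number
      -- series in the base q⁶.
      ≈⟨ lin 6 (λ f ξ x M S T → f ·[ ξ := # 1 :+ # 2 :* (x :* M) ] ∷ # 1 ·[ f := S ] ∷ # 2 :* x ·[ f :* M := T ] ∷ [] ⊢
           f :* ξ := S :+ (# 2 :* x) :* T) ξ≈ B₆.f-series (PFξ.mock-sum Unit-Dξ) ⟩
    Sum F + κ (+ 2) * X 1 * Sum M
      ≈⟨ +-cong refl (Sum-*ˡ _ λ k → *-zeroʳ[] (B₆.Psq≈0 1 k)) ⟩
    Sum F + Sum (λ j → κ (+ 2) * X 1 * M j)
      ≈⟨ Sum-+ F _ ⟨
    Sum (λ j → F j + κ (+ 2) * X 1 * M j)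
      ≈⟨ Sum-cong term ⟩
    Sum (λ j → X 2 * G j + (T (3 ℕ.* j) + T (3 ℕ.* j ℕ.+ 1) + T (3 ℕ.* j ℕ.+ 2)))
      ≈⟨ Sum-+ (λ j → X 2 * G j) _ ⟩
    Sum (λ j → X 2 * G j) + Sum (λ j → T (3 ℕ.* j) + T (3 ℕ.* j ℕ.+ 1) + T (3 ℕ.* j ℕ.+ 2))
      ≈⟨ +-cong (trans (sym (Sum-*ˡ (X 2) Summable-G)) (*-cong refl (sym f₆ω₃)))
                (trans (sym (Sum-split₃ Summable-T)) (sym ψ₁²)) ⟩
    X 2 * (f 6 * dil (+ 1) 2 ⟪ D.ω ⟫) + ψ 1 * ψ 1 ∎
    where
    F M G T : ℕ → Ser
    F j = B₆.e₁ j * B₆.Psq 1 j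
    M j = PFξ.term j * B₆.Psq 1 j
    G j = B₆.P j * ρ j * K₃ j
    T k = B₂.σ k * K k
    Summable-T : Summable T
    Summable-T k = *-zeroˡ[] (B₂.σ≈0 k)
    Summable-G : Summable G
    Summable-G k = *-zeroˡ[] (*-zeroˡ[] (B₆.P≈0 k))
    term : ∀ j → F j + κ (+ 2) * X 1 * M j ≈ X 2 * G j + (T (3 ℕ.* j) + T (3 ℕ.* j ℕ.+ 1) + T (3 ℕ.* j ℕ.+ 2))
    term j = lin 15 (λ w s x x₂ p P σ d K₃ σ₀ σ₁ σ₂ K₀ K₁ K₂ →
      :- (# 2 :* x :* (# 1 :- p :* (P :* P)) :* d :* s) ·[ w :* P := σ ] ∷
      w :* s ·[ (# 1 :- p :* (P :* P)) :+ # 2 :* (x :* (P :* ((# 1 :- p :* (P :* P)) :* d))) := K₀ :+ p :* (P :* P) :* K₂ ] ∷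
      :- K₀ ·[ σ₀ := w :* s ] ∷
      :- K₁ ·[ σ₁ := :- (x₂ :* P :* (w :* s)) ] ∷
      x₂ :* P :* w :* s ·[ K₁ := K₃ ] ∷
      :- K₂ ·[ σ₂ := p :* (P :* P) :* (w :* s) ] ∷ [] ⊢
      w :* (# 1 :- p :* (P :* P)) :* s :+ (# 2 :* x) :* ((σ :* ((# 1 :- p :* (P :* P)) :* d)) :* s) :=
      x₂ :* (P :* (w :* s) :* K₃) :+ (σ₀ :* K₀ :+ σ₁ :* K₁ :+ σ₂ :* K₂))
      (B₆.wP≈σ j) (fractions j) (σ-3j j) (σ-3j+1 j) (K-3j+1 j) (σ-3j+2 j)

-- The partial fraction identity and the recurrences of the inner sums.

module Lambert where
  open XiOmega public

  -- h a b and c a b are 1 / (1 + q^(2e)) and q^e / (1 + q^(2e)) at e = a - b, which may be negative;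
  -- the value at e = 0, where 2 would have to be inverted, is junk.
  h c : ℕ → ℕ → Ser
  h (suc a) (suc b) = h a b
  h a       zero    = inv (1# + X (a ℕ.+ a))
  h zero    (suc b) = X (suc b ℕ.+ suc b) * inv (1# + X (suc b ℕ.+ suc b))
  c (suc a) (suc b) = c a b
  c a       zero    = X a * inv (1# + X (a ℕ.+ a))
  c zero    (suc b) = X (suc b) * inv (1# + X (suc b ℕ.+ suc b))

  private
    unit : ∀ n → (1# + X (suc n ℕ.+ suc n)) * inv (1# + X (suc n ℕ.+ suc n)) ≈ 1#
    unit n = *-inv (Unit-1+X _)

  -- This is c(e) = q^e h(e) for e = a - b of either sign: i and j are any exponents with i - j = e.
  -- The rules `c-h` and `c-sum` clear negative exponents in the same way.
  h-c : ∀ a b {i j} → a ≢ b → i ℕ.+ b ≡ j ℕ.+ a → X i * h a b ≈ X j * c a b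
  h-c zero    zero    a≢b eq = contradiction ≡.refl a≢b
  h-c zero    (suc b) {i} {j} a≢b eq = lin 5 (λ i j B B² v →
    :- (B :* v) ·[ j := i :* B ] ∷ i :* v ·[ B² := B :* B ] ∷ [] ⊢ i :* (B² :* v) := j :* (B :* v))
    (X-split i (suc b) (≡.trans (≡.sym (ℕP.+-identityʳ j)) (≡.sym eq))) (X-+ (suc b) (suc b))
  h-c (suc a) zero    {i} {j} a≢b eq = lin 4 (λ i j A v → v ·[ i := j :* A ] ∷ [] ⊢ i :* v := j :* (A :* v))
    (X-split j (suc a) (≡.trans (≡.sym (ℕP.+-identityʳ i)) eq))
  h-c (suc a) (suc b) {i} {j} a≢b eq = h-c a b (a≢b ∘ cong suc)
    (ℕP.suc-injective (≡.trans (≡.sym (ℕP.+-suc i b)) (≡.trans eq (ℕP.+-suc j a))))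

  c-h : ∀ a b {i j} → a ≢ b → i ℕ.+ b ≡ j ℕ.+ a → X i * c a b ≈ X j * (1# - h a b)
  c-h zero    zero    a≢b eq = contradiction ≡.refl a≢b
  c-h zero    (suc b) {i} {j} a≢b eq = lin 5 (λ i j B B² v →
    :- (# 1 :- B² :* v) ·[ j := i :* B ] ∷ :- (i :* B) ·[ # 1 := (# 1 :+ B²) :* v ] ∷ [] ⊢ i :* (B :* v) := j :* (# 1 :- B² :* v))
    (X-split i (suc b) (≡.trans (≡.sym (ℕP.+-identityʳ j)) (≡.sym eq))) (sym (unit b))
  c-h (suc a) zero    {i} {j} a≢b eq = lin 5 (λ i j A A² v →
    A :* v ·[ i := j :* A ] ∷ j ·[ (# 1 :+ A²) :* v := # 1 ] ∷ :- (j :* v) ·[ A² := A :* A ] ∷ [] ⊢ i :* (A :* v) := j :* (# 1 :- v))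
    (X-split j (suc a) (≡.trans (≡.sym (ℕP.+-identityʳ i)) eq)) (unit a) (X-+ (suc a) (suc a))
  c-h (suc a) (suc b) {i} {j} a≢b eq = c-h a b (a≢b ∘ cong suc)
    (ℕP.suc-injective (≡.trans (≡.sym (ℕP.+-suc i b)) (≡.trans eq (ℕP.+-suc j a))))

  c-sum : ∀ a b {i j l} → a ≢ b → i ℕ.+ b ≡ l ℕ.+ a → j ℕ.+ a ≡ l ℕ.+ b → (X i + X j) * c a b ≈ X l
  c-sum zero    zero    a≢b eq eq′ = contradiction ≡.refl a≢b
  c-sum zero    (suc b) {i} {j} {l} a≢b eq eq′ = lin 6 (λ i j l B B² v →
    B :* v ·[ j := l :* B ] ∷ v :* l ·[ B :* B := B² ] ∷ l ·[ (# 1 :+ B²) :* v := # 1 ] ∷ :- v ·[ l := i :* B ] ∷ [] ⊢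
    (i :+ j) :* (B :* v) := l)
    (X-split l (suc b) (≡.trans (≡.sym (ℕP.+-identityʳ j)) eq′)) (sym (X-+ (suc b) (suc b))) (unit b)
    (X-split i (suc b) (≡.trans (≡.sym (ℕP.+-identityʳ l)) (≡.sym eq)))
  c-sum (suc a) zero    {i} {j} {l} a≢b eq eq′ = lin 6 (λ i j l A A² v →
    A :* v ·[ i := l :* A ] ∷ v :* l ·[ A :* A := A² ] ∷ l ·[ (# 1 :+ A²) :* v := # 1 ] ∷ :- v ·[ l := j :* A ] ∷ [] ⊢
    (i :+ j) :* (A :* v) := l)
    (X-split l (suc a) (≡.trans (≡.sym (ℕP.+-identityʳ i)) eq)) (sym (X-+ (suc a) (suc a))) (unit a)
    (X-split j (suc a) (≡.trans (≡.sym (ℕP.+-identityʳ l)) (≡.sym eq′)))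
  c-sum (suc a) (suc b) {i} {j} {l} a≢b eq eq′ = c-sum a b (a≢b ∘ cong suc)
    (ℕP.suc-injective (≡.trans (≡.sym (ℕP.+-suc i b)) (≡.trans eq (ℕP.+-suc l a))))
    (ℕP.suc-injective (≡.trans (≡.sym (ℕP.+-suc j a)) (≡.trans eq′ (ℕP.+-suc l b))))

  -- For a ≠ b the factor is a power of q times a series with constant term 1.
  cancel-squares : ∀ a b {u v} → a ≢ b →
    (X a * X a + X b * X b) * u ≈ (X a * X a + X b * X b) * v → u ≈ v
  cancel-squares zero    zero    a≢b p = contradiction ≡.refl a≢b
  cancel-squares zero    (suc b) a≢b p = *-cancelˡ
    (≈[]-resp (+-cong (sym (trans (*-cong X-0 X-0) (*-identityˡ 1#))) refl) refl (Unit-1+ (*-zeroˡ[] (X≈0 _ (s≤s z≤n))))) p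
  cancel-squares (suc a) zero    a≢b p = *-cancelˡ
    (≈[]-resp (trans (+-comm _ _) (+-cong refl (sym (trans (*-cong X-0 X-0) (*-identityˡ 1#))))) refl
      (Unit-1+ (*-zeroˡ[] (X≈0 _ (s≤s z≤n))))) p
  cancel-squares (suc a) (suc b) {u} {v} a≢b p = cancel-squares a b (a≢b ∘ cong suc) (X*-cancel 1 (X*-cancel 1
    (lin 7 (λ q A B A′ B′ u v →
      :- ((A′ :+ q :* A) :* (u :- v)) ·[ A′ := q :* A ] ∷
      :- ((B′ :+ q :* B) :* (u :- v)) ·[ B′ := q :* B ] ∷
      # 1 ·[ (A′ :* A′ :+ B′ :* B′) :* u := (A′ :* A′ :+ B′ :* B′) :* v ] ∷ [] ⊢
      q :* (q :* ((A :* A :+ B :* B) :* u)) := q :* (q :* ((A :* A :+ B :* B) :* v)))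
      (X-+ 1 a) (X-+ 1 b) p)))

  private
    -- The partial fraction identity with denominators cleared, for A = q^a and B = q^b. The values
    -- c and h at a - b enter only through (A² + B²)c = AB and (A² + B²)h = B², so the sign of a - b
    -- is immaterial.
    core : ∀ {A B i j g c h} →
      (1# - A) * i ≈ 1# → (1# + A * B * (A * B)) * g ≈ 1# → (1# + B * B) * j ≈ 1# →
      (A * A + B * B) * c ≈ A * B → (A * A + B * B) * h ≈ B * B →
      (A * A + B * B) * ((1# + A * B * (A * B)) * (1# - A) * (1# + B * B) *
        (κ (+ 2) * ((1# + A) * i) * (B * j))) ≈
      (A * A + B * B) * ((1# + A * B * (A * B)) * (1# - A) * (1# + B * B) *
        ((1# + A) * i * (c + A * B * g) + κ (+ 2) * (B * j) * (h - A * B * (A * B) * g) -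
         (1# - B * B) * j * (c - A * B * g)))
    core = lin 7 (λ A B i j g c h →
      let S = A :* A :+ B :* B ; G = # 1 :+ A :* B :* (A :* B) ; I = # 1 :- A ; J = # 1 :+ B :* B
          coefficient-j = S :* I :* (# 2 :* A :* A :* B :* B :* B :- (# 1 :- B :* B) :* A :* B)
            :+ S :* G :* (# 1 :+ A) :* # 2 :* B :+ S :* G :* I :* ((# 1 :- B :* B) :* c :- # 2 :* B :* h)
      in
      S :* G :* J :* (# 1 :+ A) :* (# 2 :* B :* j :- c :- A :* B :* g) ·[ I :* i := # 1 ] ∷
      S :* I :* J :* j :* (# 2 :* A :* A :* B :* B :* B :- (# 1 :- B :* B) :* A :* B) :- S :* J :* (# 1 :+ A) :* A :* B ·[ G :* g := # 1 ] ∷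
      coefficient-j ·[ J :* j := # 1 ] ∷
      G :* I :* (# 1 :- B :* B) :- G :* J :* (# 1 :+ A) ·[ S :* c := A :* B ] ∷
      :- (# 2 :* B :* G :* I) ·[ S :* h := B :* B ] ∷ [] ⊢
      S :* (G :* I :* J :* (# 2 :* ((# 1 :+ A) :* i) :* (B :* j))) :=
      S :* (G :* I :* J :*
        ((# 1 :+ A) :* i :* (c :+ A :* B :* g) :+ # 2 :* (B :* j) :* (h :- A :* B :* (A :* B) :* g) :-
         (# 1 :- B :* B) :* j :* (c :- A :* B :* g))))

  -- With K(a) = (1 + q^a)/(1 - q^a) and t(b) = (1 - q^(2b))/(1 + q^(2b)), the product of two terms is
  -- 2K(a)c(b) = K(a)(c(a-b) + c(a+b)) + 2c(b)(h(a-b) - h(-a-b)) - t(b)(c(a-b) - c(a+b)).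
  Lambert-product : ∀ a b → suc a ≢ suc b →
    (let K = (1# + X (suc a)) * inv (1# - X (suc a))
         t = (1# - X (suc b ℕ.+ suc b)) * inv (1# + X (suc b ℕ.+ suc b))
         N = suc a ℕ.+ suc b) →
    κ (+ 2) * K * c 0 (suc b) ≈
    K * (c (suc a) (suc b) + c 0 N) + κ (+ 2) * c 0 (suc b) * (h (suc a) (suc b) - h 0 N) -
    t * (c (suc a) (suc b) - c 0 N)
  Lambert-product a b a≢b = trans
    (*-cancelˡ Unit-GIJ′ (cancel-squares (suc a) (suc b) a≢b
      (core (*-inv (Unit-1-X a)) (trans (*-cong (+-cong refl (sym NN≈)) refl) (*-inv (Unit-1+X _)))
        (trans (*-cong (+-cong refl (sym (X-+ (suc b) (suc b)))) refl) (*-inv (Unit-1+X _))) S-c S-h)))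
    (-‿cong₂ (+-cong (*-cong refl (+-cong refl (sym c₀))) (*-cong refl (-‿cong₂ refl (sym h₀))))
      (*-cong (*-cong (-‿cong₂ refl (sym (X-+ (suc b) (suc b)))) refl) (-‿cong₂ refl (sym c₀))))
    where
    A = X (suc a)
    B = X (suc b)
    N = suc a ℕ.+ suc b
    j = inv (1# + X (suc b ℕ.+ suc b))
    g = inv (1# + X (N ℕ.+ N))
    N≈ : X N ≈ A * B
    N≈ = X-+ (suc a) (suc b)
    NN≈ : X (N ℕ.+ N) ≈ A * B * (A * B)
    NN≈ = trans (X-+ N N) (*-cong N≈ N≈)
    c₀ : c 0 N ≈ A * B * g
    c₀ = *-cong N≈ refl
    h₀ : h 0 N ≈ A * B * (A * B) * g
    h₀ = *-cong NN≈ refl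
    Unit-GIJ′ : Unit ((1# + A * B * (A * B)) * (1# - A) * (1# + B * B))
    Unit-GIJ′ = Unit-* (Unit-* (≈[]-resp (+-cong refl NN≈) refl (Unit-1+X _)) (Unit-1-X a))
      (≈[]-resp (+-cong refl (X-+ (suc b) (suc b))) refl (Unit-1+X _))
    S-c : (A * A + B * B) * c (suc a) (suc b) ≈ A * B
    S-c = trans (*-cong (sym (+-cong (X-+ (suc a) (suc a)) (X-+ (suc b) (suc b)))) refl)
      (trans (c-sum (suc a) (suc b) a≢b (exponent a b) (exponent′ a b)) N≈)
      where
      exponent : ∀ a b → suc a ℕ.+ suc a ℕ.+ suc b ≡ suc a ℕ.+ suc b ℕ.+ suc a
      exponent = solve-∀
      exponent′ : ∀ a b → suc b ℕ.+ suc b ℕ.+ suc a ≡ suc a ℕ.+ suc b ℕ.+ suc b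
      exponent′ = solve-∀
    S-h : (A * A + B * B) * h (suc a) (suc b) ≈ B * B
    S-h = lin 4 (λ A B h c → A ·[ A :* h := B :* c ] ∷ B ·[ A :* c := B :* (# 1 :- h) ] ∷ [] ⊢
      (A :* A :+ B :* B) :* h := B :* B)
      (h-c (suc a) (suc b) a≢b (ℕP.+-comm (suc a) (suc b))) (c-h (suc a) (suc b) a≢b (ℕP.+-comm (suc a) (suc b)))

  -- The case b = 0 of `Lambert-product`, with t(0) = 0 and with 2c(0) read as 1.
  Lambert-product₀ : ∀ a → (let K = (1# + X (suc a)) * inv (1# - X (suc a))) →
    K ≈ κ (+ 2) * (K * c 0 (suc a)) + (h (suc a) 0 - h 0 (suc a))
  Lambert-product₀ a = *-cancelˡ (Unit-* (Unit-1-X a) (Unit-1+X (a ℕ.+ suc a)))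
    (lin 4 (λ A A² i g →
      (# 1 :+ A) :* ((# 1 :+ A²) :- # 2 :* (# 1 :+ A²) :* A :* g) ·[ (# 1 :- A) :* i := # 1 ] ∷
      :- # 2 :* (# 1 :+ A) :* A :- (# 1 :- A) :* (# 1 :- A²) ·[ (# 1 :+ A²) :* g := # 1 ] ∷
      # 2 ·[ A² := A :* A ] ∷ [] ⊢
      ((# 1 :- A) :* (# 1 :+ A²)) :* ((# 1 :+ A) :* i) :=
      ((# 1 :- A) :* (# 1 :+ A²)) :* (# 2 :* ((# 1 :+ A) :* i :* (A :* g)) :+ (g :- A² :* g)))
      (*-inv (Unit-1-X a)) (unit a) (X-+ (suc a) (suc a)))

  -- b m = 2m and a k = 2k + 1, so that h and c compute on their arguments
  b a : ℕ → ℕ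
  b zero    = 0
  b (suc m) = suc (suc (b m))
  a k = suc (b k)

  b≡ : ∀ m → b m ≡ 2 ℕ.* m
  b≡ zero    = ≡.refl
  b≡ (suc m) = ≡.trans (cong (suc ∘ suc) (b≡ m)) (≡.sym (ℕP.*-suc 2 m))

  a≢b : ∀ k m → a k ≢ b m
  a≢b zero    (suc m) ()
  a≢b (suc k) (suc m) p = a≢b k m (ℕP.suc-injective (ℕP.suc-injective p))

  a+b : ∀ k m → a k ℕ.+ b (suc m) ≡ a (suc k) ℕ.+ b m
  a+b k m = ≡.trans (ℕP.+-suc (a k) (suc (b m))) (cong suc (ℕP.+-suc (a k) (b m)))

  s : ℕ → Ser
  s = B₂.σ

  X-2suc : ∀ k → X (2 ℕ.* suc k) ≈ X (b (suc k))
  X-2suc k = X-≡ (≡.sym (b≡ (suc k)))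

  s-suc : ∀ k → s (suc k) ≈ - (X (b (suc k)) * s k)
  s-suc k = -‿cong (*-cong (X-2suc k) refl)

  h-c₀ : ∀ n → h 0 (suc n) ≈ X (suc n) * c 0 (suc n)
  h-c₀ n = trans (trans (sym (*-identityˡ _)) (*-cong (sym X-0) refl)) (h-c 0 (suc n) {0} {suc n} (λ ()) (≡.sym (ℕP.+-identityʳ (suc n))))

  c-h₀ : ∀ n → c 0 (suc n) ≈ X (suc n) * (1# - h 0 (suc n))
  c-h₀ n = trans (trans (sym (*-identityˡ _)) (*-cong (sym X-0) refl)) (c-h 0 (suc n) {0} {suc n} (λ ()) (≡.sym (ℕP.+-identityʳ (suc n))))

  -- The sums of s_k h(2k+1-2m) and s_k c(2k+1-2m) over k ∈ ℤ, folded at 2k+1 ↔ -(2k+1), where s is odd.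
  H K′ : ℕ → Ser
  H  m = Sum (λ k → s k * (h (a k) (b m) - h 0 (a k ℕ.+ b m)))
  K′ m = Sum (λ k → s k * (c (a k) (b m) - c 0 (a k ℕ.+ b m)))

  Summable-s : ∀ {u : ℕ → Ser} → Summable (λ k → s k * u k)
  Summable-s k = *-zeroˡ[] (B₂.σ≈0 k)

  private
    shift-exponent : ∀ k m → b (suc k) ℕ.+ b m ≡ suc (b m) ℕ.+ a k
    shift-exponent k m = cong suc (ℕP.+-comm (suc (b k)) (b m))

    X-shift : ∀ k m → X (suc (b m)) * X (b (suc k)) ≈ X (a (suc k) ℕ.+ b m)
    X-shift k m = trans (sym (X-+ (suc (b m)) (b (suc k)))) (X-≡ (cong suc (ℕP.+-comm (b m) (b (suc k)))))

  -- Moving k and m together keeps 2k+1-2m, so `h (a (suc k)) (b (suc m))` reduces to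
  -- `h (a k) (b m)`; then s_{k+1} h = -q^(2k+2) s_k h = -q^(2m+1) s_k c by `h-c`, and the sum
  -- telescopes.
  H-suc : ∀ m → H (suc m) ≈ - (X (a m) * K′ m)
  H-suc m = lin 4 (λ H x K Z → # 1 ·[ H :+ Z := # 0 ] ∷ # 1 ·[ x :* K := Z ] ∷ [] ⊢ H := :- (x :* K))
    (trans (sym (Sum-+ _ (λ k → X (a m) * (s k * (c (a k) (b m) - c 0 (a k ℕ.+ b m))))))
      (trans (Sum-cong step) (trans (Sum-telescope (Summable-s {λ k → h (a k) (b (suc m)) - X (a m) * c 0 (a k ℕ.+ b m)}))
        (lin 3 (λ h x c → # 1 ·[ h := x :* c ] ∷ [] ⊢ # 1 :* (h :- x :* c) := # 0) (h-c₀ (b m))))))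
    (Sum-*ˡ (X (a m)) Summable-s)
    where
    y : ℕ → Ser
    y k = s k * (h (a k) (b (suc m)) - X (a m) * c 0 (a k ℕ.+ b m))
    step : ∀ k → s k * (h (a k) (b (suc m)) - h 0 (a k ℕ.+ b (suc m))) + X (a m) * (s k * (c (a k) (b m) - c 0 (a k ℕ.+ b m))) ≈
      y k - y (suc k)
    step k = lin 12 (λ x z N s s′ h₁ h₀′ h₀ c₁ c₀ c₀′ h₂ →
      :- s ·[ h₀′ := h₀ ] ∷
      :- s ·[ h₀ := N :* c₀′ ] ∷
      s :* c₀′ ·[ x :* z := N ] ∷
      h₁ :- x :* c₀′ ·[ s′ := :- (z :* s) ] ∷
      :- s ·[ z :* h₁ := x :* c₁ ] ∷ [] ⊢
      s :* (h₂ :- h₀′) :+ x :* (s :* (c₁ :- c₀)) := s :* (h₂ :- x :* c₀) :- s′ :* (h₁ :- x :* c₀′))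
      (reflexive (cong (h 0) (a+b k m))) (h-c₀ (b (suc k) ℕ.+ b m)) (X-shift k m) (s-suc k)
      (h-c (a k) (b m) (a≢b k m) (shift-exponent k m))

  K′-suc : ∀ m → K′ (suc m) ≈ X (a m) * H m
  K′-suc m = lin 4 (λ K x H Z → # 1 ·[ K :- Z := # 0 ] ∷ :- # 1 ·[ x :* H := Z ] ∷ [] ⊢ K := x :* H)
    (trans (+-cong refl negate) (trans (sym (Sum-+ _ _)) (trans (Sum-cong step) (trans (Sum-telescope (Summable-s {λ k → c (a k) (b (suc m)) + X (a m) * h 0 (a k ℕ.+ b m) - X (a m)}))
        (lin 3 (λ h x c → # 1 ·[ c := x :* (# 1 :- h) ] ∷ [] ⊢ # 1 :* (c :+ x :* h :- x) := # 0) (c-h₀ (b m)))))))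
    (Sum-*ˡ (X (a m)) Summable-s)
    where
    u y : ℕ → Ser
    u k = X (a m) * (s k * (h (a k) (b m) - h 0 (a k ℕ.+ b m)))
    -- The constant -q^(2m+1) absorbs the 1 in the relation between c and 1 - h.
    y k = s k * (c (a k) (b (suc m)) + X (a m) * h 0 (a k ℕ.+ b m) - X (a m))
    negate : - Sum u ≈ Sum (λ k → (- 1#) * u k)
    negate = trans (lin 1 (λ t → [] ⊢ :- t := (:- # 1) :* t)) (Sum-*ˡ (- 1#) {u} (λ k → *-zeroʳ[] (Summable-s {λ k → h (a k) (b m) - h 0 (a k ℕ.+ b m)} k)))
    step : ∀ k → s k * (c (a k) (b (suc m)) - c 0 (a k ℕ.+ b (suc m))) + (- 1#) * u k ≈ y k - y (suc k)
    step k = lin 12 (λ x z N s s′ c₂ c₀′ c₀ h₁ h₀ h₀′ c₁ →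
      :- s ·[ c₀′ := c₀ ] ∷
      :- s ·[ c₀ := N :* (# 1 :- h₀′) ] ∷
      s :* (# 1 :- h₀′) ·[ x :* z := N ] ∷
      c₁ :+ x :* h₀′ :- x ·[ s′ := :- (z :* s) ] ∷
      :- s ·[ z :* c₁ := x :* (# 1 :- h₁) ] ∷ [] ⊢
      s :* (c₂ :- c₀′) :+ (:- # 1) :* (x :* (s :* (h₁ :- h₀))) :=
      s :* (c₂ :+ x :* h₀ :- x) :- s′ :* (c₁ :+ x :* h₀′ :- x))
      (reflexive (cong (c 0) (a+b k m))) (c-h₀ (b (suc k) ℕ.+ b m)) (X-shift k m) (s-suc k)
      (c-h (a k) (b m) (a≢b k m) (shift-exponent k m))

  K′-0 : K′ 0 ≈ 0#
  K′-0 = Sum-0 λ k → lin 3 (λ s x y → :- s ·[ y := x ] ∷ [] ⊢ s :* (x :- y) := # 0)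
    (reflexive (cong (c 0) (ℕP.+-identityʳ (a k))))

  -- (-1)^j q^(4j²)
  η : ℕ → Ser
  η zero    = 1#
  η (suc j) = - (X (a (b j) ℕ.+ a (suc (b j))) * η j)

  -- c is even, so K′ 0 = 0, and the recurrences alternate between H and K′. Hence two chains
  -- separate: K′ at even and H at odd arguments vanish, and all other values are multiples of H 0.
  K′-even : ∀ j → K′ (b j) ≈ 0#
  K′-even zero    = K′-0
  K′-even (suc j) = lin 5 (λ K x H y K₀ → # 1 ·[ K := x :* H ] ∷ x ·[ H := :- (y :* K₀) ] ∷ :- (x :* y) ·[ K₀ := # 0 ] ∷ [] ⊢ K := # 0)
    (K′-suc (suc (b j))) (H-suc (b j)) (K′-even j)

  H-odd : ∀ j → H (suc (b j)) ≈ 0#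
  H-odd j = lin 3 (λ H y K → # 1 ·[ H := :- (y :* K) ] ∷ :- y ·[ K := # 0 ] ∷ [] ⊢ H := # 0) (H-suc (b j)) (K′-even j)

  H-even : ∀ j → H (b j) ≈ η j * H 0
  H-even zero    = sym (*-identityˡ (H 0))
  H-even (suc j) = lin 8 (λ H₂ K x y z H₀ η h →
    # 1 ·[ H₂ := :- (y :* K) ] ∷ :- y ·[ K := x :* H₀ ] ∷ :- (y :* x) ·[ H₀ := η :* h ] ∷ η :* h ·[ z := x :* y ] ∷ [] ⊢ H₂ := :- (z :* η) :* h)
    (H-suc (suc (b j))) (K′-suc (b j)) (H-even j) (X-+ (a (b j)) (a (suc (b j))))

  K′-odd : ∀ j → K′ (suc (b j)) ≈ X (a (b j)) * (η j * H 0)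
  K′-odd j = trans (K′-suc (b j)) (*-cong refl (H-even j))

  -- (-1)^m q^(2m²)
  τ : ℕ → Ser
  τ zero    = 1#
  τ (suc m) = - (X (b (a m)) * τ m)

  τ≈0 : Summable τ
  τ≈0 zero    = ≈[0]
  τ≈0 (suc m) = -‿zero[] (*-zeroˡ[] (X≈0 _ (bound m)))
    where
    bound : ∀ m → suc m ≤ b (a m)
    bound m = subst (suc m ≤_) (≡.sym (≡.trans (b≡ (a m)) (cong (λ n → 2 ℕ.* suc n) (b≡ m))))
      (s≤s (ℕP.≤-trans (ℕP.m≤m+n m _) (ℕP.m≤m+n _ _)))

  C₊ C₋ : ℕ → ℕ → Ser
  C₋ n m = τ m * c (a n) (b m)
  C₊ n m = τ m * c 0 (a n ℕ.+ b m)

  -- The sum of τ_m c(2n+1-2m) over m ∈ ℤ.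
  C : ℕ → Ser
  C n = Sum (λ m → C₊ n m + C₋ n (suc m))

  private
    Summable-C₋ : ∀ n → Summable (C₋ n)
    Summable-C₋ n m = *-zeroˡ[] (τ≈0 m)
    Summable-C₊ : ∀ n → Summable (C₊ n)
    Summable-C₊ n m = *-zeroˡ[] (τ≈0 m)

  C₋-0 : ∀ n → C₋ n 0 ≈ C₊ n 0
  C₋-0 n = *-cong refl (reflexive (cong (c 0) (≡.sym (ℕP.+-identityʳ (a n)))))

  C-shift : ∀ n → C n ≈ Sum (λ m → C₋ n m + C₊ n (suc m))
  C-shift n = lin 8 (λ C T P Q P′ Q′ p q →
    # 1 ·[ C := P :+ Q′ ] ∷ # 1 ·[ P := p :+ P′ ] ∷ :- # 1 ·[ Q := q :+ Q′ ] ∷ :- # 1 ·[ q := p ] ∷ :- # 1 ·[ T := Q :+ P′ ] ∷ [] ⊢ C := T)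
    (Sum-+ (C₊ n) _) (Sum-head (Summable-C₊ n)) (Sum-head (Summable-C₋ n)) (C₋-0 n) (Sum-+ (C₋ n) _)

  -- Holds term by term after the regrouping `C-shift`: with l = 2n+2m+3, both (q^(4n+4) + q^(4m+2))
  -- c(2n+1-2m) and (1 + q^(2l)) c(l) equal q^l.
  C-suc : ∀ n → C (suc n) ≈ X (b (b (suc n))) * C n
  C-suc n = trans (Sum-cong step) (trans
    (sym (Sum-*ˡ (X (b (b (suc n)))) (Summable-+ (Summable-C₋ n) (Summable-suc (Summable-C₊ n)))))
    (*-cong refl (sym (C-shift n))))
    where
    step : ∀ m → C₊ (suc n) m + C₋ (suc n) (suc m) ≈ X (b (b (suc n))) * (C₋ n m + C₊ n (suc m))
    step m = lin 9 (λ x z o w l t c₁ c₀ c₀′ →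
      x :* z :* t ·[ c₀′ := c₀ ] ∷
      :- t ·[ (x :+ z) :* c₁ := l ] ∷
      t ·[ (o :+ w) :* c₀ := l ] ∷
      :- (t :* c₀) ·[ o := # 1 ] ∷
      t :* c₀ ·[ x :* z := w ] ∷ [] ⊢
      t :* c₀ :+ (:- (z :* t)) :* c₁ := x :* (t :* c₁ :+ (:- (z :* t)) :* c₀′))
      (reflexive (cong (c 0) (a+b n m)))
      (c-sum (a n) (b m) (a≢b n m) (exponent₁ n m) (exponent₂ n m))
      (c-sum 0 (a (suc n) ℕ.+ b m) {0} (λ ()) (≡.sym (ℕP.+-identityʳ _)) (ℕP.+-identityʳ _))
      X-0
      (trans (sym (X-+ (b (b (suc n))) (b (a m)))) (X-≡ (exponent₃ n m)))
      where
      exponent₁ : ∀ n m → b (b (suc n)) ℕ.+ b m ≡ a (suc n) ℕ.+ b m ℕ.+ a n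
      exponent₁ n m rewrite b≡ (b n) | b≡ n | b≡ m = lemma n m
        where
        lemma : ∀ n m → suc (suc (suc (suc (2 ℕ.* (2 ℕ.* n))))) ℕ.+ 2 ℕ.* m ≡ suc (suc (suc (2 ℕ.* n))) ℕ.+ 2 ℕ.* m ℕ.+ suc (2 ℕ.* n)
        lemma = solve-∀
      exponent₂ : ∀ n m → b (a m) ℕ.+ a n ≡ a (suc n) ℕ.+ b m ℕ.+ b m
      exponent₂ n m rewrite b≡ (b m) | b≡ n | b≡ m = lemma n m
        where
        lemma : ∀ n m → suc (suc (2 ℕ.* (2 ℕ.* m))) ℕ.+ suc (2 ℕ.* n) ≡ suc (suc (suc (2 ℕ.* n))) ℕ.+ 2 ℕ.* m ℕ.+ 2 ℕ.* m
        lemma = solve-∀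
      exponent₃ : ∀ n m → b (b (suc n)) ℕ.+ b (a m) ≡ a (suc n) ℕ.+ b m ℕ.+ (a (suc n) ℕ.+ b m)
      exponent₃ n m rewrite b≡ (b m) | b≡ (b n) | b≡ n | b≡ m = lemma n m
        where
        lemma : ∀ n m → suc (suc (suc (suc (2 ℕ.* (2 ℕ.* n))))) ℕ.+ suc (suc (2 ℕ.* (2 ℕ.* m))) ≡
          suc (suc (suc (2 ℕ.* n))) ℕ.+ 2 ℕ.* m ℕ.+ (suc (suc (suc (2 ℕ.* n))) ℕ.+ 2 ℕ.* m)
        lemma = solve-∀

  -- The monomial q^(2n(n+1)) is exactly the factor by which the series of f₂ω differs from that of
  -- ψ(q)².
  C-power : ∀ n → C n ≈ B₂.Psq 1 n * C 0
  C-power zero    = lin 2 (λ C o → :- C ·[ o := # 1 ] ∷ [] ⊢ C := o :* C) X-0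
  C-power (suc n) = lin 6 (λ C C₁ x P P′ C₀ →
    # 1 ·[ C₁ := x :* C ] ∷ x ·[ C := P :* C₀ ] ∷ :- C₀ ·[ P′ := x :* P ] ∷ [] ⊢ C₁ := P′ :* C₀)
    (C-suc n) (C-power n) (X-split (b (b (suc n))) _ (exponent n))
    where
    exponent : ∀ n → 2 ℕ.* (suc n ℕ.* (suc n ℕ.+ 1)) ≡ b (b (suc n)) ℕ.+ 2 ℕ.* (n ℕ.* (n ℕ.+ 1))
    exponent n rewrite b≡ (b n) | b≡ n = lemma n
      where
      lemma : ∀ n → 2 ℕ.* (suc n ℕ.* (suc n ℕ.+ 1)) ≡ suc (suc (suc (suc (2 ℕ.* (2 ℕ.* n))))) ℕ.+ 2 ℕ.* (n ℕ.* (n ℕ.+ 1))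
      lemma = solve-∀

-- The identity between f(q⁸), ω(q) and ω(-q⁴).

module MockIdentity where
  open Lambert public

  -- The weight of m in Σ 2c(2m) over m ∈ ℤ, folded at m ↔ -m; at m = 0 it is 2c(0) = 1.
  γ : ℕ → Ser
  γ zero    = 1#
  γ (suc m) = κ (+ 4) * c 0 (b (suc m))

  σ₄≈ : ∀ m → B₄.σ m ≈ τ m * X (b m)
  σ₄≈ zero    = lin 1 (λ o → :- # 1 ·[ o := # 1 ] ∷ [] ⊢ # 1 := # 1 :* o) X-0
  σ₄≈ (suc m) = lin 6 (λ P σ t x y z →
    :- P ·[ σ := t :* x ] ∷ :- t ·[ P :* x := y :* z ] ∷ [] ⊢ :- (P :* σ) := (:- (y :* t)) :* z)
    (σ₄≈ m) (trans (sym (X-+ (4 ℕ.* suc m) (b m))) (X-split (b (a m)) (b (suc m)) (exponent m)))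
    where
    exponent : ∀ m → 4 ℕ.* suc m ℕ.+ b m ≡ b (a m) ℕ.+ b (suc m)
    exponent m rewrite b≡ (b m) | b≡ m = lemma m
      where
      lemma : ∀ m → 4 ℕ.* suc m ℕ.+ 2 ℕ.* m ≡ suc (suc (2 ℕ.* (2 ℕ.* m))) ℕ.+ suc (suc (2 ℕ.* m))
      lemma = solve-∀

  private
    reduce : ∀ {y D u} → (1# + y) * (1# + y) ≈ D → Unit D → (1# + y) * u ≈ 1# → (1# - y * y) * inv D ≈ (1# - y) * u
    reduce {y} {D} {u} D≈ ok p = *-cancelˡ ok (lin 4 (λ y D v u →
      # 1 :- y :* y ·[ D :* v := # 1 ] ∷ (# 1 :- y) :* u ·[ (# 1 :+ y) :* (# 1 :+ y) := D ] ∷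
      :- ((# 1 :- y) :* (# 1 :+ y)) ·[ (# 1 :+ y) :* u := # 1 ] ∷ [] ⊢
      D :* ((# 1 :- y :* y) :* v) := D :* ((# 1 :- y) :* u)) (*-inv ok) D≈ p)

  reduce′ : ∀ {y D u} → (1# + y) * (1# + y) ≈ D → Unit D → (1# + y) * u ≈ 1# → (1# + y) * inv D ≈ u
  reduce′ {y} {D} {u} D≈ ok p = *-cancelˡ ok (lin 4 (λ y D v u →
    # 1 :+ y ·[ D :* v := # 1 ] ∷ u ·[ (# 1 :+ y) :* (# 1 :+ y) := D ] ∷
    :- (# 1 :+ y) ·[ (# 1 :+ y) :* u := # 1 ] ∷ [] ⊢
    D :* ((# 1 :+ y) :* v) := D :* u) (*-inv ok) D≈ p)

  module PF-P₂ = B₄.PF₀ (- κ (+ 2))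

  D-P₂ : ∀ k → (1# + B₄.P (suc k)) * (1# + B₄.P (suc k)) ≈ PF-P₂.D (suc k)
  D-P₂ k = lin 2 (λ P o → :- (P :* P) ·[ o := # 1 ] ∷ [] ⊢
    (# 1 :+ P) :* (# 1 :+ P) := # 1 :- (:- # 2) :* P :+ o :* (P :* P)) B₄.P-0

  P₂ : Ser
  P₂ = Sum (λ m → τ m * γ m)

  -- In the base q⁴ with s = -2 the denominators are (1 + q^(4m))², and one factor 1 + q^(4m)
  -- cancels against the numerator. The product of the denominators over m > 0 is (f₈/f₄)².
  P₂-f : f 8 ^ 2 * P₂ ≈ f 4 ^ 4
  P₂-f = lin 5 (λ f₈ f₄ A T U →
    f₈ :^ 2 ·[ U := T ] ∷ f₄ :* f₄ ·[ A :* A :* T := f₄ :* f₄ ] ∷ :- (T :* (A :* f₄ :+ f₈)) ·[ A :* f₄ := f₈ ] ∷ [] ⊢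
    f₈ :^ 2 :* U := f₄ :^ 4)
    (Sum-cong term) (PF-P₂.theta-sum unit lim) (∏all⁺-f 3)
    where
    unit : ∀ k → Unit (PF-P₂.D (suc k))
    unit k = ≈[]-resp (D-P₂ k) refl (Unit-* (Unit-1+X _) (Unit-1+X _))
    lim : Lim (∏ (PF-P₂.D ∘ suc)) (∏all⁺ 3 * ∏all⁺ 3)
    lim = Lim-cong (λ n → trans (sym (∏-* _ _ n)) (∏-cong D-P₂ n)) (Lim-* (∏all⁺-lim 3) (∏all⁺-lim 3))
    exponent : ∀ m → 4 ℕ.* suc m ≡ b (suc m) ℕ.+ b (suc m)
    exponent m rewrite b≡ m = lemma m
      where
      lemma : ∀ m → 4 ℕ.* suc m ≡ suc (suc (2 ℕ.* m)) ℕ.+ suc (suc (2 ℕ.* m))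
      lemma = solve-∀
    term : ∀ m → τ m * γ m ≈ PF-P₂.term m
    term zero    = refl
    term (suc m) = lin 7 (λ t x u s P v w →
      :- (# 4 :* s) ·[ w := u ] ∷ :- (# 4 :* u) ·[ s := t :* x ] ∷ # 4 :* s ·[ w := (# 1 :+ P) :* v ] ∷ [] ⊢
      t :* (# 4 :* (x :* u)) := s :* (# 1 :+ P) :* ((# 2 :- (:- # 2)) :* v))
      (inv-cong (Unit-1+X _) (+-cong refl (X-≡ (exponent m)))) (σ₄≈ (suc m))
      (sym (reduce′ (D-P₂ m) (unit m) (*-inv (Unit-1+X _))))

  module PF-C = B₄.PF₁ (- (κ (+ 2) * X 2))

  -- Since c is even and τ_{m+1} = -q^(4m+2) τ_m, pairing m with -m-1 gives τ_m (1 - q^(4m+2))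
  -- c(2m+1), a partial fraction term with denominator (1 + q^(4m+2))².
  C-f : f 4 ^ 2 * C 0 ≈ X 1 * (f 2 ^ 2 * f 8 ^ 2)
  C-f = *-cancelˡ (Unit-^ 2 (Unit-f 3)) (lin 7 (λ f₂ f₄ f₈ q C T O →
    f₄ :^ 4 ·[ C := q :* T ] ∷
    q :* f₂ :^ 2 :* f₈ :^ 2 ·[ O :* O :* T := f₄ :* f₄ ] ∷
    :- (q :* T :* (O :* f₂ :* f₈ :+ f₄ :^ 2)) ·[ O :* (f₂ :* f₈) := f₄ :* f₄ ] ∷ [] ⊢
    f₄ :^ 2 :* (f₄ :^ 2 :* C) := f₄ :^ 2 :* (q :* (f₂ :^ 2 :* f₈ :^ 2)))
    (trans (Sum-cong term) (sym (Sum-*ˡ (X 1) λ k → *-zeroˡ[] (B₄.σ≈0 k)))) theta (∏odd⁺-f 1))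
    where
    y≈ : ∀ k → X (2 ℕ.+ 4 ℕ.* k) ≈ X 2 * B₄.P k
    y≈ k = X-+ 2 (4 ℕ.* k)
    D-C : ∀ k → (1# + X (2 ℕ.+ 4 ℕ.* k)) * (1# + X (2 ℕ.+ 4 ℕ.* k)) ≈ PF-C.D k
    D-C k = lin 4 (λ x z y P → # 2 :+ y :+ x :* P ·[ y := x :* P ] ∷ :- (P :* P) ·[ z := x :* x ] ∷ [] ⊢
      (# 1 :+ y) :* (# 1 :+ y) := # 1 :- (:- (# 2 :* x)) :* P :+ z :* (P :* P)) (y≈ k) (X-+ 2 2)
    unit : ∀ k → Unit (PF-C.D k)
    unit k = ≈[]-resp (D-C k) refl (Unit-* (Unit-1+X _) (Unit-1+X _))
    lim : Lim (∏ PF-C.D) (∏odd⁺ 1 * ∏odd⁺ 1)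
    lim = Lim-cong (λ n → trans (sym (∏-* _ _ n)) (∏-cong (λ k → trans (*-cong (e k) (e k)) (D-C k)) n)) (Lim-* (∏odd⁺-lim 1) (∏odd⁺-lim 1))
      where
      exponent : ∀ k → 2 ℕ.* suc (2 ℕ.* k) ≡ 2 ℕ.+ 4 ℕ.* k
      exponent = solve-∀
      e : ∀ k → 1# + X (2 ℕ.* suc (2 ℕ.* k)) ≈ 1# + X (2 ℕ.+ 4 ℕ.* k)
      e k = +-cong refl (X-≡ (exponent k))
    theta : ∏odd⁺ 1 * ∏odd⁺ 1 * Sum PF-C.term ≈ f 4 * f 4
    theta = PF-C.theta-sum unit lim
    term : ∀ m → C₊ 0 m + C₋ 0 (suc m) ≈ X 1 * PF-C.term m
    term m = lin 11 (λ t x x₁ y y′ q s p P u v →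
      :- (t :* x₁ :* u) ·[ y′ := y ] ∷
      t :* u :* (# 1 :- y) ·[ x₁ := q :* x ] ∷
      q :* s :* v ·[ p :* (P :* P) := y :* y ] ∷
      :- (q :* s) ·[ (# 1 :- y :* y) :* v := (# 1 :- y) :* u ] ∷
      :- (q :* (# 1 :- y) :* u) ·[ s := t :* x ] ∷ [] ⊢
      t :* (x₁ :* u) :+ (:- (y′ :* t)) :* (x₁ :* u) := q :* (s :* ((# 1 :- p :* (P :* P)) :* v)))
      (X-≡ (exponent₁ m)) (X-+ 1 (b m)) pPP
      (reduce (D-C m) (unit m) (trans (*-cong (+-cong refl (X-≡ (exponent₂ m))) refl) (*-inv (Unit-1+X _))))
      (σ₄≈ m)
      where
      exponent₁ : ∀ m → b (a m) ≡ 2 ℕ.+ 4 ℕ.* m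
      exponent₁ m rewrite b≡ (b m) | b≡ m = lemma m
        where
        lemma : ∀ m → suc (suc (2 ℕ.* (2 ℕ.* m))) ≡ 2 ℕ.+ 4 ℕ.* m
        lemma = solve-∀
      exponent₂ : ∀ m → 2 ℕ.+ 4 ℕ.* m ≡ suc (b m) ℕ.+ suc (b m)
      exponent₂ m rewrite b≡ m = lemma m
        where
        lemma : ∀ m → 2 ℕ.+ 4 ℕ.* m ≡ suc (2 ℕ.* m) ℕ.+ suc (2 ℕ.* m)
        lemma = solve-∀
      pPP : B₄.p * (B₄.P m * B₄.P m) ≈ X (2 ℕ.+ 4 ℕ.* m) * X (2 ℕ.+ 4 ℕ.* m)
      pPP = lin 4 (λ x z y P → :- (y :+ x :* P) ·[ y := x :* P ] ∷ P :* P ·[ z := x :* x ] ∷ [] ⊢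
        z :* (P :* P) := y :* y) (y≈ m) (X-+ 2 2)

  module PF-H = B₂.PF₁ 0#

  -- Here h(e) - h(-e) = (1 - q^(2e))/(1 + q^(2e)) at e = 2k+1, the partial fraction term for s = 0
  -- in the base q².
  H-f : f 4 ^ 2 * H 0 ≈ f 2 ^ 3 * f 8
  H-f = lin 6 (λ f₂ f₄ f₈ H T O →
    f₄ :^ 2 ·[ H := T ] ∷ f₂ :* f₈ ·[ O :* T := f₂ :* f₂ ] ∷ :- T ·[ O :* (f₂ :* f₈) := f₄ :* f₄ ] ∷ [] ⊢
    f₄ :^ 2 :* H := f₂ :^ 3 :* f₈)
    (Sum-cong term) (PF-H.theta-sum unit lim) (∏odd⁺-f 1)
    where
    pPP : ∀ k → B₂.p * (B₂.P k * B₂.P k) ≈ X (2 ℕ.+ 4 ℕ.* k)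
    pPP k = trans (*-cong refl (sym (X-+ (2 ℕ.* k) (2 ℕ.* k)))) (trans (sym (X-+ 2 _)) (X-≡ (exponent k)))
      where
      exponent : ∀ k → 2 ℕ.+ (2 ℕ.* k ℕ.+ 2 ℕ.* k) ≡ 2 ℕ.+ 4 ℕ.* k
      exponent = solve-∀
    D-H : ∀ k → 1# + X (2 ℕ.+ 4 ℕ.* k) ≈ PF-H.D k
    D-H k = lin 3 (λ p P y → :- # 1 ·[ p :* (P :* P) := y ] ∷ [] ⊢ # 1 :+ y := # 1 :- # 0 :* P :+ p :* (P :* P)) (pPP k)
    unit : ∀ k → Unit (PF-H.D k)
    unit k = ≈[]-resp (D-H k) refl (Unit-1+X _)
    lim : Lim (∏ PF-H.D) (∏odd⁺ 1)
    lim = Lim-cong (λ n → ∏-cong (λ k → trans (+-cong refl (X-≡ (exponent k))) (D-H k)) n) (∏odd⁺-lim 1)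
      where
      exponent : ∀ k → 2 ℕ.* suc (2 ℕ.* k) ≡ 2 ℕ.+ 4 ℕ.* k
      exponent = solve-∀
    term : ∀ k → s k * (h (a k) (b 0) - h 0 (a k ℕ.+ b 0)) ≈ PF-H.term k
    term k = lin 8 (λ s u h₀ y y′ v p P →
      :- s ·[ h₀ := y′ :* u ] ∷ :- (s :* u) ·[ y′ := y ] ∷ s :* (# 1 :- y) ·[ u := v ] ∷ s :* v ·[ p :* (P :* P) := y ] ∷ [] ⊢
      s :* (u :- h₀) := s :* ((# 1 :- p :* (P :* P)) :* v))
      (reflexive (cong (h 0) (ℕP.+-identityʳ (a k)))) y≈ (inv-cong (Unit-1+X _) (trans (+-cong refl y≈) (D-H k))) (pPP k)
      where
      y≈ : X (a k ℕ.+ a k) ≈ X (2 ℕ.+ 4 ℕ.* k)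
      y≈ = X-≡ (exponent k)
        where
        exponent : ∀ k → a k ℕ.+ a k ≡ 2 ℕ.+ 4 ℕ.* k
        exponent k rewrite b≡ k = lemma k
          where
          lemma : ∀ k → suc (2 ℕ.* k) ℕ.+ suc (2 ℕ.* k) ≡ 2 ℕ.+ 4 ℕ.* k
          lemma = solve-∀

  t : ℕ → Ser
  t n = (1# - X (n ℕ.+ n)) * inv (1# + X (n ℕ.+ n))

  -- The weight of the t-part of the partial fraction identity after folding m and -m; it vanishes
  -- at m = 0 because t(0) = 0.
  θ : ℕ → Ser
  θ zero    = 0#
  θ (suc m) = κ (+ 2) * t (b (suc m))

  private
    Γ : ℕ → ℕ → Ser
    Γ k zero    = C₊ k 0
    Γ k (suc m) = C₋ k (suc m) + C₊ k (suc m)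

    Summable-Γ : ∀ k → Summable (Γ k)
    Summable-Γ k zero    = ≈[0]
    Summable-Γ k (suc m) = +-zero[] (*-zeroˡ[] (τ≈0 (suc m))) (*-zeroˡ[] (τ≈0 (suc m)))

    Sum-Γ : ∀ k → Sum (Γ k) ≈ C k
    Sum-Γ k = trans (Sum-head (Summable-Γ k)) (lin 6 (λ p M S₊ S₋ C P →
      # 1 ·[ M := S₋ :+ S₊ ] ∷ :- # 1 ·[ C := P :+ S₋ ] ∷ :- # 1 ·[ P := p :+ S₊ ] ∷ [] ⊢ p :+ M := C)
      (Sum-+ (C₋ k ∘ suc) (C₊ k ∘ suc)) (Sum-+ (C₊ k) (C₋ k ∘ suc)) (Sum-head λ m → *-zeroˡ[] (τ≈0 m)))

    K≈ : ∀ k → K k ≈ (1# + X (a k)) * inv (1# - X (a k))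
    K≈ k = *-cong (+-cong refl X≈) (inv-cong (Unit-1-X _) (-‿cong₂ refl X≈))
      where
      X≈ : X (1 ℕ.+ 2 ℕ.* k) ≈ X (a k)
      X≈ = X-≡ (cong suc (≡.sym (b≡ k)))

    δh δc : ℕ → ℕ → Ser
    δh k m = h (a k) (b m) - h 0 (a k ℕ.+ b m)
    δc k m = c (a k) (b m) - c 0 (a k ℕ.+ b m)

    product-term : ∀ k m → (s k * K k) * (τ m * γ m) ≈
      (s k * K k) * (κ (+ 2) * Γ k m) + ((τ m * γ m) * (s k * δh k m) + (- (τ m * θ m)) * (s k * δc k m))
    product-term k zero = lin 8 (λ s K c₀ h₀ c₁ h₁ h₂ d →
      s ·[ K := # 2 :* (K :* c₀) :+ (h₂ :- h₀) ] ∷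
      :- (# 2 :* s :* K) ·[ c₁ := c₀ ] ∷
      s ·[ h₁ := h₀ ] ∷ [] ⊢
      (s :* K) :* (# 1 :* # 1) := (s :* K) :* (# 2 :* (# 1 :* c₁)) :+ ((# 1 :* # 1) :* (s :* (h₂ :- h₁)) :+ (:- (# 1 :* # 0)) :* (s :* d)))
      (trans (K≈ k) (trans (Lambert-product₀ (b k)) (+-cong (*-cong refl (*-cong (sym (K≈ k)) refl)) refl)))
      (reflexive (cong (c 0) (ℕP.+-identityʳ (a k)))) (reflexive (cong (h 0) (ℕP.+-identityʳ (a k))))
    product-term k (suc m) = lin 8 (λ s K t T cb c c₀ δh →
      # 2 :* s :* t ·[ # 2 :* K :* cb := K :* (c :+ c₀) :+ # 2 :* cb :* δh :- T :* (c :- c₀) ] ∷ [] ⊢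
      (s :* K) :* (t :* (# 4 :* cb)) :=
      (s :* K) :* (# 2 :* (t :* c :+ t :* c₀)) :+ ((t :* (# 4 :* cb)) :* (s :* δh) :+ (:- (t :* (# 2 :* T))) :* (s :* (c :- c₀))))
      (trans (*-cong (*-cong refl (K≈ k)) refl) (trans (Lambert-product (b k) (suc (b m)) (a≢b k (suc m)))
        (-‿cong₂ (+-cong (*-cong (sym (K≈ k)) refl) refl) refl)))

  Summable-sK : Summable (λ k → s k * K k)
  Summable-sK k = *-zeroˡ[] (B₂.σ≈0 k)

  -- The three parts of `product-term` are summed in different orders: the part with K(a) over m
  -- first, where `C-power` turns the series of ψ(q)² into that of f₂ω; the other two over k first,
  -- giving H m and K′ m.
  ψ²P₂ : ψ 1 * ψ 1 * P₂ ≈ κ (+ 2) * (C 0 * (f 2 * ⟪ D.ω ⟫)) + (Sum (λ m → (τ m * γ m) * H m) + Sum (λ m → (- (τ m * θ m)) * K′ m))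
  ψ²P₂ = begin
    ψ 1 * ψ 1 * P₂
      ≈⟨ trans (*-cong ψ₁² refl) (trans (*-comm _ _) (Sum-*ˡ P₂ Summable-sK)) ⟩
    Sum (λ k → P₂ * (s k * K k))
      ≈⟨ Sum-cong (λ k → trans (*-comm _ _) (trans (Sum-*ˡ (s k * K k) λ m → *-zeroˡ[] (τ≈0 m)) (Sum-cong (product-term k)))) ⟩
    Sum (λ k → Sum (λ m → A k m + (B k m + E k m)))
      ≈⟨ Sum-cong (λ k → trans (Sum-+ (A k) _) (+-cong refl (Sum-+ (B k) (E k)))) ⟩
    Sum (λ k → Sum (A k) + (Sum (B k) + Sum (E k)))
      ≈⟨ trans (Sum-+ (Sum ∘ A) _) (+-cong refl (Sum-+ (Sum ∘ B) (Sum ∘ E))) ⟩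
    Sum (Sum ∘ A) + (Sum (Sum ∘ B) + Sum (Sum ∘ E))
      ≈⟨ +-cong A≈ (+-cong (trans (Sum-swap B) (Sum-cong λ m → sym (Sum-*ˡ (τ m * γ m) Summable-s)))
                           (trans (Sum-swap E) (Sum-cong λ m → sym (Sum-*ˡ (- (τ m * θ m)) Summable-s)))) ⟩
    κ (+ 2) * (C 0 * (f 2 * ⟪ D.ω ⟫)) + (Sum (λ m → (τ m * γ m) * H m) + Sum (λ m → (- (τ m * θ m)) * K′ m)) ∎
    where
    A B E : ℕ → ℕ → Ser
    A k m = (s k * K k) * (κ (+ 2) * Γ k m)
    B k m = (τ m * γ m) * (s k * δh k m)
    E k m = (- (τ m * θ m)) * (s k * δc k m)
    A-k : ∀ k → Sum (A k) ≈ (κ (+ 2) * C 0) * (s k * K k * B₂.Psq 1 k)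
    A-k k = trans (sym (Sum-*ˡ (s k * K k) λ m → *-zeroʳ[] (Summable-Γ k m)))
      (trans (*-cong refl (sym (Sum-*ˡ (κ (+ 2)) (Summable-Γ k))))
        (lin 5 (λ u G C P C₀ → # 2 :* u ·[ G := C ] ∷ # 2 :* u ·[ C := P :* C₀ ] ∷ [] ⊢ u :* (# 2 :* G) := (# 2 :* C₀) :* (u :* P))
          (Sum-Γ k) (C-power k)))
    A≈ : Sum (Sum ∘ A) ≈ κ (+ 2) * (C 0 * (f 2 * ⟪ D.ω ⟫))
    A≈ = trans (Sum-cong A-k) (trans (sym (Sum-*ˡ (κ (+ 2) * C 0) λ k → *-zeroʳ[] (B₂.Psq≈0 1 k)))
      (trans (*-cong refl (sym f₂ω)) (*-assoc _ _ _)))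

  module PFf = B₁.PF₀ (- κ (+ 2))

  D-f : ∀ k → (1# + B₁.P (suc k)) * (1# + B₁.P (suc k)) ≈ PFf.D (suc k)
  D-f k = lin 2 (λ P o → :- (P :* P) ·[ o := # 1 ] ∷ [] ⊢
    (# 1 :+ P) :* (# 1 :+ P) := # 1 :- (:- # 2) :* P :+ o :* (P :* P)) B₁.P-0

  Unit-Df : ∀ k → Unit (PFf.D (suc k))
  Unit-Df k = ≈[]-resp (D-f k) refl (Unit-* (Unit-1+X _) (Unit-1+X _))

  mockf≈ : ⟪ D.mockf ⟫ ≈ Sum (λ n → B₁.Psq 0 n * inv (∏ (PFf.D ∘ suc) n))
  mockf≈ = trans mockf-unfold (Sum-cong λ n → *-cong (X-≡ (exponent n)) (sym (inv-cong (Unit-∏ Unit-Df n)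
      (trans (∏² (λ k → sym (D-f k)) n) (trans (^-congˡ 2 (trans (∏-cong (λ k → +-cong refl (X-≡ (ℕP.*-suc 1 k))) n) (sym (poch⁺ 1 1 n)))) (sym (pow≈^ _ 2)))))))
    where
    exponent : ∀ n → n ℕ.* n ≡ 1 ℕ.* (n ℕ.* (n ℕ.+ 0))
    exponent = solve-∀

  private
    -- (-1)^j q^(12j²)
    μ : ℕ → Ser
    μ j = τ (b j) * η j

    μ-suc : ∀ j → μ (suc j) ≈ - (X (24 ℕ.* j ℕ.+ 12) * μ j)
    μ-suc j = lin 6 (λ x y z t η w → :- (t :* η) ·[ x :* y :* z := w ] ∷ [] ⊢
      (:- (x :* (:- (y :* t)))) :* (:- (z :* η)) := :- (w :* (t :* η)))
      (trans (*-cong (sym (X-+ (b (a (suc (b j)))) (b (a (b j))))) refl) (trans (sym (X-+ _ (a (b j) ℕ.+ a (suc (b j))))) (X-≡ (exponent j))))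
      where
      exponent : ∀ j → b (a (suc (b j))) ℕ.+ b (a (b j)) ℕ.+ (a (b j) ℕ.+ a (suc (b j))) ≡ 24 ℕ.* j ℕ.+ 12
      exponent j rewrite b≡ (b (b j)) | b≡ (b j) | b≡ j = lemma j
        where
        lemma : ∀ j → suc (suc (suc (suc (suc (suc (2 ℕ.* (2 ℕ.* (2 ℕ.* j)))))))) ℕ.+ suc (suc (2 ℕ.* (2 ℕ.* (2 ℕ.* j)))) ℕ.+
          (suc (2 ℕ.* (2 ℕ.* j)) ℕ.+ suc (suc (suc (2 ℕ.* (2 ℕ.* j))))) ≡ 24 ℕ.* j ℕ.+ 12
        lemma = solve-∀

    dil-σ₁ : ∀ j → dil (+ 1) 7 (B₁.σ j) * X (8 ℕ.* (j ℕ.* j)) ≈ μ j * X (4 ℕ.* j)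
    dil-σ₁ zero    = lin 2 (λ o x → x ·[ o := # 1 ] ∷ [] ⊢ o :* x := # 1 :* # 1 :* x) (dil-1 (+ 1) 7)
    dil-σ₁ (suc j) = trans (*-cong (trans (dil-neg _ _ _) (-‿cong (trans (dil-* _ _ _ _) (*-cong (dil-X₁ 7 _ (exponent₀ j)) refl)))) refl)
      (lin 10 (λ s x y Y m m′ z Z w v →
        :- s ·[ x :* Y := v :* y ] ∷ :- v ·[ s :* y := m :* z ] ∷ :- m ·[ v :* z := w :* Z ] ∷ :- Z ·[ m′ := :- (w :* m) ] ∷ [] ⊢
        (:- (x :* s)) :* Y := m′ :* Z)
       (trans (sym (X-+ (8 ℕ.* suc j) (8 ℕ.* (suc j ℕ.* suc j)))) (X-split (24 ℕ.* j ℕ.+ 16) (8 ℕ.* (j ℕ.* j)) (exponent₁ j)))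
       (dil-σ₁ j)
       (trans (sym (X-+ (24 ℕ.* j ℕ.+ 16) (4 ℕ.* j))) (X-split (24 ℕ.* j ℕ.+ 12) (4 ℕ.* suc j) (exponent₂ j)))
       (μ-suc j))
      where
      exponent₀ : ∀ j → 8 ℕ.* (1 ℕ.* suc j) ≡ 8 ℕ.* suc j
      exponent₀ = solve-∀
      exponent₁ : ∀ j → 8 ℕ.* suc j ℕ.+ 8 ℕ.* (suc j ℕ.* suc j) ≡ 24 ℕ.* j ℕ.+ 16 ℕ.+ 8 ℕ.* (j ℕ.* j)
      exponent₁ = solve-∀
      exponent₂ : ∀ j → 24 ℕ.* j ℕ.+ 16 ℕ.+ 4 ℕ.* j ≡ 24 ℕ.* j ℕ.+ 12 ℕ.+ 4 ℕ.* suc j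
      exponent₂ = solve-∀

    even-power : ∀ k → (ℤ.- (+ 1)) ℤ.^ (2 ℕ.* k) ≡ + 1
    even-power k = ≡.trans (≡.sym (ℤP.^-*-assoc (ℤ.- (+ 1)) 2 k)) (ℤP.^-zeroˡ k)

    dil-X-even : ∀ k {l} → 4 ℕ.* (2 ℕ.* k) ≡ l → dil (ℤ.- (+ 1)) 3 (X (2 ℕ.* k)) ≈ X l
    dil-X-even k ≡.refl = trans (dil-Xpow _ 3 (2 ℕ.* k)) (lin 2 (λ k x → x ·[ k := # 1 ] ∷ [] ⊢ k :* x := x) (κ-cong (even-power k)))

    dil-X-odd : ∀ k {l} → 4 ℕ.* (1 ℕ.+ 2 ℕ.* k) ≡ l → dil (ℤ.- (+ 1)) 3 (X (1 ℕ.+ 2 ℕ.* k)) ≈ - X l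
    dil-X-odd k ≡.refl = trans (dil-Xpow _ 3 (1 ℕ.+ 2 ℕ.* k)) (lin 2 (λ k x → x ·[ k := con (ℤ.- (+ 1)) ] ∷ [] ⊢ k :* x := :- x)
      (κ-cong (cong (ℤ.- (+ 1) ℤ.*_) (even-power k))))

    dil-σ₂ : ∀ j → dil (ℤ.- (+ 1)) 3 (B₂.σ j) * X (8 ℕ.* (j ℕ.* (j ℕ.+ 1))) ≈ μ j * X (12 ℕ.* j)
    dil-σ₂ zero    = lin 2 (λ o x → x ·[ o := # 1 ] ∷ [] ⊢ o :* x := # 1 :* # 1 :* x) (dil-1 _ 3)
    dil-σ₂ (suc j) = trans (*-cong (trans (dil-neg _ _ _) (-‿cong (trans (dil-* _ _ _ _) (*-cong (dil-X-even (suc j) (exponent₀ j)) refl)))) refl)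
      (lin 10 (λ s x y Y m m′ z Z w v →
        :- s ·[ x :* Y := v :* y ] ∷ :- v ·[ s :* y := m :* z ] ∷ :- m ·[ v :* z := w :* Z ] ∷ :- Z ·[ m′ := :- (w :* m) ] ∷ [] ⊢
        (:- (x :* s)) :* Y := m′ :* Z)
       (trans (sym (X-+ (8 ℕ.* suc j) (8 ℕ.* (suc j ℕ.* (suc j ℕ.+ 1))))) (X-split (24 ℕ.* j ℕ.+ 24) (8 ℕ.* (j ℕ.* (j ℕ.+ 1))) (exponent₁ j)))
       (dil-σ₂ j)
       (trans (sym (X-+ (24 ℕ.* j ℕ.+ 24) (12 ℕ.* j))) (X-split (24 ℕ.* j ℕ.+ 12) (12 ℕ.* suc j) (exponent₂ j)))
       (μ-suc j))
      where
      exponent₀ : ∀ j → 4 ℕ.* (2 ℕ.* suc j) ≡ 8 ℕ.* suc j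
      exponent₀ = solve-∀
      exponent₁ : ∀ j → 8 ℕ.* suc j ℕ.+ 8 ℕ.* (suc j ℕ.* (suc j ℕ.+ 1)) ≡ 24 ℕ.* j ℕ.+ 24 ℕ.+ 8 ℕ.* (j ℕ.* (j ℕ.+ 1))
      exponent₁ = solve-∀
      exponent₂ : ∀ j → 24 ℕ.* j ℕ.+ 24 ℕ.+ 12 ℕ.* j ≡ 24 ℕ.* j ℕ.+ 12 ℕ.+ 12 ℕ.* suc j
      exponent₂ = solve-∀

    split : ∀ T → Summable T → Sum T ≈ Sum (λ j → T (b j) + T (suc (b j)))
    split T h = trans (Sum-split₂ h) (Sum-cong λ j → +-cong
      (reflexive (cong T (≡.sym (b≡ j)))) (reflexive (cong T (≡.trans (ℕP.+-comm (2 ℕ.* j) 1) (cong suc (≡.sym (b≡ j)))))))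

  -- Only even m contribute, because H vanishes at odd arguments; the terms m = 2j form the
  -- Lambert-type series of f₁ f(q) at q⁸.
  mockf-part : Sum (λ m → (τ m * γ m) * H m) ≈ H 0 * (f 8 * dil (+ 1) 7 ⟪ D.mockf ⟫)
  mockf-part = begin
    Sum (λ m → (τ m * γ m) * H m)
      ≈⟨ split (λ m → (τ m * γ m) * H m) (λ m → *-zeroˡ[] (*-zeroˡ[] (τ≈0 m))) ⟩
    Sum (λ j → (τ (b j) * γ (b j)) * H (b j) + (τ (suc (b j)) * γ (suc (b j))) * H (suc (b j)))
      ≈⟨ Sum-cong term ⟩
    Sum (λ j → H 0 * dil (+ 1) 7 (PFf.term j * B₁.Psq 0 j))
      ≈⟨ Sum-*ˡ (H 0) (λ j → dil-≈0[] _ _ (summable j)) ⟨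
    H 0 * Sum (λ j → dil (+ 1) 7 (PFf.term j * B₁.Psq 0 j))
      ≈⟨ *-cong refl (dil-Sum _ _ summable) ⟨
    H 0 * dil (+ 1) 7 (Sum (λ j → PFf.term j * B₁.Psq 0 j))
      ≈⟨ *-cong refl (dil-≈ _ _ (trans (sym (PFf.mock-sum Unit-Df)) (*-cong refl (sym mockf≈)))) ⟩
    H 0 * dil (+ 1) 7 (f 1 * ⟪ D.mockf ⟫)
      ≈⟨ *-cong refl (trans (dil-* _ _ _ _) (*-cong (dil-f (+ 1) 7 0 ≡.refl) refl)) ⟩
    H 0 * (f 8 * dil (+ 1) 7 ⟪ D.mockf ⟫) ∎
    where
    summable : Summable (λ j → PFf.term j * B₁.Psq 0 j)
    summable j = *-zeroʳ[] (B₁.Psq≈0 0 j)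
    dil-Psq : ∀ j → dil (+ 1) 7 (B₁.Psq 0 j) ≈ X (8 ℕ.* (j ℕ.* j))
    dil-Psq j = dil-X₁ 7 _ (exponent j)
      where
      exponent : ∀ j → 8 ℕ.* (1 ℕ.* (j ℕ.* (j ℕ.+ 0))) ≡ 8 ℕ.* (j ℕ.* j)
      exponent = solve-∀
    even : ∀ j → τ (b j) * γ (b j) * η j ≈ dil (+ 1) 7 (PFf.term j * B₁.Psq 0 j)
    even zero    = sym (trans (dil-≈ _ _ (lin 1 (λ x → # 1 ·[ x := # 1 ] ∷ [] ⊢ # 1 :* # 1 :* x := # 1) X-0))
      (trans (dil-1 _ _) (lin 0 ([] ⊢ # 1 := # 1 :* # 1 :* # 1))))
    even (suc j) = sym (trans (dil-* _ _ _ _) (trans (*-cong (trans (dil-* _ _ _ _) (*-cong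
        (trans (dil-* _ _ _ _) (*-cong refl (dil-1+P j)))
        (trans (dil-* _ _ _ _) (*-cong (trans (dil-minus _ _ _ _) (-‿cong₂ (dil-κ _ _ _) (trans (dil-neg _ _ _) (-‿cong (dil-κ _ _ _))))) (dil-inv _ _ (Unit-Df j))))))
        (dil-Psq (suc j)))
      (lin 9 (λ s y P v u t η z Z →
        # 4 :* s :* y ·[ P :* v := u ] ∷ # 4 :* u ·[ s :* y := t :* η :* z ] ∷ # 4 :* t :* η :* u ·[ z := Z ] ∷ [] ⊢
        ((s :* P) :* ((# 2 :- (:- # 2)) :* v)) :* y := (t :* (# 4 :* (Z :* u))) :* η)
        inverse (dil-σ₁ (suc j)) (X-≡ (exponent₁ j)))))
      where
      exponent₁ : ∀ j → 4 ℕ.* suc j ≡ b (b (suc j))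
      exponent₁ j rewrite b≡ (b j) | b≡ j = lemma j
        where
        lemma : ∀ j → 4 ℕ.* suc j ≡ suc (suc (suc (suc (2 ℕ.* (2 ℕ.* j)))))
        lemma = solve-∀
      exponent₂ : ∀ j → 8 ℕ.* (1 ℕ.* suc j) ≡ b (b (suc j)) ℕ.+ b (b (suc j))
      exponent₂ j rewrite b≡ (b j) | b≡ j = lemma j
        where
        lemma : ∀ j → 8 ℕ.* (1 ℕ.* suc j) ≡ suc (suc (suc (suc (2 ℕ.* (2 ℕ.* j))))) ℕ.+ suc (suc (suc (suc (2 ℕ.* (2 ℕ.* j)))))
        lemma = solve-∀
      dil-1+P : ∀ j → dil (+ 1) 7 (1# + B₁.P (suc j)) ≈ 1# + X (b (b (suc j)) ℕ.+ b (b (suc j)))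
      dil-1+P j = trans (dil-hom-+ _ _ _ _) (+-cong (dil-1 _ _) (dil-X₁ 7 _ (exponent₂ j)))
      inverse : (1# + X (b (b (suc j)) ℕ.+ b (b (suc j)))) * inv (dil (+ 1) 7 (PFf.D (suc j))) ≈
        inv (1# + X (b (b (suc j)) ℕ.+ b (b (suc j))))
      inverse = reduce′ (trans (*-cong (sym (dil-1+P j)) (sym (dil-1+P j))) (trans (sym (dil-* _ _ _ _)) (dil-≈ _ _ (D-f j))))
        (dil-≈1[] _ _ (Unit-Df j)) (*-inv (Unit-1+X _))
    term : ∀ j → (τ (b j) * γ (b j)) * H (b j) + (τ (suc (b j)) * γ (suc (b j))) * H (suc (b j)) ≈
      H 0 * dil (+ 1) 7 (PFf.term j * B₁.Psq 0 j)
    term j = lin 8 (λ t g H H₀ η t′ H′ d →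
      t :* g ·[ H := η :* H₀ ] ∷ t′ ·[ H′ := # 0 ] ∷ H₀ ·[ t :* g :* η := d ] ∷ [] ⊢ (t :* g) :* H :+ t′ :* H′ := H₀ :* d)
      (H-even j) (H-odd j) (even j)

  -- Only odd m contribute. At m = 2j + 1 the factor (1 - q^(8j+4))/(1 + q^(8j+4)) is K_j with -q⁴
  -- in place of q, whence the sign in ω(-q⁴).
  ω-part : Sum (λ m → (- (τ m * θ m)) * K′ m) ≈ κ (+ 2) * (X 3 * (H 0 * (f 8 * dil (ℤ.- (+ 1)) 3 ⟪ D.ω ⟫)))
  ω-part = begin
    Sum (λ m → (- (τ m * θ m)) * K′ m)
      ≈⟨ split (λ m → (- (τ m * θ m)) * K′ m) (λ m → *-zeroˡ[] (-‿zero[] (*-zeroˡ[] (τ≈0 m)))) ⟩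
    Sum (λ j → (- (τ (b j) * θ (b j))) * K′ (b j) + (- (τ (suc (b j)) * θ (suc (b j)))) * K′ (suc (b j)))
      ≈⟨ Sum-cong term ⟩
    Sum (λ j → κ (+ 2) * (X 3 * H 0) * dil (ℤ.- (+ 1)) 3 (B₂.σ j * K j * B₂.Psq 1 j))
      ≈⟨ Sum-*ˡ (κ (+ 2) * (X 3 * H 0)) (λ j → dil-≈0[] _ _ (summable j)) ⟨
    κ (+ 2) * (X 3 * H 0) * Sum (λ j → dil (ℤ.- (+ 1)) 3 (B₂.σ j * K j * B₂.Psq 1 j))
      ≈⟨ *-cong refl (trans (sym (dil-Sum _ _ summable)) (dil-≈ _ _ (sym f₂ω))) ⟩
    κ (+ 2) * (X 3 * H 0) * dil (ℤ.- (+ 1)) 3 (f 2 * ⟪ D.ω ⟫)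
      ≈⟨ *-cong refl (trans (dil-* _ _ _ _) (*-cong (dil-f (ℤ.- (+ 1)) 3 1 ≡.refl) refl)) ⟩
    κ (+ 2) * (X 3 * H 0) * (f 8 * dil (ℤ.- (+ 1)) 3 ⟪ D.ω ⟫)
      ≈⟨ lin 4 (λ x h f w → [] ⊢ # 2 :* (x :* h) :* (f :* w) := # 2 :* (x :* (h :* (f :* w)))) ⟩
    κ (+ 2) * (X 3 * (H 0 * (f 8 * dil (ℤ.- (+ 1)) 3 ⟪ D.ω ⟫))) ∎
    where
    summable : Summable (λ j → B₂.σ j * K j * B₂.Psq 1 j)
    summable j = *-zeroʳ[] (B₂.Psq≈0 1 j)
    dil-Psq : ∀ j → dil (ℤ.- (+ 1)) 3 (B₂.Psq 1 j) ≈ X (8 ℕ.* (j ℕ.* (j ℕ.+ 1)))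
    dil-Psq j = dil-X-even (j ℕ.* (j ℕ.+ 1)) (exponent j)
      where
      exponent : ∀ j → 4 ℕ.* (2 ℕ.* (j ℕ.* (j ℕ.+ 1))) ≡ 8 ℕ.* (j ℕ.* (j ℕ.+ 1))
      exponent = solve-∀
    dil-K : ∀ j → dil (ℤ.- (+ 1)) 3 (K j) ≈ t (b (suc (b j)))
    dil-K j = trans (dil-* _ _ _ _) (*-cong
        (trans (dil-hom-+ _ _ _ _) (+-cong (dil-1 _ _) (dil-X-odd j (exponent j))))
        (trans (dil-inv _ _ (Unit-1-X _)) (sym (inv-cong (Unit-1+X _) (sym
          (trans (dil-minus _ _ _ _) (trans (-‿cong₂ (dil-1 _ _) (dil-X-odd j (exponent j))) (lin 1 (λ x → [] ⊢ # 1 :- (:- x) := # 1 :+ x)))))))))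
      where
      exponent : ∀ j → 4 ℕ.* (1 ℕ.+ 2 ℕ.* j) ≡ b (suc (b j)) ℕ.+ b (suc (b j))
      exponent j rewrite b≡ (b j) | b≡ j = lemma j
        where
        lemma : ∀ j → 4 ℕ.* (1 ℕ.+ 2 ℕ.* j) ≡ suc (suc (2 ℕ.* (2 ℕ.* j))) ℕ.+ suc (suc (2 ℕ.* (2 ℕ.* j)))
        lemma = solve-∀
    odd : ∀ j → dil (ℤ.- (+ 1)) 3 (B₂.σ j * K j * B₂.Psq 1 j) ≈ τ (b j) * η j * X (12 ℕ.* j) * t (b (suc (b j)))
    odd j = trans (dil-* _ _ _ _) (trans (*-cong (trans (dil-* _ _ _ _) (*-cong refl (dil-K j))) (dil-Psq j))
      (lin 6 (λ s y m η z t → t ·[ s :* y := m :* η :* z ] ∷ [] ⊢ s :* t :* y := m :* η :* z :* t) (dil-σ₂ j)))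
    term : ∀ j → (- (τ (b j) * θ (b j))) * K′ (b j) + (- (τ (suc (b j)) * θ (suc (b j)))) * K′ (suc (b j)) ≈
      κ (+ 2) * (X 3 * H 0) * dil (ℤ.- (+ 1)) 3 (B₂.σ j * K j * B₂.Psq 1 j)
    term j = lin 12 (λ u K₀ τ y T K₁ x η H z q d →
      :- u ·[ K₀ := # 0 ] ∷
      # 2 :* y :* τ :* T ·[ K₁ := x :* (η :* H) ] ∷
      # 2 :* τ :* T :* η :* H ·[ y :* x := q :* z ] ∷
      :- # 2 :* q :* H ·[ d := τ :* η :* z :* T ] ∷ [] ⊢
      (:- u) :* K₀ :+ (:- ((:- (y :* τ)) :* (# 2 :* T))) :* K₁ := # 2 :* (q :* H) :* d)
      (K′-even j) (K′-odd j)
      (trans (sym (X-+ (b (a (b j))) (a (b j)))) (X-split 3 (12 ℕ.* j) (exponent j))) (odd j)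
      where
      exponent : ∀ j → b (a (b j)) ℕ.+ a (b j) ≡ 3 ℕ.+ 12 ℕ.* j
      exponent j rewrite b≡ (b (b j)) | b≡ (b j) | b≡ j = lemma j
        where
        lemma : ∀ j → suc (suc (2 ℕ.* (2 ℕ.* (2 ℕ.* j)))) ℕ.+ suc (2 ℕ.* (2 ℕ.* j)) ≡ 3 ℕ.+ 12 ℕ.* j
        lemma = solve-∀

  mock-identity : (f 1 ^ 2 * f 8 ^ 4) * (dil (+ 1) 7 ⟪ D.mockf ⟫ + κ (+ 2) * (X 1 * ⟪ D.ω ⟫)
      + κ (+ 2) * (X 3 * dil (ℤ.- (+ 1)) 3 ⟪ D.ω ⟫)) ≈ f 2 * f 4 ^ 6
  -- f₂³ is cancelled because both f₂ · C 0 and f₈ · H 0 contain it, by their evaluations as eta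
  -- quotients.
  mock-identity = *-cancelˡ (Unit-^ 3 (Unit-f 1)) (lin 15 (λ f₁ f₂ f₄ f₈ ψ P C H q q³ F W O M N →
    let d = f₁ :^ 2 :* f₈ :^ 2 :* f₄ :^ 2 in
    :- (f₁ :^ 2 :* f₈ :^ 3 :* (F :+ # 2 :* q³ :* O)) ·[ f₄ :^ 2 :* H := f₂ :^ 3 :* f₈ ] ∷
    :- # 2 :* f₁ :^ 2 :* f₈ :^ 2 :* f₂ :* W ·[ f₄ :^ 2 :* C := q :* (f₂ :^ 2 :* f₈ :^ 2) ] ∷
    :- d ·[ M := H :* (f₈ :* F) ] ∷
    :- d ·[ N := # 2 :* (q³ :* (H :* (f₈ :* O))) ] ∷
    :- d ·[ ψ :* ψ :* P := # 2 :* (C :* (f₂ :* W)) :+ (M :+ N) ] ∷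
    f₁ :^ 2 :* f₄ :^ 2 :* ψ :* ψ ·[ f₈ :^ 2 :* P := f₄ :^ 4 ] ∷
    f₄ :^ 6 :* (ψ :* f₁ :+ f₂ :^ 2) ·[ ψ :* f₁ := f₂ :^ 2 ] ∷ [] ⊢
    f₂ :^ 3 :* ((f₁ :^ 2 :* f₈ :^ 4) :* (F :+ # 2 :* (q :* W) :+ # 2 :* (q³ :* O))) := f₂ :^ 3 :* (f₂ :* f₄ :^ 6))
    H-f C-f mockf-part ω-part ψ²P₂ P₂-f (ψ-f 0))

-- Dissection of 2qξ(q) modulo 4.

module Dissection where
  open Coefficients using (X^-⊛-+; X^-⊛-<; dil-4*; dil-<; dil-+)
  open MockIdentity public

  -- Allows f(q²⁴), obtained as f(q⁸) at q³, to be read as f(q⁶) at q⁴, and ω(-q¹²) as ω(-q³) at q⁴.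
  dil-dil : ∀ c {m m′ l l′} → suc m ℕ.* suc m′ ≡ suc l ℕ.* suc l′ → ∀ a →
    dil (+ 1) m (dil c m′ a) ≈ dil (+ 1) l (dil c l′ a)
  dil-dil c {m} {m′} {l} {l′} eq a = ≈[]⇒≈ λ n → go n a
    where
    unfold : ∀ m m′ a → dil (+ 1) m (dil c m′ a) ≈ κ (coeff a 0) + κ c * (X (suc m ℕ.* suc m′) * dil (+ 1) m (dil c m′ (tail a)))
    unfold m m′ a = trans (dil-≈ _ _ (dil-unfold c m′ a)) (trans (dil-hom-+ _ _ _ _) (+-cong (dil-κ _ _ _)
      (trans (dil-κ* _ _ _ _) (*-cong refl (trans (dil-* _ _ _ _) (*-cong (dil-X₁ m (suc m′) ≡.refl) refl))))))
    go : ∀ n a → dil (+ 1) m (dil c m′ a) ≈[ n ] dil (+ 1) l (dil c l′ a)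
    go zero    a = ≈[0]
    go (suc n) a = ≈[]-resp (sym (unfold m m′ a))
      (trans (+-cong refl (*-cong refl (*-cong (X-≡ eq) refl))) (sym (unfold l l′ a)))
      (+-cong[] ≈[]-refl (*-cong[] ≈[]-refl (≈[]-mono (s≤s (ℕP.m≤n+m n _)) (X*-cong[] (suc m ℕ.* suc m′) (go n (tail a))))))

  private
    T : Ser → Ser
    T = dil (+ 1) 3

    F Ω i : Ser
    F = dil (+ 1) 5 ⟪ D.mockf ⟫
    Ω = dil (ℤ.- (+ 1)) 2 ⟪ D.ω ⟫
    i = inv (f 3 ^ 2)

  -- The four classes of 2qξ = G₀(q⁴) + 2q G₁(q⁴) + 2q² G₂(q⁴) + 2q³ G₃(q⁴), in theta functions. The
  -- factor q shifts the classes: G₁, G₂, G₃ belong to 4n, 4n+1, 4n+2, and G₀ to 4n+3 with an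
  -- additional factor 2q.
  G₀ G₁ G₂ G₃ : Ser
  G₀ = φ 3 ^ 3 * i - F + κ (+ 4) * X 1 * (ψ 2 * φ 1 * ψ 6 * i)
  G₁ = κ (+ 4) * X 2 * (ψ 6 ^ 3 * i) - X 2 * Ω + φ 1 * φ 3 * ψ 2 * i
  G₂ = κ (+ 2) * X 1 * (ψ 6 ^ 2 * φ 3 * i) + κ (+ 2) * (ψ 2 ^ 2 * φ 3 * i)
  G₃ = ψ 6 * φ 3 ^ 2 * i + φ 1 ^ 2 * ψ 6 * i

  private
    dil-f₄ : ∀ β → T (f (suc β)) ≈ f (suc β ℕ.* 4)
    dil-f₄ β = dil-f (+ 1) 3 β (ℤP.^-zeroˡ (suc β))

    dil-f^ : ∀ β k {n} → suc β ℕ.* 4 ≡ n → T (f (suc β) ^ k) ≈ f n ^ k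
    dil-f^ β k ≡.refl = trans (dil-^ _ _ _ k) (^-congˡ k (dil-f₄ β))

    dil-φ : ∀ β → T (φ (suc β)) ≈ φ (suc β ℕ.* 4)
    dil-φ β = trans (dil-* _ _ _ _) (*-cong (dil-f^ (pred (2 ℕ.* suc β)) 5 (ℕP.*-assoc 2 (suc β) 4))
      (trans (dil-inv _ _ (Unit-φ-denominator β)) (inv-cong (dil-≈1[] _ _ (Unit-φ-denominator β))
        (trans (dil-* _ _ _ _) (*-cong (dil-f^ β 2 ≡.refl) (dil-f^ (pred (4 ℕ.* suc β)) 2 (ℕP.*-assoc 4 (suc β) 4)))))))

    dil-ψ : ∀ β → T (ψ (suc β)) ≈ ψ (suc β ℕ.* 4)
    dil-ψ β = trans (dil-* _ _ _ _) (*-cong (dil-f^ (pred (2 ℕ.* suc β)) 2 (ℕP.*-assoc 2 (suc β) 4))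
      (trans (dil-inv _ _ (Unit-f β)) (inv-cong (dil-≈1[] _ _ (Unit-f β)) (dil-f₄ β))))

    mock-identity₃ : (f 3 ^ 2 * f 24 ^ 4) * (T F + κ (+ 2) * (X 3 * dil (+ 1) 2 ⟪ D.ω ⟫) + κ (+ 2) * (X 9 * T Ω)) ≈ f 6 * f 12 ^ 6
    mock-identity₃ = trans (sym (trans (d* _ _) (*-cong (trans (d* _ _) (*-cong (f^ 0 2 ≡.refl) (f^ 7 4 ≡.refl)))
        (trans (d+ _ _) (+-cong (trans (d+ _ _) (+-cong (dil-dil (+ 1) ≡.refl _) (trans (dil-κ* _ _ _ _) (*-cong refl (trans (d* _ _) (*-cong (dil-X₁ 2 1 ≡.refl) refl))))))
          (trans (dil-κ* _ _ _ _) (*-cong refl (trans (d* _ _) (*-cong (dil-X₁ 2 3 ≡.refl) (dil-dil _ ≡.refl _))))))))))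
      (trans (dil-≈ _ _ mock-identity) (trans (d* _ _) (*-cong (dil-f (+ 1) 2 1 ≡.refl) (f^ 3 6 ≡.refl))))
      where
      d* = dil-* (+ 1) 2
      d+ = dil-hom-+ (+ 1) 2
      f^ : ∀ β k → (+ 1) ℤ.^ suc β ≡ + 1 → dil (+ 1) 2 (f (suc β) ^ k) ≈ f (suc β ℕ.* 3) ^ k
      f^ β k eq = trans (dil-^ _ _ _ k) (^-congˡ k (dil-f (+ 1) 2 β eq))

    -- The factor f₁₂² turns the eta quotient f₆f₁₂⁶/(f₃²f₂₄⁴) into φ(q³)φ(q⁶)². As a series in q⁴
    -- it does not mix the residue classes modulo 4.
    ω-theta : f 12 ^ 2 * (κ (+ 2) * (X 3 * dil (+ 1) 2 ⟪ D.ω ⟫)) ≈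
      φ 3 * φ 6 ^ 2 - f 12 ^ 2 * T F - f 12 ^ 2 * (κ (+ 2) * (X 9 * T Ω))
    ω-theta = *-cancelˡ (Unit-* (Unit-* (Unit-^ 2 (Unit-f 2)) (Unit-^ 4 (Unit-f 23))) (Unit-* (Unit-^ 4 (Unit-f 5)) (Unit-^ 2 (Unit-f 11))))
      (lin 9 (λ f₃ f₆ f₁₂ f₂₄ F W O φ₃ φ₆ →
        f₆ :^ 4 :* f₁₂ :^ 4 ·[ (f₃ :^ 2 :* f₂₄ :^ 4) :* (F :+ W :+ O) := f₆ :* f₁₂ :^ 6 ] ∷
        :- (f₆ :^ 4 :* f₂₄ :^ 4 :* φ₆ :^ 2) ·[ φ₃ :* (f₃ :^ 2 :* f₁₂ :^ 2) := f₆ :^ 5 ] ∷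
        :- (f₆ :^ 5 :* (φ₆ :* f₆ :^ 2 :* f₂₄ :^ 2 :+ f₁₂ :^ 5)) ·[ φ₆ :* (f₆ :^ 2 :* f₂₄ :^ 2) := f₁₂ :^ 5 ] ∷ [] ⊢
        ((f₃ :^ 2 :* f₂₄ :^ 4) :* (f₆ :^ 4 :* f₁₂ :^ 2)) :* (f₁₂ :^ 2 :* W) :=
        ((f₃ :^ 2 :* f₂₄ :^ 4) :* (f₆ :^ 4 :* f₁₂ :^ 2)) :* (φ₃ :* φ₆ :^ 2 :- f₁₂ :^ 2 :* F :- f₁₂ :^ 2 :* O))
      mock-identity₃ (φ-f 2) (φ-f 5))

    -- Since f₁₂²/f₆ = ψ(q⁶) and ψ(q)² = φ(q)ψ(q²), the remaining term of `ξ-ω` becomes the theta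
    -- product 2qφ(q)ψ(q²)ψ(q⁶).
    ξ-theta : f 12 ^ 2 * (κ (+ 2) * (X 1 * ⟪ D.ξ ⟫)) ≈
      φ 3 * φ 6 ^ 2 - f 12 ^ 2 * T F - f 12 ^ 2 * (κ (+ 2) * (X 9 * T Ω)) + κ (+ 2) * (X 1 * (φ 1 * (ψ 2 * ψ 6)))
    ξ-theta = *-cancelˡ (Unit-f 5) (lin 12 (λ f₆ f₁₂ q q² q³ ξ w ψ₁ ψ₂ ψ₆ φ₁ R →
        # 2 :* q :* f₁₂ :^ 2 ·[ f₆ :* ξ := q² :* (f₆ :* w) :+ ψ₁ :* ψ₁ ] ∷
        # 2 :* q :* f₁₂ :^ 2 ·[ ψ₁ :* ψ₁ := φ₁ :* ψ₂ ] ∷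
        :- (# 2 :* q :* φ₁ :* ψ₂) ·[ ψ₆ :* f₆ := f₁₂ :^ 2 ] ∷
        :- (# 2 :* f₁₂ :^ 2 :* f₆ :* w) ·[ q³ := q :* q² ] ∷
        f₆ ·[ f₁₂ :^ 2 :* (# 2 :* (q³ :* w)) := R ] ∷ [] ⊢
        f₆ :* (f₁₂ :^ 2 :* (# 2 :* (q :* ξ))) := f₆ :* (R :+ # 2 :* (q :* (φ₁ :* (ψ₂ :* ψ₆)))))
      ξ-ω (ψ² 0 ≡.refl) (ψ-f 5) (X-+ 1 2) ω-theta)

    q : Ser
    q = X 1

    X^ : ∀ m → X m ≈ q ^ m
    X^ m = trans (X-≡ (≡.sym (ℕP.*-identityʳ m))) (X-* m 1)

    j : Ser
    j = inv (f 12 ^ 2)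

    d* : ∀ {a b a′ b′} → T a ≈ a′ → T b ≈ b′ → T (a * b) ≈ a′ * b′
    d* p q = trans (dil-* _ _ _ _) (*-cong p q)

    d+ : ∀ {a b a′ b′} → T a ≈ a′ → T b ≈ b′ → T (a + b) ≈ a′ + b′
    d+ p q = trans (dil-hom-+ _ _ _ _) (+-cong p q)

    d- : ∀ {a b a′ b′} → T a ≈ a′ → T b ≈ b′ → T (a - b) ≈ a′ - b′
    d- p q = trans (dil-minus _ _ _ _) (-‿cong₂ p q)

    d^ : ∀ {a a′} k → T a ≈ a′ → T (a ^ k) ≈ a′ ^ k
    d^ k p = trans (dil-^ _ _ _ k) (^-congˡ k p)

    dκ : ∀ z → T (κ z) ≈ κ z
    dκ z = dil-κ _ _ z

    dX : ∀ m → T (X m) ≈ q ^ (4 ℕ.* m)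
    dX m = trans (dil-X₁ 3 m ≡.refl) (X^ (4 ℕ.* m))

    di : T i ≈ j
    di = trans (dil-inv _ _ (Unit-^ 2 (Unit-f 2))) (inv-cong (dil-≈1[] _ _ (Unit-^ 2 (Unit-f 2))) (dil-f^ 2 2 ≡.refl))

    dG₀ : T G₀ ≈ φ 12 ^ 3 * j - T F + κ (+ 4) * q ^ 4 * (ψ 8 * φ 4 * ψ 24 * j)
    dG₀ = d+ (d- (d* (d^ 3 (dil-φ 2)) di) refl) (d* (d* (dκ _) (dX 1)) (d* (d* (d* (dil-ψ 1) (dil-φ 0)) (dil-ψ 5)) di))

    dG₁ : T G₁ ≈ κ (+ 4) * q ^ 8 * (ψ 24 ^ 3 * j) - q ^ 8 * T Ω + φ 4 * φ 12 * ψ 8 * j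
    dG₁ = d+ (d- (d* (d* (dκ _) (dX 2)) (d* (d^ 3 (dil-ψ 5)) di)) (d* (dX 2) refl)) (d* (d* (d* (dil-φ 0) (dil-φ 2)) (dil-ψ 1)) di)

    dG₂ : T G₂ ≈ κ (+ 2) * q ^ 4 * (ψ 24 ^ 2 * φ 12 * j) + κ (+ 2) * (ψ 8 ^ 2 * φ 12 * j)
    dG₂ = d+ (d* (d* (dκ _) (dX 1)) (d* (d* (d^ 2 (dil-ψ 5)) (dil-φ 2)) di)) (d* (dκ _) (d* (d* (d^ 2 (dil-ψ 1)) (dil-φ 2)) di))

    dG₃ : T G₃ ≈ ψ 24 * φ 12 ^ 2 * j + φ 4 ^ 2 * ψ 24 * j
    dG₃ = d+ (d* (d* (dil-ψ 5) (d^ 2 (dil-φ 2))) di) (d* (d* (d^ 2 (dil-φ 0)) (dil-ψ 5)) di)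

    cubic : φ 3 * φ 6 ^ 2 ≈ (φ 12 + κ (+ 2) * (q ^ 3 * ψ 24)) * (φ 12 ^ 2 + κ (+ 4) * (q ^ 6 * ψ 24 ^ 2))
    cubic = lin 7 (λ φ₃ φ₆ φ₁₂ ψ₂₄ q x₃ x₆ →
      φ₆ :^ 2 ·[ φ₃ := φ₁₂ :+ # 2 :* (x₃ :* ψ₂₄) ] ∷
      # 2 :* ψ₂₄ :* φ₆ :^ 2 ·[ x₃ := q :^ 3 ] ∷
      φ₁₂ :+ # 2 :* (q :^ 3 :* ψ₂₄) ·[ φ₆ :* φ₆ := φ₁₂ :* φ₁₂ :+ # 4 :* (x₆ :* (ψ₂₄ :* ψ₂₄)) ] ∷
      (φ₁₂ :+ # 2 :* (q :^ 3 :* ψ₂₄)) :* # 4 :* ψ₂₄ :* ψ₂₄ ·[ x₆ := q :^ 6 ] ∷ [] ⊢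
      φ₃ :* φ₆ :^ 2 := (φ₁₂ :+ # 2 :* (q :^ 3 :* ψ₂₄)) :* (φ₁₂ :^ 2 :+ # 4 :* (q :^ 6 :* ψ₂₄ :^ 2)))
      (φ-dissection 2 ≡.refl ≡.refl) (X^ 3) (φ² 5 ≡.refl ≡.refl) (X^ 6)

    -- The product ψ(q²)ψ(q⁶) is the identity for ψ(q)ψ(q³) at q², which leaves only functions of q⁴
    -- and explicit powers of q.
    quadratic : φ 1 * (ψ 2 * ψ 6) ≈ (φ 4 + κ (+ 2) * (q * ψ 8)) * (φ 12 * ψ 8 + q ^ 2 * (φ 4 * ψ 24))
    quadratic = *-cong (φ-dissection 0 ≡.refl ≡.refl) (trans (ψψ₃ 1) (+-cong refl (*-cong (X^ 2) refl)))

  ξ-dissection : κ (+ 2) * (X 1 * ⟪ D.ξ ⟫) ≈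
    T G₀ + X 1 * (κ (+ 2) * T G₁) + X 2 * (κ (+ 2) * T G₂) + X 3 * (κ (+ 2) * T G₃)
  ξ-dissection = trans ξ≈T (+-cong (+-cong
      (+-cong (sym dG₀) (*-cong refl (*-cong refl (sym dG₁))))
      (*-cong (sym (X^ 2)) (*-cong refl (sym dG₂)))) (*-cong (sym (X^ 3)) (*-cong refl (sym dG₃))))
    where
    ξ≈T : κ (+ 2) * (X 1 * ⟪ D.ξ ⟫) ≈
      (φ 12 ^ 3 * j - T F + κ (+ 4) * q ^ 4 * (ψ 8 * φ 4 * ψ 24 * j)) +
      q * (κ (+ 2) * (κ (+ 4) * q ^ 8 * (ψ 24 ^ 3 * j) - q ^ 8 * T Ω + φ 4 * φ 12 * ψ 8 * j)) +
      q ^ 2 * (κ (+ 2) * (κ (+ 2) * q ^ 4 * (ψ 24 ^ 2 * φ 12 * j) + κ (+ 2) * (ψ 8 ^ 2 * φ 12 * j))) +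
      q ^ 3 * (κ (+ 2) * (ψ 24 * φ 12 ^ 2 * j + φ 4 ^ 2 * ψ 24 * j))
    ξ≈T = *-cancelˡ (Unit-^ 2 (Unit-f 11)) (lin 13 (λ f j q Z x₉ F O φ₄ φ₁₂ ψ₈ ψ₂₄ U V →
      let U′ = (φ₁₂ :+ # 2 :* (q :^ 3 :* ψ₂₄)) :* (φ₁₂ :^ 2 :+ # 4 :* (q :^ 6 :* ψ₂₄ :^ 2))
          V′ = (φ₄ :+ # 2 :* (q :* ψ₈)) :* (φ₁₂ :* ψ₈ :+ q :^ 2 :* (φ₄ :* ψ₂₄))
      in
      # 1 ·[ f :^ 2 :* Z := U :- f :^ 2 :* F :- f :^ 2 :* (# 2 :* (x₉ :* O)) :+ # 2 :* (q :* V) ] ∷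
      :- # 2 :* f :^ 2 :* O ·[ x₉ := q :^ 9 ] ∷
      # 1 ·[ U := U′ ] ∷
      # 2 :* q ·[ V := V′ ] ∷
      :- (U′ :+ # 2 :* q :* V′) ·[ f :^ 2 :* j := # 1 ] ∷ [] ⊢
      f :^ 2 :* Z := f :^ 2 :* (
        (φ₁₂ :^ 3 :* j :- F :+ # 4 :* q :^ 4 :* (ψ₈ :* φ₄ :* ψ₂₄ :* j)) :+
        q :* (# 2 :* (# 4 :* q :^ 8 :* (ψ₂₄ :^ 3 :* j) :- q :^ 8 :* O :+ φ₄ :* φ₁₂ :* ψ₈ :* j)) :+
        q :^ 2 :* (# 2 :* (# 2 :* q :^ 4 :* (ψ₂₄ :^ 2 :* φ₁₂ :* j) :+ # 2 :* (ψ₈ :^ 2 :* φ₁₂ :* j))) :+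
        q :^ 3 :* (# 2 :* (ψ₂₄ :* φ₁₂ :^ 2 :* j :+ φ₄ :^ 2 :* ψ₂₄ :* j))))
      ξ-theta (X^ 9) cubic quadratic (*-inv (Unit-^ 2 (Unit-f 11))))

  -- Translating the eta quotients of the statement into ring elements.

  infixl 6 _⊕ᵉ_ _⊖ᵉ_
  infixl 7 _⊛ᵉ_ _⊘ᵉ_ _⊛ᵈ_
  infix 8 _^ᵉ_ _^ᵈ_
  infix 20 _·ᵉ_

  -- The shapes that occur as denominators; constant term 1 follows by induction, so every division
  -- in the statement is a genuine inverse.
  data FProduct : D.PS → Ser → Set where
    fᵈ   : ∀ k .{{_ : ℕ.NonZero k}} → FProduct (D.fq k) (f k)
    _^ᵈ_ : ∀ {a x} → FProduct a x → ∀ k → FProduct (D.pow a k) (x ^ k)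
    _⊛ᵈ_ : ∀ {a b x y} → FProduct a x → FProduct b y → FProduct (a D.⊛ b) (x * y)

  -- A coefficient function together with the element of Ser that it denotes. Both are indices, so that
  -- the coefficient function is the literal right-hand side of the theorem and is never unfolded.
  data Denotes : D.PS → Ser → Set where
    fᵉ   : ∀ k → Denotes (D.fq k) (f k)
    Xᵉ   : ∀ k → Denotes (D.X^ k) (X k)
    atom : ∀ a → Denotes a ⟪ a ⟫
    _·ᵉ_ : ∀ {a x} z → Denotes a x → Denotes (z D.· a) (κ z * x)
    _^ᵉ_ : ∀ {a x} → Denotes a x → ∀ k → Denotes (D.pow a k) (x ^ k)
    _⊕ᵉ_ : ∀ {a b x y} → Denotes a x → Denotes b y → Denotes (a D.⊕ b) (x + y)
    _⊖ᵉ_ : ∀ {a b x y} → Denotes a x → Denotes b y → Denotes (a D.⊖ b) (x - y)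
    _⊛ᵉ_ : ∀ {a b x y} → Denotes a x → Denotes b y → Denotes (a D.⊛ b) (x * y)
    _⊘ᵉ_ : ∀ {a b x y} → Denotes a x → FProduct b y → Denotes (a D.⊘ b) (x * inv y)

  Unit-FProduct : ∀ {a x} → FProduct a x → Unit x
  Unit-FProduct (fᵈ (suc β)) = Unit-f β
  Unit-FProduct (d ^ᵈ k) = Unit-^ k (Unit-FProduct d)
  Unit-FProduct (d ⊛ᵈ e) = Unit-* (Unit-FProduct d) (Unit-FProduct e)

  opaque
    unfolding Ser f

    ⟪f⟫ : ∀ k → ⟪ D.fq k ⟫ ≈ f k
    ⟪f⟫ k _ = ≡.refl

    ⟪X⟫ : ∀ k → ⟪ D.X^ k ⟫ ≈ X k
    ⟪X⟫ k _ = ≡.refl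

    ⟪·⟫ : ∀ z a → ⟪ z D.· a ⟫ ≈ κ z * ⟪ a ⟫
    ⟪·⟫ = ·≈κ*

    ⟪⊕⟫ : ∀ a b → ⟪ a D.⊕ b ⟫ ≈ ⟪ a ⟫ + ⟪ b ⟫
    ⟪⊕⟫ a b _ = ≡.refl

    ⟪⊖⟫ : ∀ a b → ⟪ a D.⊖ b ⟫ ≈ ⟪ a ⟫ - ⟪ b ⟫
    ⟪⊖⟫ a b _ = ≡.refl

    ⟪⊛⟫ : ∀ a b → ⟪ a D.⊛ b ⟫ ≈ ⟪ a ⟫ * ⟪ b ⟫
    ⟪⊛⟫ a b _ = ≡.refl

    ⟪⊘⟫ : ∀ a b → ⟪ a D.⊘ b ⟫ ≈ ⟪ a ⟫ * inv ⟪ b ⟫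
    ⟪⊘⟫ a b _ = ≡.refl

    ⟪dil⟫ : ∀ c m a → ⟪ D.dil c m a ⟫ ≈ dil c m ⟪ a ⟫
    ⟪dil⟫ c m a _ = ≡.refl

    coeff-⟪⟫ : ∀ a n → coeff ⟪ a ⟫ n ≡ a n
    coeff-⟪⟫ a n = ≡.refl

    coeff-+ : ∀ a b n → coeff (a + b) n ≡ coeff a n ℤ.+ coeff b n
    coeff-+ a b n = ≡.refl

    coeff-κ* : ∀ z a n → coeff (κ z * a) n ≡ z ℤ.* coeff a n
    coeff-κ* z a n = ≡.sym (·≈κ* z a n)

    coeff-X* : ∀ k a n → coeff (X k * a) (k ℕ.+ n) ≡ coeff a n
    coeff-X* = X^-⊛-+

    coeff-X*-< : ∀ k a n → n < k → coeff (X k * a) n ≡ + 0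
    coeff-X*-< = X^-⊛-<

    coeff-dil : ∀ a n → coeff (dil (+ 1) 3 a) (4 ℕ.* n) ≡ coeff a n
    coeff-dil = dil-4*

    coeff-dil-off : ∀ k a n → suc k < 4 → coeff (dil (+ 1) 3 a) (suc k ℕ.+ 4 ℕ.* n) ≡ + 0
    coeff-dil-off k a zero    k<3 = dil-< (+ 1) 3 a (k ℕ.+ 0) (subst (λ l → suc l < 4) (≡.sym (ℕP.+-identityʳ k)) k<3)
    coeff-dil-off k a (suc n) k<3 = ≡.trans (cong (dil (+ 1) 3 a) (index k n))
      (≡.trans (dil-+ (+ 1) 3 a (suc k ℕ.+ 4 ℕ.* n)) (≡.trans (ℤP.*-identityˡ _) (coeff-dil-off k (tail a) n k<3)))
      where
      index : ∀ k n → suc k ℕ.+ 4 ℕ.* suc n ≡ suc k ℕ.+ 4 ℕ.* n ℕ.+ 4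
      index k n = ≡.trans (cong (suc k ℕ.+_) (≡.trans (ℕP.*-suc 4 n) (ℕP.+-comm 4 (4 ℕ.* n)))) (≡.sym (ℕP.+-assoc (suc k) (4 ℕ.* n) 4))

  bridgeᵈ : ∀ {a x} → FProduct a x → ⟪ a ⟫ ≈ x
  bridgeᵈ (fᵈ k)           = ⟪f⟫ k
  bridgeᵈ (_^ᵈ_ {a} d k)   = trans (pow≈^ a k) (^-congˡ k (bridgeᵈ d))
  bridgeᵈ (_⊛ᵈ_ {a} {b} d e) = trans (⟪⊛⟫ a b) (*-cong (bridgeᵈ d) (bridgeᵈ e))

  bridge : ∀ {a x} → Denotes a x → ⟪ a ⟫ ≈ x
  bridge (fᵉ k)             = ⟪f⟫ k
  bridge (Xᵉ k)             = ⟪X⟫ k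
  bridge (atom a)           = refl
  bridge (_·ᵉ_ {a} z e)     = trans (⟪·⟫ z a) (*-cong refl (bridge e))
  bridge (_^ᵉ_ {a} e k)     = trans (pow≈^ a k) (^-congˡ k (bridge e))
  bridge (_⊕ᵉ_ {a} {b} d e) = trans (⟪⊕⟫ a b) (+-cong (bridge d) (bridge e))
  bridge (_⊖ᵉ_ {a} {b} d e) = trans (⟪⊖⟫ a b) (-‿cong₂ (bridge d) (bridge e))
  bridge (_⊛ᵉ_ {a} {b} d e) = trans (⟪⊛⟫ a b) (*-cong (bridge d) (bridge e))
  bridge (_⊘ᵉ_ {a} {b} d e) = trans (⟪⊘⟫ a b) (*-cong (bridge d)
    (sym (inv-cong (Unit-FProduct e) (sym (bridgeᵈ e)))))

  coeff-bridge : ∀ {a x y} → Denotes a x → x ≈ y → ∀ n → a n ≡ coeff y n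
  coeff-bridge {a} e p n = ≡.trans (≡.sym (coeff-⟪⟫ a n)) (coeff-cong (trans (bridge e) p) n)

  -- Extraction of the residue classes and comparison with the eta quotients.

  private
    hit : ∀ i a n → coeff (X i * T a) (i ℕ.+ 4 ℕ.* n) ≡ coeff a n
    hit i a n = ≡.trans (coeff-X* i (T a) (4 ℕ.* n)) (coeff-dil a n)

    miss : ∀ i k a n → suc k < 4 → coeff (X i * T a) (i ℕ.+ (suc k ℕ.+ 4 ℕ.* n)) ≡ + 0
    miss i k a n k<3 = ≡.trans (coeff-X* i (T a) (suc k ℕ.+ 4 ℕ.* n)) (coeff-dil-off k a n k<3)

    -- For r < i the exponent r + 4n lies below the order i when n = 0, and otherwise equals i +
    -- (k+1) + 4(n-1), off the multiples of 4 by k + 1.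
    miss′ : ∀ r k a n i → suc k < 4 → i ℕ.+ suc k ≡ r ℕ.+ 4 → r < i → coeff (X i * T a) (r ℕ.+ 4 ℕ.* n) ≡ + 0
    miss′ r k a zero    i k<3 eq r<i = coeff-X*-< i (T a) (r ℕ.+ 0) (subst (_< i) (≡.sym (ℕP.+-identityʳ r)) r<i)
    miss′ r k a (suc n) i k<3 eq r<i = ≡.trans (cong (coeff (X i * T a)) index) (miss i k a n k<3)
      where
      index : r ℕ.+ 4 ℕ.* suc n ≡ i ℕ.+ (suc k ℕ.+ 4 ℕ.* n)
      index = ≡.trans (cong (r ℕ.+_) (ℕP.*-suc 4 n)) (≡.trans (≡.sym (ℕP.+-assoc r 4 (4 ℕ.* n)))
        (≡.trans (cong (ℕ._+ 4 ℕ.* n) (≡.sym eq)) (ℕP.+-assoc i (suc k) (4 ℕ.* n))))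

    assemble : Ser → Ser → Ser → Ser → Ser
    assemble a₀ a₁ a₂ a₃ = X 0 * T a₀ + X 1 * T a₁ + X 2 * T a₂ + X 3 * T a₃

    sections : ∀ a₀ a₁ a₂ a₃ m {x₀ x₁ x₂ x₃} →
      coeff (X 0 * T a₀) m ≡ x₀ → coeff (X 1 * T a₁) m ≡ x₁ → coeff (X 2 * T a₂) m ≡ x₂ → coeff (X 3 * T a₃) m ≡ x₃ →
      coeff (assemble a₀ a₁ a₂ a₃) m ≡ x₀ ℤ.+ x₁ ℤ.+ x₂ ℤ.+ x₃
    sections a₀ a₁ a₂ a₃ m p₀ p₁ p₂ p₃ = ≡.trans (coeff-+ _ _ m) (cong₂ ℤ._+_
      (≡.trans (coeff-+ _ _ m) (cong₂ ℤ._+_ (≡.trans (coeff-+ _ _ m) (cong₂ ℤ._+_ p₀ p₁)) p₂)) p₃)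

    2ξ : Ser
    2ξ = κ (+ 2) * (X 1 * ⟪ D.ξ ⟫)

    2ξ-sections : 2ξ ≈ assemble G₀ (κ (+ 2) * G₁) (κ (+ 2) * G₂) (κ (+ 2) * G₃)
    2ξ-sections = trans ξ-dissection (+-cong (+-cong (+-cong
      (lin 2 (λ t x → :- t ·[ x := # 1 ] ∷ [] ⊢ t := x :* t) X-0) (d G₁)) (d G₂)) (d G₃))
      where
      d : ∀ {x} G → x * (κ (+ 2) * T G) ≈ x * T (κ (+ 2) * G)
      d G = *-cong refl (sym (dil-κ* _ _ _ G))

    coeff-2ξ : ∀ n → coeff 2ξ (suc n) ≡ + 2 ℤ.* D.pξ n
    coeff-2ξ n = ≡.trans (coeff-κ* (+ 2) _ (suc n)) (cong (+ 2 ℤ.*_) (≡.trans (coeff-X* 1 ⟪ D.ξ ⟫ n) (coeff-⟪⟫ D.ξ n)))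

    pattern 0< = s≤s z≤n
    pattern 1< = s≤s 0<
    pattern 2< = s≤s 1<
    pattern 3< = s≤s 2<

    -- The division by 2 happens only here, between integers.
    halve : ∀ G m n → coeff 2ξ (suc m) ≡ coeff (κ (+ 2) * G) n → D.pξ m ≡ coeff G n
    halve G m n p = ℤP.*-cancelˡ-≡ (+ 2) _ _ (≡.trans (≡.sym (coeff-2ξ m)) (≡.trans p (coeff-κ* (+ 2) G n)))

  section₀ : ∀ n → coeff 2ξ (4 ℕ.* n) ≡ coeff G₀ n
  section₀ n = ≡.trans (coeff-cong 2ξ-sections _) (≡.trans
    (sections _ _ _ _ (4 ℕ.* n) (hit 0 _ n) (miss′ 0 2 _ n 1 3< ≡.refl 0<) (miss′ 0 1 _ n 2 2< ≡.refl 0<)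
      (miss′ 0 0 _ n 3 1< ≡.refl 0<))
    (≡.trans (ℤP.+-identityʳ _) (≡.trans (ℤP.+-identityʳ _) (ℤP.+-identityʳ _))))

  section₁ : ∀ n → D.pξ (4 ℕ.* n) ≡ coeff G₁ n
  section₁ n = halve G₁ (4 ℕ.* n) n (≡.trans (coeff-cong 2ξ-sections _) (≡.trans
    (sections _ _ _ _ (1 ℕ.+ 4 ℕ.* n) (miss 0 0 _ n 1<) (hit 1 _ n)
      (miss′ 1 2 _ n 2 3< ≡.refl 1<) (miss′ 1 1 _ n 3 2< ≡.refl 1<))
    (≡.trans (ℤP.+-identityʳ _) (≡.trans (ℤP.+-identityʳ _) (ℤP.+-identityˡ _)))))

  section₂ : ∀ n → D.pξ (4 ℕ.* n ℕ.+ 1) ≡ coeff G₂ n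
  section₂ n = ≡.trans (cong D.pξ (ℕP.+-comm (4 ℕ.* n) 1)) (halve G₂ (1 ℕ.+ 4 ℕ.* n) n (≡.trans (coeff-cong 2ξ-sections _) (≡.trans
    (sections _ _ _ _ (2 ℕ.+ 4 ℕ.* n) (miss 0 1 _ n 2<) (miss 1 0 _ n 1<) (hit 2 _ n) (miss′ 2 2 _ n 3 3< ≡.refl 2<))
    (≡.trans (ℤP.+-identityʳ _) (ℤP.+-identityˡ _)))))

  section₃ : ∀ n → D.pξ (4 ℕ.* n ℕ.+ 2) ≡ coeff G₃ n
  section₃ n = ≡.trans (cong D.pξ (ℕP.+-comm (4 ℕ.* n) 2)) (halve G₃ (2 ℕ.+ 4 ℕ.* n) n (≡.trans (coeff-cong 2ξ-sections _) (≡.trans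
    (sections _ _ _ _ (3 ℕ.+ 4 ℕ.* n) (miss 0 2 _ n 3<) (miss 1 1 _ n 2<) (miss 2 0 _ n 1<) (hit 3 _ n))
    (ℤP.+-identityˡ _))))

  private
    frac : ∀ {a d N t} → FProduct a d → N ≈ t * d → N * inv d ≈ t
    frac d p = lin 4 (λ d i N t → i ·[ N := t :* d ] ∷ t ·[ d :* i := # 1 ] ∷ [] ⊢ N :* i := t)
      p (*-inv (Unit-FProduct d))

    f₃i : f 3 ^ 2 * inv (f 3 ^ 2) ≈ 1#
    f₃i = *-inv (Unit-^ 2 (Unit-f 2))

  -- The right sides of the theorem in reified form; their types are inferred, and the first index
  -- is the coefficient function that the statement spells out.
  e₀ = fᵉ 6 ^ᵉ 15 ⊘ᵉ (fᵈ 3 ^ᵈ 8 ⊛ᵈ fᵈ 12 ^ᵈ 6) ⊖ᵉ atom (D.dil (+ 1) 5 D.mockf)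
    ⊕ᵉ (+ 4) ·ᵉ Xᵉ 1 ⊛ᵉ fᵉ 2 ^ᵉ 4 ⊛ᵉ fᵉ 12 ^ᵉ 2 ⊘ᵉ (fᵈ 1 ^ᵈ 2 ⊛ᵈ fᵈ 3 ^ᵈ 2 ⊛ᵈ fᵈ 6)
  e₁ = (+ 4) ·ᵉ Xᵉ 2 ⊛ᵉ fᵉ 12 ^ᵉ 6 ⊘ᵉ (fᵈ 3 ^ᵈ 2 ⊛ᵈ fᵈ 6 ^ᵈ 3)
    ⊖ᵉ Xᵉ 2 ⊛ᵉ atom (D.dil (ℤ.- (+ 1)) 2 D.ω)
    ⊕ᵉ fᵉ 2 ^ᵉ 4 ⊛ᵉ fᵉ 6 ^ᵉ 5 ⊘ᵉ (fᵈ 1 ^ᵈ 2 ⊛ᵈ fᵈ 3 ^ᵈ 4 ⊛ᵈ fᵈ 12 ^ᵈ 2)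
  e₂ = (+ 2) ·ᵉ Xᵉ 1 ⊛ᵉ fᵉ 6 ^ᵉ 3 ⊛ᵉ fᵉ 12 ^ᵉ 2 ⊘ᵉ fᵈ 3 ^ᵈ 4
    ⊕ᵉ (+ 2) ·ᵉ (fᵉ 4 ^ᵉ 4) ⊛ᵉ fᵉ 6 ^ᵉ 5 ⊘ᵉ (fᵈ 2 ^ᵈ 2 ⊛ᵈ fᵈ 3 ^ᵈ 4 ⊛ᵈ fᵈ 12 ^ᵈ 2)
  e₃ = fᵉ 6 ^ᵉ 9 ⊘ᵉ (fᵈ 3 ^ᵈ 6 ⊛ᵈ fᵈ 12 ^ᵈ 2)
    ⊕ᵉ fᵉ 2 ^ᵉ 10 ⊛ᵉ fᵉ 12 ^ᵉ 2 ⊘ᵉ (fᵈ 1 ^ᵈ 4 ⊛ᵈ fᵈ 3 ^ᵈ 2 ⊛ᵈ fᵈ 4 ^ᵈ 4 ⊛ᵈ fᵈ 6)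

  e₀≈ : _ ≈ G₀
  e₀≈ = +-cong
    (-‿cong₂
      (frac (fᵈ 3 ^ᵈ 8 ⊛ᵈ fᵈ 12 ^ᵈ 6) (lin 5 (λ f₃ f₆ f₁₂ φ₃ i →
        let a = φ₃ :* (f₃ :^ 2 :* f₁₂ :^ 2) in
        :- (φ₃ :^ 3 :* f₃ :^ 6 :* f₁₂ :^ 6) ·[ f₃ :^ 2 :* i := # 1 ] ∷
        :- (a :^ 2 :+ a :* f₆ :^ 5 :+ f₆ :^ 10) ·[ a := f₆ :^ 5 ] ∷ [] ⊢
        f₆ :^ 15 := φ₃ :^ 3 :* i :* (f₃ :^ 8 :* f₁₂ :^ 6))
        f₃i (φ-f 2)))
      (⟪dil⟫ (+ 1) 5 D.mockf))
    (frac (fᵈ 1 ^ᵈ 2 ⊛ᵈ fᵈ 3 ^ᵈ 2 ⊛ᵈ fᵈ 6) (lin 11 (λ x f₁ f₂ f₃ f₆ f₁₂ φ₁ ψ₁ ψ₂ ψ₆ i →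
      :- (# 4 :* x :* ψ₂ :* φ₁ :* ψ₆ :* f₁ :^ 2 :* f₆) ·[ f₃ :^ 2 :* i := # 1 ] ∷
      :- (# 4 :* x :* ψ₂ :* φ₁ :* f₁ :^ 2) ·[ ψ₆ :* f₆ := f₁₂ :^ 2 ] ∷
      # 4 :* x :* f₁ :^ 2 :* f₁₂ :^ 2 ·[ ψ₁ :* ψ₁ := φ₁ :* ψ₂ ] ∷
      :- (# 4 :* x :* f₁₂ :^ 2 :* (ψ₁ :* f₁ :+ f₂ :^ 2)) ·[ ψ₁ :* f₁ := f₂ :^ 2 ] ∷ [] ⊢
      # 4 :* x :* f₂ :^ 4 :* f₁₂ :^ 2 := (# 4 :* x :* (ψ₂ :* φ₁ :* ψ₆ :* i)) :* (f₁ :^ 2 :* f₃ :^ 2 :* f₆))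
      f₃i (ψ-f 5) (ψ² 0 ≡.refl) (ψ-f 0)))

  e₁≈ : _ ≈ G₁
  e₁≈ = +-cong
    (-‿cong₂
      (frac (fᵈ 3 ^ᵈ 2 ⊛ᵈ fᵈ 6 ^ᵈ 3) (lin 6 (λ x f₃ f₆ f₁₂ ψ₆ i →
        let a = ψ₆ :* f₆ in
        :- (# 4 :* x :* ψ₆ :^ 3 :* f₆ :^ 3) ·[ f₃ :^ 2 :* i := # 1 ] ∷
        :- (# 4 :* x :* (a :^ 2 :+ a :* f₁₂ :^ 2 :+ f₁₂ :^ 4)) ·[ a := f₁₂ :^ 2 ] ∷ [] ⊢
        # 4 :* x :* f₁₂ :^ 6 := (# 4 :* x :* (ψ₆ :^ 3 :* i)) :* (f₃ :^ 2 :* f₆ :^ 3))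
        f₃i (ψ-f 5)))
      (*-cong refl (⟪dil⟫ (ℤ.- (+ 1)) 2 D.ω)))
    (frac (fᵈ 1 ^ᵈ 2 ⊛ᵈ fᵈ 3 ^ᵈ 4 ⊛ᵈ fᵈ 12 ^ᵈ 2) (lin 10 (λ f₁ f₂ f₃ f₆ f₁₂ φ₁ φ₃ ψ₁ ψ₂ i →
      :- (φ₁ :* φ₃ :* ψ₂ :* f₁ :^ 2 :* f₃ :^ 2 :* f₁₂ :^ 2) ·[ f₃ :^ 2 :* i := # 1 ] ∷
      :- (φ₁ :* ψ₂ :* f₁ :^ 2) ·[ φ₃ :* (f₃ :^ 2 :* f₁₂ :^ 2) := f₆ :^ 5 ] ∷
      f₁ :^ 2 :* f₆ :^ 5 ·[ ψ₁ :* ψ₁ := φ₁ :* ψ₂ ] ∷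
      :- (f₆ :^ 5 :* (ψ₁ :* f₁ :+ f₂ :^ 2)) ·[ ψ₁ :* f₁ := f₂ :^ 2 ] ∷ [] ⊢
      f₂ :^ 4 :* f₆ :^ 5 := (φ₁ :* φ₃ :* ψ₂ :* i) :* (f₁ :^ 2 :* f₃ :^ 4 :* f₁₂ :^ 2))
      f₃i (φ-f 2) (ψ² 0 ≡.refl) (ψ-f 0)))

  e₂≈ : _ ≈ G₂
  e₂≈ = +-cong
    (frac (fᵈ 3 ^ᵈ 4) (lin 8 (λ x f₃ f₆ f₁₂ φ₃ ψ₃ ψ₆ i →
      :- (# 2 :* x :* ψ₆ :^ 2 :* φ₃ :* f₃ :^ 2) ·[ f₃ :^ 2 :* i := # 1 ] ∷
      # 2 :* x :* ψ₆ :* f₃ :^ 2 ·[ ψ₃ :* ψ₃ := φ₃ :* ψ₆ ] ∷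
      :- (# 2 :* x :* ψ₆ :* (ψ₃ :* f₃ :+ f₆ :^ 2)) ·[ ψ₃ :* f₃ := f₆ :^ 2 ] ∷
      :- (# 2 :* x :* f₆ :^ 3) ·[ ψ₆ :* f₆ := f₁₂ :^ 2 ] ∷ [] ⊢
      # 2 :* x :* f₆ :^ 3 :* f₁₂ :^ 2 := (# 2 :* x :* (ψ₆ :^ 2 :* φ₃ :* i)) :* f₃ :^ 4)
      f₃i (ψ² 2 ≡.refl) (ψ-f 2) (ψ-f 5)))
    (frac (fᵈ 2 ^ᵈ 2 ⊛ᵈ fᵈ 3 ^ᵈ 4 ⊛ᵈ fᵈ 12 ^ᵈ 2) (lin 8 (λ f₂ f₃ f₄ f₆ f₁₂ φ₃ ψ₂ i →
      :- (# 2 :* ψ₂ :^ 2 :* φ₃ :* f₂ :^ 2 :* f₃ :^ 2 :* f₁₂ :^ 2) ·[ f₃ :^ 2 :* i := # 1 ] ∷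
      :- (# 2 :* ψ₂ :^ 2 :* f₂ :^ 2) ·[ φ₃ :* (f₃ :^ 2 :* f₁₂ :^ 2) := f₆ :^ 5 ] ∷
      :- (# 2 :* f₆ :^ 5 :* (ψ₂ :* f₂ :+ f₄ :^ 2)) ·[ ψ₂ :* f₂ := f₄ :^ 2 ] ∷ [] ⊢
      # 2 :* f₄ :^ 4 :* f₆ :^ 5 := (# 2 :* (ψ₂ :^ 2 :* φ₃ :* i)) :* (f₂ :^ 2 :* f₃ :^ 4 :* f₁₂ :^ 2))
      f₃i (φ-f 2) (ψ-f 1)))

  e₃≈ : _ ≈ G₃
  e₃≈ = +-cong
    (frac (fᵈ 3 ^ᵈ 6 ⊛ᵈ fᵈ 12 ^ᵈ 2) (lin 7 (λ f₃ f₆ f₁₂ φ₃ ψ₃ ψ₆ i →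
      :- (ψ₆ :* φ₃ :^ 2 :* f₃ :^ 4 :* f₁₂ :^ 2) ·[ f₃ :^ 2 :* i := # 1 ] ∷
      φ₃ :* f₃ :^ 4 :* f₁₂ :^ 2 ·[ ψ₃ :* ψ₃ := φ₃ :* ψ₆ ] ∷
      :- (f₃ :^ 2 :* ψ₃ :^ 2) ·[ φ₃ :* (f₃ :^ 2 :* f₁₂ :^ 2) := f₆ :^ 5 ] ∷
      :- (f₆ :^ 5 :* (ψ₃ :* f₃ :+ f₆ :^ 2)) ·[ ψ₃ :* f₃ := f₆ :^ 2 ] ∷ [] ⊢
      f₆ :^ 9 := (ψ₆ :* φ₃ :^ 2 :* i) :* (f₃ :^ 6 :* f₁₂ :^ 2))
      f₃i (ψ² 2 ≡.refl) (φ-f 2) (ψ-f 2)))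
    (frac (fᵈ 1 ^ᵈ 4 ⊛ᵈ fᵈ 3 ^ᵈ 2 ⊛ᵈ fᵈ 4 ^ᵈ 4 ⊛ᵈ fᵈ 6) (lin 9 (λ f₁ f₂ f₃ f₄ f₆ f₁₂ φ₁ ψ₆ i →
      :- (φ₁ :^ 2 :* ψ₆ :* f₁ :^ 4 :* f₄ :^ 4 :* f₆) ·[ f₃ :^ 2 :* i := # 1 ] ∷
      :- (φ₁ :^ 2 :* f₁ :^ 4 :* f₄ :^ 4) ·[ ψ₆ :* f₆ := f₁₂ :^ 2 ] ∷
      :- (f₁₂ :^ 2 :* (φ₁ :* (f₁ :^ 2 :* f₄ :^ 2) :+ f₂ :^ 5)) ·[ φ₁ :* (f₁ :^ 2 :* f₄ :^ 2) := f₂ :^ 5 ] ∷ [] ⊢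
      f₂ :^ 10 :* f₁₂ :^ 2 := (φ₁ :^ 2 :* ψ₆ :* i) :* (f₁ :^ 4 :* f₃ :^ 2 :* f₄ :^ 4 :* f₆))
      f₃i (ψ-f 5) (φ-f 0)))

  -- The coefficient of q^(n+1) matches because 4(n+1) = (4n+3) + 1; the constant terms are 0 on
  -- both sides, since 2qξ has the factor q.
  part₀ : ∀ n → ((+ 2) D.· D.X^ 1 D.⊛ (λ n → D.pξ (4 ℕ.* n ℕ.+ 3))) n ≡ coeff G₀ n
  part₀ n = ≡.trans (coeff-bridge ((+ 2) ·ᵉ Xᵉ 1 ⊛ᵉ atom p₃) (*-assoc _ _ _) n) (≡.trans (go n) (section₀ n))
    where
    p₃ : D.PS
    p₃ n = D.pξ (4 ℕ.* n ℕ.+ 3)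
    go : ∀ n → coeff (κ (+ 2) * (X 1 * ⟪ p₃ ⟫)) n ≡ coeff 2ξ (4 ℕ.* n)
    go zero    = ≡.trans (≡.trans (coeff-κ* (+ 2) _ 0) (cong (+ 2 ℤ.*_) (coeff-X*-< 1 _ 0 0<)))
      (≡.sym (≡.trans (coeff-κ* (+ 2) _ 0) (cong (+ 2 ℤ.*_) (coeff-X*-< 1 _ 0 0<))))
    go (suc n) = ≡.trans (≡.trans (coeff-κ* (+ 2) _ (suc n)) (cong (+ 2 ℤ.*_) (≡.trans (coeff-X* 1 ⟪ p₃ ⟫ n) (coeff-⟪⟫ p₃ n))))
      (≡.sym (≡.trans (cong (coeff 2ξ) (≡.trans (ℕP.*-suc 4 n) (cong suc (ℕP.+-comm 3 (4 ℕ.* n))))) (coeff-2ξ (4 ℕ.* n ℕ.+ 3))))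

open import Defs
open import Data.Nat using (_+_; _*_)
open import Data.Integer using (-_)
open Dissection using (coeff-bridge; part₀; section₁; section₂; section₃; e₀; e₁; e₂; e₃; e₀≈; e₁≈; e₂≈; e₃≈)

theorem3p3 :
    ((λ n → pξ (4 * n))
      ≈ (+ 4) · X^ 2 ⊛ pow (fq 12) 6 ⊘ (pow (fq 3) 2 ⊛ pow (fq 6) 3)
        ⊖ X^ 2 ⊛ dil (- + 1) 2 ω
        ⊕ pow (fq 2) 4 ⊛ pow (fq 6) 5
            ⊘ (pow (fq 1) 2 ⊛ pow (fq 3) 4 ⊛ pow (fq 12) 2))
  × ((λ n → pξ (4 * n + 1))
      ≈ (+ 2) · X^ 1 ⊛ pow (fq 6) 3 ⊛ pow (fq 12) 2 ⊘ pow (fq 3) 4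
        ⊕ (+ 2) · pow (fq 4) 4 ⊛ pow (fq 6) 5
            ⊘ (pow (fq 2) 2 ⊛ pow (fq 3) 4 ⊛ pow (fq 12) 2))
  × ((λ n → pξ (4 * n + 2))
      ≈ pow (fq 6) 9 ⊘ (pow (fq 3) 6 ⊛ pow (fq 12) 2)
        ⊕ pow (fq 2) 10 ⊛ pow (fq 12) 2
            ⊘ (pow (fq 1) 4 ⊛ pow (fq 3) 2 ⊛ pow (fq 4) 4 ⊛ fq 6))
  × ((+ 2) · X^ 1 ⊛ (λ n → pξ (4 * n + 3))
      ≈ pow (fq 6) 15 ⊘ (pow (fq 3) 8 ⊛ pow (fq 12) 6)
        ⊖ dil (+ 1) 5 mockf
        ⊕ (+ 4) · X^ 1 ⊛ pow (fq 2) 4 ⊛ pow (fq 12) 2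
            ⊘ (pow (fq 1) 2 ⊛ pow (fq 3) 2 ⊛ fq 6))
theorem3p3 =
  (λ n → ≡.trans (section₁ n) (≡.sym (coeff-bridge e₁ e₁≈ n))) ,
  (λ n → ≡.trans (section₂ n) (≡.sym (coeff-bridge e₂ e₂≈ n))) ,
  (λ n → ≡.trans (section₃ n) (≡.sym (coeff-bridge e₃ e₃≈ n))) ,
  (λ n → ≡.trans (part₀ n) (≡.sym (coeff-bridge e₀ e₀≈ n)))
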